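{- Let $q\equiv1\pmod4$ be a prime power and let $\mathcal U_3$, $\mathcal X^+$, $\mathfrak G$, $\mathfrak H$ be as in the context. Then: (C) $\mathfrak H$ has index $2$ in $\mathfrak G$, and $\mathfrak G$ and $\mathfrak H$ have the same orbits on $\mathcal X^+(\mathbb F_{q^2})$; (D) for every $\mathfrak G$-orbit $o$ on $\mathcal X^+(\mathbb F_{q^2})$, letting $\mathcal G_o$ be the set of generators of $\mathcal U_3$ meeting $o$, the group $\mathfrak G$ acts transitively on $\mathcal G_o$ while $\mathfrak H$ has two orbits on $\mathcal G_o$.
   Context: $q$ is a power of an odd prime $p$, $q\equiv1\pmod4$. In $\mathrm{PG}(3,q^2)$ with coordinates $(X_0,X_1,X_2,X_3)$ (points as column vectors, matrices acting by $x\mapsto Ax$), $\mathcal U_3$ is the Hermitian surface $X_1^{q+1}+2X_2^{q+1}=X_3^qX_0+X_3X_0^q$; a generator is a line of $\mathrm{PG}(3,q^2)$ contained in $\mathcal U_3$. $\mathcal X^+$ is the non-singular model in $\mathrm{PG}(3,\overline{\mathbb F}_{q^2})$ of the plane curve $y^qz-yz^q=x^{(q+1)/2}$ given by $(x,y,z)\mapsto(z^2,xz,yz,y^2)$; it is an $\mathbb F_{q^2}$-maximal curve of degree $q+1$ lying on $\mathcal U_3$, and $\mathcal X^+(\mathbb F_{q^2})$ is its set of $\mathbb F_{q^2}$-rational points. $\mathfrak G\le\mathrm{PGU}(4,q)$ is generated by the collineations with matrices $\mathbf T_\alpha=\begin{pmatrix}1&0&0&0\\0&1&0&0\\ \alpha&0&1&0\\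 \alpha^2&0&2\alpha&1\end{pmatrix}$ ($\alpha\in\mathbb F_q$), $\mathbf M_\rho=\mathrm{diag}(\rho^{ -1},1,1,\rho)$ ($\rho$ non-zero square in $\mathbb F_q$), $\mathbf L_\lambda=\mathrm{diag}(1,\lambda,1,1)$ ($\lambda\in\mathbb F_{q^2}$, $\lambda^{(q+1)/2}=1$), $\mathbf N_\sigma=\begin{pmatrix}0&0&0&1\\0&\sigma&0&0\\0&0&1&0\\1&0&0&0\end{pmatrix}$ ($\sigma\in\mathbb F_{q^2}$, $\sigma^{(q+1)/2}=-1$), $\mathbf R_\mu=\begin{pmatrix}0&0&0&\mu^{ -1}\\0&1&0&0\\0&0&1&0\\ \mu&0&0&0\end{pmatrix}$ ($\mu$ non-square in $\mathbb F_q$); these preserve $\mathcal X^+$. $\mathfrak H$ is the subgroup of $\mathfrak G$ generated by all elements of $p$-power order together with the collineations $\mathbf L_\lambda$. -}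

module Defs where

open import Level using (0ℓ)
open import Data.Nat as ℕ using (ℕ; zero; suc)
open import Data.Nat.DivMod using (_/_)
open import Data.Fin using (Fin; zero; suc)
open import Data.Vec using (Vec; []; _∷_; lookup)
open import Data.Product using (Σ; ∃; ∃₂; _×_; _,_; proj₁; proj₂)
open import Data.Sum using (_⊎_)
open import Relation.Binary.PropositionalEquality using (_≡_; _≢_)
open import Relation.Nullary using (¬_)
open import Algebra.Structures using (IsCommutativeRing)

record Field : Set₁ where
  infixl 6 _+_
  infixl 7 _*_
  field
    Carrier : Set
    _+_ _*_ : Carrier → Carrier → Carrier
    -_ : Carrier → Carrier
    0# 1# : Carrier
    isCommutativeRing : IsCommutativeRing _≡_ _+_ _*_ -_ 0# 1#
    0≢1 : 0# ≢ 1#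
    inverse : ∀ x → x ≢ 0# → ∃ λ y → x * y ≡ 1#

-- The geometry of Theorem 5.13, over a field K (playing F_{q^2}),
-- with p the characteristic prime and q the prime power.

module Geometry (K : Field) (p q : ℕ) where
  open Field K

  _-_ : Carrier → Carrier → Carrier
  x - y = x + (- y)

  2# : Carrier
  2# = 1# + 1#

  _^_ : Carrier → ℕ → Carrier
  x ^ zero  = 1#
  x ^ suc n = x * (x ^ n)

  half : ℕ
  half = (q ℕ.+ 1) / 2

  InFq : Carrier → Set
  InFq x = x ^ q ≡ x

  NonZeroSquareFq : Carrier → Set
  NonZeroSquareFq ρ = InFq ρ × ρ ≢ 0# × ∃ λ s → InFq s × s * s ≡ ρ

  NonSquareFq : Carrier → Set
  NonSquareFq μ = InFq μ × ¬ (∃ λ s → InFq s × s * s ≡ μ)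

  Vec4 : Set
  Vec4 = Fin 4 → Carrier

  Mat : Set
  Mat = Fin 4 → Fin 4 → Carrier

  sum4 : (Fin 4 → Carrier) → Carrier
  sum4 f = f zero + f (suc zero) + f (suc (suc zero)) + f (suc (suc (suc zero)))

  X0 X1 X2 X3 : Fin 4
  X0 = zero
  X1 = suc zero
  X2 = suc (suc zero)
  X3 = suc (suc (suc zero))

  vec : Carrier → Carrier → Carrier → Carrier → Vec4
  vec a b c d i = lookup (a ∷ b ∷ c ∷ d ∷ []) i

  fromRows : Vec (Vec Carrier 4) 4 → Mat
  fromRows m i j = lookup (lookup m i) j

  apply : Mat → Vec4 → Vec4
  apply A x i = sum4 (λ j → A i j * x j)

  _⊗_ : Mat → Mat → Mat
  (A ⊗ B) i k = sum4 (λ j → A i j * B j k)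

  Id : Mat
  Id = fromRows ((1# ∷ 0# ∷ 0# ∷ 0# ∷ []) ∷ (0# ∷ 1# ∷ 0# ∷ 0# ∷ []) ∷
                 (0# ∷ 0# ∷ 1# ∷ 0# ∷ []) ∷ (0# ∷ 0# ∷ 0# ∷ 1# ∷ []) ∷ [])

  mpow : Mat → ℕ → Mat
  mpow A zero    = Id
  mpow A (suc n) = A ⊗ mpow A n

  -- projective equality (points of PG(3,q^2), elements of PGL(4,q^2))

  NonZeroVec : Vec4 → Set
  NonZeroVec v = ¬ (∀ i → v i ≡ 0#)

  _∼_ : Vec4 → Vec4 → Set
  v ∼ w = ∃ λ c → c ≢ 0# × (∀ i → w i ≡ c * v i)

  _≃_ : Mat → Mat → Set
  A ≃ B = ∃ λ c → c ≢ 0# × (∀ i j → B i j ≡ c * A i j)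

  OnU3 : Vec4 → Set
  OnU3 v = (v X1 ^ (q ℕ.+ 1)) + 2# * (v X2 ^ (q ℕ.+ 1))
           ≡ (v X3 ^ q) * v X0 + v X3 * (v X0 ^ q)

  -- F_{q^2}-rational points of X^+ : images (1,x,y,y^2) of the affine
  -- points of y^q - y = x^{(q+1)/2}, together with the image (0,0,0,1)
  -- of the unique point at infinity.
  InXplus : Vec4 → Set
  InXplus v = (∃₂ λ x y → (y ^ q) - y ≡ x ^ half × v ∼ vec 1# x y (y * y))
              ⊎ v ∼ vec 0# 0# 0# 1#

  T : Carrier → Mat
  T α = fromRows ((1# ∷ 0# ∷ 0# ∷ 0# ∷ []) ∷ (0# ∷ 1# ∷ 0# ∷ 0# ∷ []) ∷
                  (α ∷ 0# ∷ 1# ∷ 0# ∷ []) ∷ ((α * α) ∷ 0# ∷ (2# * α) ∷ 1# ∷ []) ∷ [])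

  M : Carrier → Carrier → Mat
  M ρinv ρ = fromRows ((ρinv ∷ 0# ∷ 0# ∷ 0# ∷ []) ∷ (0# ∷ 1# ∷ 0# ∷ 0# ∷ []) ∷
                       (0# ∷ 0# ∷ 1# ∷ 0# ∷ []) ∷ (0# ∷ 0# ∷ 0# ∷ ρ ∷ []) ∷ [])

  L : Carrier → Mat
  L lam = fromRows ((1# ∷ 0# ∷ 0# ∷ 0# ∷ []) ∷ (0# ∷ lam ∷ 0# ∷ 0# ∷ []) ∷
                    (0# ∷ 0# ∷ 1# ∷ 0# ∷ []) ∷ (0# ∷ 0# ∷ 0# ∷ 1# ∷ []) ∷ [])

  N : Carrier → Mat
  N σ = fromRows ((0# ∷ 0# ∷ 0# ∷ 1# ∷ []) ∷ (0# ∷ σ ∷ 0# ∷ 0# ∷ []) ∷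
                  (0# ∷ 0# ∷ 1# ∷ 0# ∷ []) ∷ (1# ∷ 0# ∷ 0# ∷ 0# ∷ []) ∷ [])

  R : Carrier → Carrier → Mat
  R μinv μ = fromRows ((0# ∷ 0# ∷ 0# ∷ μinv ∷ []) ∷ (0# ∷ 1# ∷ 0# ∷ 0# ∷ []) ∷
                       (0# ∷ 0# ∷ 1# ∷ 0# ∷ []) ∷ (μ ∷ 0# ∷ 0# ∷ 0# ∷ []) ∷ [])

  data GenG : Mat → Set where
    genT : ∀ α → InFq α → GenG (T α)
    genM : ∀ ρinv ρ → NonZeroSquareFq ρ → ρinv * ρ ≡ 1# → GenG (M ρinv ρ)
    genL : ∀ lam → lam ^ half ≡ 1# → GenG (L lam)
    genN : ∀ σ → σ ^ half ≡ - 1# → GenG (N σ)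
    genR : ∀ μinv μ → NonSquareFq μ → μinv * μ ≡ 1# → GenG (R μinv μ)

  -- the subgroup of PGL(4,q^2) generated by a set S of matrices, as the
  -- set of matrices representing its elements (closed under scalars)
  data ⟨_⟩ (S : Mat → Set) : Mat → Set where
    gen   : ∀ {A} → S A → ⟨ S ⟩ A
    one   : ⟨ S ⟩ Id
    mul   : ∀ {A B} → ⟨ S ⟩ A → ⟨ S ⟩ B → ⟨ S ⟩ (A ⊗ B)
    inv   : ∀ {A B} → ⟨ S ⟩ A → (A ⊗ B) ≃ Id → ⟨ S ⟩ B
    resc  : ∀ {A B} → ⟨ S ⟩ A → A ≃ B → ⟨ S ⟩ B

  𝔊 : Mat → Set
  𝔊 = ⟨ GenG ⟩

  PPowerOrder : Mat → Set
  PPowerOrder A = ∃ λ k → mpow A (p ℕ.^ k) ≃ Id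

  data GenH : Mat → Set where
    genP : ∀ {A} → 𝔊 A → PPowerOrder A → GenH A
    genL : ∀ lam → lam ^ half ≡ 1# → GenH (L lam)

  ℌ : Mat → Set
  ℌ = ⟨ GenH ⟩

  Orbit : (Mat → Set) → Vec4 → Vec4 → Set
  Orbit S P Q = ∃ λ A → S A × apply A P ∼ Q

  -- lines of PG(3,q^2), given by two spanning vectors

  Line : Set
  Line = Vec4 × Vec4

  comb : Carrier → Vec4 → Carrier → Vec4 → Vec4
  comb a u b v i = a * u i + b * v i

  Independent : Line → Set
  Independent (u , v) = ∀ a b → (∀ i → comb a u b v i ≡ 0#) → a ≡ 0# × b ≡ 0#

  OnLine : Line → Vec4 → Set
  OnLine (u , v) w = ∃₂ λ a b → ∀ i → w i ≡ comb a u b v i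

  SameLine : Line → Line → Set
  SameLine l (u' , v') = OnLine l u' × OnLine l v' × OnLine (u' , v') (proj₁ l) × OnLine (u' , v') (proj₂ l)

  IsGenerator : Line → Set
  IsGenerator (u , v) = Independent (u , v) × (∀ a b → OnU3 (comb a u b v))

  MeetsOrbit : Vec4 → Line → Set
  MeetsOrbit P l = ∃ λ w → OnLine l w × NonZeroVec w × Orbit 𝔊 P w

  InGo : Vec4 → Line → Set
  InGo P l = IsGenerator l × MeetsOrbit P l

  LineOrbit : (Mat → Set) → Line → Line → Set
  LineOrbit S (u , v) l' = ∃ λ A → S A × SameLine (apply A u , apply A v) l'

  IndexTwo : Set
  IndexTwo = ∃ λ g0 → 𝔊 g0 × ¬ ℌ g0 ×
               (∀ g → 𝔊 g → ℌ g ⊎ ∃ λ h → ℌ h × g ≃ (g0 ⊗ h))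

  SameOrbits : Set
  SameOrbits = ∀ P Q → InXplus P → InXplus Q →
                 (Orbit 𝔊 P Q → Orbit ℌ P Q) × (Orbit ℌ P Q → Orbit 𝔊 P Q)

  PartD : Set
  PartD = ∀ P → InXplus P →
            (∀ l l' → InGo P l → InGo P l' → LineOrbit 𝔊 l l')
            × (∃₂ λ l₁ l₂ → InGo P l₁ × InGo P l₂ × ¬ LineOrbit ℌ l₁ l₂ ×
                 (∀ l → InGo P l → LineOrbit ℌ l₁ l ⊎ LineOrbit ℌ l₂ l))

  Theorem5p13 : Set
  Theorem5p13 = (IndexTwo × SameOrbits) × PartD

{-# OPTIONS --safe #-}
module Submission where

-- With h = (q+1)/2, the elements of 𝔊 are, up to scalars, the collineations induced on X⁺ by
-- y ↦ (ay+b)/(cy+d), x ↦ κx/(cy+d)², where a, b, c, d ∈ F_q, D = ad - bc ≠ 0 and κ^h = D.  The quadratic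
-- character of D is a homomorphism 𝔊 → {±1}.  It is trivial on the L_λ and on elements of odd order, and
-- its kernel is generated by the L_λ and the elementary matrices of SL₂(q), which have order p; so the
-- kernel is ℌ.  At a point P of X⁺ the tangent plane of U₃ has an orthogonal basis P, V, W in which
-- the generators through P are the lines joining P to V + βW with β^(q+1) = ν.  The stabiliser of P
-- acts on them by β ↦ ζβ, ζ^(q+1) = 1, with character ζ^h: it is transitive on the generators through P
-- and contains elements outside ℌ, whence the equality of orbits and the transitivity.  A generator carries
-- at most one point of each orbit on X⁺, so β and -β, with (-1)^h = -1, lie in different ℌ-orbits.

open import Defs
open import Level using (0ℓ)
open import Data.Bool using (Bool; true; false)
open import Data.Empty using (⊥-elim)
open import Data.Fin as Fin using (Fin; zero; suc; punchIn; punchOut; toℕ; fromℕ; inject₁)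
open import Data.Fin.Patterns using (0F; 1F; 2F; 3F)
open import Data.Fin.Permutation using (Permutation; permutation)
import Data.Fin.Properties as Finₚ
open import Data.Integer as ℤ using (ℤ; -[1+_]; _⊖_) renaming (+_ to pos)
import Data.Integer.Properties as ℤₚ
open import Data.List using ([]; _∷_; length; filter; tabulate)
open import Data.List.Membership.Propositional using (_∈_; find; lose)
open import Data.List.Membership.Propositional.Properties using (∈-filter⁺; ∈-filter⁻; ∈-tabulate⁺; ∈-tabulate⁻)
open import Data.List.Properties using (length-tabulate)
open import Data.List.Relation.Unary.All as All using (All; []; _∷_)
open import Data.List.Relation.Unary.All.Properties using (all-filter)
open import Data.List.Relation.Unary.AllPairs using ([]; _∷_)
open import Data.List.Relation.Unary.Any using (here; there; any?)
open import Data.List.Relation.Unary.Unique.Propositional using (Unique)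
import Data.List.Relation.Unary.Unique.Propositional.Properties as Uniqueₚ
open import Data.Maybe using (nothing)
open import Data.Nat as ℕ using (ℕ; zero; suc; z≤n; s≤s; _!)
open import Data.Nat.Combinatorics using (nCk≡n!/k![n-k]!; k![n∸k]!∣n!; nCn≡1) renaming (_C_ to _choose_)
open import Data.Nat.Divisibility using (_∣_; divides; m∣m*n; ∣⇒≤; ∣1⇒≡1)
open import Data.Nat.DivMod using (_/_; m/n*n≡m; m*n/n≡m; m≡m%n+[m/n]*n)
open import Data.Nat.Primality using (Prime; euclidsLemma; prime⇒nonZero; prime⇒nonTrivial; prime⇒irreducible)
import Data.Nat.Properties as ℕₚ
import Data.Nat.Solver
open import Data.Product using (∃; ∃₂; _×_; _,_; proj₁; proj₂; swap)
open import Data.Sign as Sign using (Sign)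
open import Data.Sum using (_⊎_; inj₁; inj₂)
open import Data.Vec as Vec using (Vec; []; _∷_; lookup)
open import Data.Vec.N-ary using (N-ary; _$ⁿ_)
import Data.Vec.Properties as Vecₚ
open import Function using (_∘_; _↔_)
open import Function.Bundles using (Inverse)
open import Relation.Binary.PropositionalEquality
import Relation.Binary.Reflection as Reflection
open import Relation.Nullary using (¬_; Dec; yes; no; does; ¬?)
open import Relation.Nullary.Decidable using (map′)
open import Algebra.Bundles using (CommutativeRing)
import Algebra.Properties.AbelianGroup as AbelianGroupProperties
import Algebra.Properties.CommutativeMonoid.Sum as Sum
import Algebra.Properties.CommutativeSemiring.Binomial as Binomial
import Algebra.Properties.Ring as RingProperties
import Algebra.Properties.Semiring.Exp as Exp
import Algebra.Properties.Semiring.Exp.TCOptimised as OptimisedExp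
import Algebra.Properties.Semiring.Mult as Mult
import Algebra.Properties.Semiring.Mult.TCOptimised as OptimisedMult
open import Tactic.RingSolver.Core.AlmostCommutativeRing using (AlmostCommutativeRing; fromCommutativeRing)
import Tactic.RingSolver.Core.Expression as Expression
import Tactic.RingSolver.Core.Polynomial.Base as PolynomialBase
import Tactic.RingSolver.Core.Polynomial.Homomorphism as PolynomialHomomorphism
open import Tactic.RingSolver.Core.Polynomial.Parameters using (Homomorphism)
import Tactic.RingSolver.Core.Polynomial.Semantics as PolynomialSemantics

-- The matrix form of the collineations fits the curve because 2h = q+1: under y ↦ (ay+b)/(cy+d) the
-- difference y^q - y is multiplied by D/(cy+d)^(q+1), and x^h by κ^h/(cy+d)^(2h), so κ^h = D is the
-- condition for preserving the curve. The same equality gives κ^(q+1) = D², which makes these maps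
-- similitudes of the Hermitian form. Scaling (a,b,c,d) by u in F_q changes D by u², so the
-- quadratic character of D belongs to the collineation and not to the chosen matrix. The congruence
-- q ≡ 1 mod 4 enters as the evenness of k = (q-1)/2: then (-1)^k = 1, h = k+1 is odd, and ζ = -1
-- yields an element of character -1 in every point stabiliser. Two kinds of frame occur. The affine
-- points with x = 0 are images of the point at infinity, whose stabiliser is triangular (c = 0). A
-- point with x ≠ 0 has y outside F_q, and its stabiliser comes from a non-split torus: the matrices
-- over F_q with eigenvectors (y,1) and (y^q,1).

-- Field arithmetic and a ring solver with integer coefficients.

module FieldAlgebra (K : Field) where
  open Field K

  commutativeRing : CommutativeRing 0ℓ 0ℓ
  commutativeRing = record { isCommutativeRing = isCommutativeRing }

  open CommutativeRing commutativeRing public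
    using (semiring; ring; commutativeSemiring; +-abelianGroup; *-commutativeMonoid; +-commutativeMonoid;
           +-assoc; +-comm; +-identityˡ; +-identityʳ; -‿inverseˡ; -‿inverseʳ;
           *-assoc; *-comm; *-identityˡ; *-identityʳ; zeroˡ; zeroʳ; distribˡ)
  open RingProperties ring using (-‿distribˡ-*; -‿distribʳ-*; -‿involutive; -0#≈0#)
  open AbelianGroupProperties +-abelianGroup using (⁻¹-∙-comm)
  open OptimisedMult semiring using (1+×; ×-homo-+; ×1-homo-*) renaming (_×_ to _⊠_)
  open ≡-Reasoning

  private
    -- With the optimised multiple, `1ₑ` and `2ₑ` evaluate to `1#` and `2#` by computation. The
    -- `refl` arguments that identify solver expressions with the actual matrices rely on this.
    ⟦_⟧ℤ : ℤ → Carrier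
    ⟦ pos n ⟧ℤ      = n ⊠ 1#
    ⟦ -[1+ n ] ⟧ℤ = - (suc n ⊠ 1#)

    ⟦⟧-neg : ∀ i → ⟦ ℤ.- i ⟧ℤ ≡ - ⟦ i ⟧ℤ
    ⟦⟧-neg (pos zero)   = sym -0#≈0#
    ⟦⟧-neg (pos (suc n))  = refl
    ⟦⟧-neg -[1+ n ]   = sym (-‿involutive _)

    ⟦⟧-⊖ : ∀ m n → ⟦ m ⊖ n ⟧ℤ ≡ m ⊠ 1# + - (n ⊠ 1#)
    ⟦⟧-⊖ m zero = sym (trans (cong ((m ⊠ 1#) +_) -0#≈0#) (+-identityʳ _))
    ⟦⟧-⊖ zero (suc n) = sym (+-identityˡ _)
    ⟦⟧-⊖ (suc m) (suc n) = begin
      ⟦ suc m ⊖ suc n ⟧ℤ                     ≡⟨ cong ⟦_⟧ℤ (ℤₚ.[1+m]⊖[1+n]≡m⊖n m n) ⟩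
      ⟦ m ⊖ n ⟧ℤ                             ≡⟨ ⟦⟧-⊖ m n ⟩
      a + - b                                ≡⟨ cong (_+ - b) (sym (trans (cong (_+ a) (-‿inverseʳ 1#)) (+-identityˡ a))) ⟩
      1# + - 1# + a + - b                    ≡⟨ cong (_+ - b) (trans (+-assoc _ _ _) (trans (cong (1# +_) (+-comm _ _)) (sym (+-assoc _ _ _)))) ⟩
      1# + a + - 1# + - b                    ≡⟨ trans (+-assoc _ _ _) (cong ((1# + a) +_) (⁻¹-∙-comm 1# b)) ⟩
      1# + a + - (1# + b)                    ≡⟨ sym (cong₂ (λ x y → x + - y) (1+× m 1#) (1+× n 1#)) ⟩
      suc m ⊠ 1# + - (suc n ⊠ 1#)            ∎
      where a = m ⊠ 1#
            b = n ⊠ 1#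

    ⟦⟧-+ : ∀ i j → ⟦ i ℤ.+ j ⟧ℤ ≡ ⟦ i ⟧ℤ + ⟦ j ⟧ℤ
    ⟦⟧-+ (pos m) (pos n)           = ×-homo-+ 1# m n
    ⟦⟧-+ (pos m) -[1+ n ]        = ⟦⟧-⊖ m (suc n)
    ⟦⟧-+ -[1+ m ] (pos n)        = trans (⟦⟧-⊖ n (suc m)) (+-comm _ _)
    ⟦⟧-+ -[1+ m ] -[1+ n ]     = trans (cong (λ k → - (k ⊠ 1#)) (cong suc (sym (ℕₚ.+-suc m n))))
                                   (trans (cong -_ (×-homo-+ 1# (suc m) (suc n))) (sym (⁻¹-∙-comm _ _)))

    ⟦⟧-◃ : ∀ s n → ⟦ s ℤ.◃ n ⟧ℤ ≡ ⟦ s ℤ.◃ 1 ⟧ℤ * (n ⊠ 1#)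
    ⟦⟧-◃ s zero = sym (zeroʳ _)
    ⟦⟧-◃ Sign.+ (suc n) = sym (*-identityˡ _)
    ⟦⟧-◃ Sign.- (suc n) = sym (trans (sym (-‿distribˡ-* _ _)) (cong -_ (*-identityˡ _)))

    ⟦⟧-* : ∀ i j → ⟦ i ℤ.* j ⟧ℤ ≡ ⟦ i ⟧ℤ * ⟦ j ⟧ℤ
    ⟦⟧-* (pos m) (pos n)       = trans (⟦⟧-◃ Sign.+ (m ℕ.* n)) (trans (*-identityˡ _) (×1-homo-* m n))
    ⟦⟧-* (pos m) -[1+ n ]    = trans (⟦⟧-◃ Sign.- (m ℕ.* suc n))
      (trans (sym (-‿distribˡ-* _ _)) (trans (cong -_ (trans (*-identityˡ _) (×1-homo-* m (suc n)))) (-‿distribʳ-* _ _)))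
    ⟦⟧-* -[1+ m ] (pos n)    = trans (⟦⟧-◃ Sign.- (suc m ℕ.* n))
      (trans (sym (-‿distribˡ-* _ _)) (trans (cong -_ (trans (*-identityˡ _) (×1-homo-* (suc m) n))) (-‿distribˡ-* _ _)))
    ⟦⟧-* -[1+ m ] -[1+ n ] = trans (⟦⟧-◃ Sign.+ (suc m ℕ.* suc n)) (trans (*-identityˡ _)
      (trans (×1-homo-* (suc m) (suc n)) (trans (sym (-‿involutive _))
        (trans (cong -_ (-‿distribˡ-* _ _)) (-‿distribʳ-* _ _)))))

    isZero : ℤ → Bool
    isZero (pos zero) = true
    isZero _        = false

    acr : AlmostCommutativeRing 0ℓ 0ℓ
    acr = fromCommutativeRing commutativeRing (λ _ → nothing)

    homo : Homomorphism 0ℓ 0ℓ 0ℓ 0ℓ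
    homo = record
      { from = record { rawRing = ℤ.+-*-rawRing ; isZero = isZero }
      ; to = acr
      ; morphism = record { ⟦_⟧ = ⟦_⟧ℤ ; +-homo = ⟦⟧-+ ; *-homo = ⟦⟧-* ; -‿homo = ⟦⟧-neg ; 0-homo = refl ; 1-homo = refl }
      ; Zero-C⟶Zero-R = λ { (pos zero) _ → refl }
      }

  -- The standard library's solver takes its coefficients from the ring itself and so cannot
  -- see that 1 - 1 is zero over an abstract field; integer coefficients can.
  module Solver where
    open Expression public using (Expr; Κ; Ι; _⊛_) renaming (_⊕_ to _:+_; _⊗_ to _:*_; ⊝_ to :-_)
    open Expression.Eval (AlmostCommutativeRing.rawRing acr) ⟦_⟧ℤ public
    open PolynomialBase (Homomorphism.from homo) using (Poly; κ; ι; _⊞_; _⊡_; ⊟_) renaming (_⊠_ to _⊠ₚ_)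
    open PolynomialSemantics homo using () renaming (⟦_⟧ to ⟦_⟧ₚ)
    open PolynomialHomomorphism homo using (κ-hom; ι-hom; ⊞-hom; ⊠-hom; ⊟-hom; ⊡-hom)

    norm : ∀ {n} → Expr ℤ n → Poly n
    norm (Κ x)   = κ x
    norm (Ι x)   = ι x
    norm (x :+ y) = norm x ⊞ norm y
    norm (x :* y) = norm x ⊠ₚ norm y
    norm (:- x)   = ⊟ norm x
    norm (x ⊛ i) = norm x ⊡ i

    ⟦_⇓⟧ : ∀ {n} → Expr ℤ n → Vec Carrier n → Carrier
    ⟦ e ⇓⟧ = ⟦ norm e ⟧ₚ

    correct : ∀ {n} (e : Expr ℤ n) ρ → ⟦ e ⇓⟧ ρ ≡ ⟦ e ⟧ ρ
    correct (Κ x)   ρ = κ-hom x ρ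
    correct (Ι x)   ρ = ι-hom x ρ
    correct (x :+ y) ρ = trans (⊞-hom (norm x) (norm y) ρ) (cong₂ _+_ (correct x ρ) (correct y ρ))
    correct (x :* y) ρ = trans (⊠-hom (norm x) (norm y) ρ) (cong₂ _*_ (correct x ρ) (correct y ρ))
    correct (:- x)   ρ = trans (⊟-hom (norm x) ρ) (cong -_ (correct x ρ))
    correct (x ⊛ i) ρ = trans (⊡-hom (norm x) i ρ) (OptimisedExp.^-congˡ semiring i (correct x ρ))

    open Reflection (setoid Carrier) Ι ⟦_⟧ ⟦_⇓⟧ correct public using (solve) renaming (_⊜_ to _:=_)

    infixl 6 _:-_
    _:-_ : ∀ {n} → Expr ℤ n → Expr ℤ n → Expr ℤ n
    x :- y = x :+ :- y

    0ₑ 1ₑ 2ₑ : ∀ {n} → Expr ℤ n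
    0ₑ = Κ (pos 0)
    1ₑ = Κ (pos 1)
    2ₑ = Κ (pos 2)

  open Solver

  x-y≡0⇒x≡y : ∀ {x y} → x + - y ≡ 0# → x ≡ y
  x-y≡0⇒x≡y {x} {y} e = trans (solve 2 (λ x y → x := (x :- y) :+ y) refl x y) (trans (cong (_+ y) e) (+-identityˡ y))

  x≡y⇒x-y≡0 : ∀ {x y} → x ≡ y → x + - y ≡ 0#
  x≡y⇒x-y≡0 refl = -‿inverseʳ _

  infix 8 _⁻¹
  _⁻¹ : ∀ {x} → x ≢ 0# → Carrier
  _⁻¹ {x} x≢0 = proj₁ (inverse x x≢0)

  inverseʳ : ∀ {x} (x≢0 : x ≢ 0#) → x * x≢0 ⁻¹ ≡ 1#
  inverseʳ {x} x≢0 = proj₂ (inverse x x≢0)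

  inverseˡ : ∀ {x} (x≢0 : x ≢ 0#) → x≢0 ⁻¹ * x ≡ 1#
  inverseˡ x≢0 = trans (*-comm _ _) (inverseʳ x≢0)

  *-cancelˡ : ∀ {x y z} → x ≢ 0# → x * y ≡ x * z → y ≡ z
  *-cancelˡ {x} {y} {z} x≢0 e = begin
    y                     ≡⟨ reassoc y ⟩
    x≢0 ⁻¹ * (x * y)      ≡⟨ cong (x≢0 ⁻¹ *_) e ⟩
    x≢0 ⁻¹ * (x * z)      ≡⟨ sym (reassoc z) ⟩
    z                     ∎
    where
    reassoc : ∀ w → w ≡ x≢0 ⁻¹ * (x * w)
    reassoc w = sym (trans (sym (*-assoc _ _ _)) (trans (cong (_* w) (inverseˡ x≢0)) (*-identityˡ w)))

  *-cancelʳ : ∀ {x y z} → x ≢ 0# → y * x ≡ z * x → y ≡ z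
  *-cancelʳ x≢0 e = *-cancelˡ x≢0 (trans (*-comm _ _) (trans e (*-comm _ _)))

  xy≡0⇒y≡0 : ∀ {x y} → x ≢ 0# → x * y ≡ 0# → y ≡ 0#
  xy≡0⇒y≡0 x≢0 e = *-cancelˡ x≢0 (trans e (sym (zeroʳ _)))

  *-nonzero : ∀ {x y} → x ≢ 0# → y ≢ 0# → x * y ≢ 0#
  *-nonzero x≢0 y≢0 e = y≢0 (xy≡0⇒y≡0 x≢0 e)

  1≢0 : 1# ≢ 0#
  1≢0 = 0≢1 ∘ sym

  factor-nonzero : ∀ {x y z} → x * y ≡ z → z ≢ 0# → x ≢ 0# × y ≢ 0#
  factor-nonzero {x} {y} e z≢0 = (λ { refl → z≢0 (trans (sym e) (zeroˡ y)) }) , (λ { refl → z≢0 (trans (sym e) (zeroʳ x)) })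

  neg-nonzero : ∀ {x} → x ≢ 0# → - x ≢ 0#
  neg-nonzero {x} x≢0 e = x≢0 (trans (sym (-‿involutive x)) (trans (cong -_ e) -0#≈0#))

  ⁻¹-nonzero : ∀ {x} (x≢0 : x ≢ 0#) → x≢0 ⁻¹ ≢ 0#
  ⁻¹-nonzero x≢0 = proj₂ (factor-nonzero (inverseʳ x≢0) 1≢0)

-- Divisibility of binomial coefficients by a prime.

p∣m!⇒p≤m : ∀ {p} → Prime p → ∀ m → p ∣ m ! → p ℕ.≤ m
p∣m!⇒p≤m pr zero d = ⊥-elim (ℕ.nonTrivial⇒≢1 {{prime⇒nonTrivial pr}} (∣1⇒≡1 d))
p∣m!⇒p≤m pr (suc m) d with euclidsLemma (suc m) (m !) pr d
... | inj₁ d′ = ∣⇒≤ d′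
... | inj₂ d′ = ℕₚ.m≤n⇒m≤1+n (p∣m!⇒p≤m pr m d′)

-- `p` divides p!, which is the binomial coefficient times k!(p-k)!. Both k and p-k are smaller than
-- `p`, so `p` divides neither factorial and must divide the coefficient.
prime∣binomial : ∀ {p} → Prime p → ∀ k → 0 ℕ.< k → k ℕ.< p → p ∣ p choose k
prime∣binomial {p} pr k 0<k k<p with euclidsLemma (p choose k) (k ! ℕ.* (p ℕ.∸ k) !) pr p∣pCk*k![p-k]!
  where
  p∣p! : ∀ {p} → Prime p → p ∣ p !
  p∣p! {zero} pr = ⊥-elim (ℕ.≢-nonZero⁻¹ 0 {{prime⇒nonZero pr}} refl)
  p∣p! {suc n} pr = m∣m*n (n !)
  p∣pCk*k![p-k]! : p ∣ (p choose k) ℕ.* (k ! ℕ.* (p ℕ.∸ k) !)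
  p∣pCk*k![p-k]! = subst (p ∣_)
    (sym (trans (cong (ℕ._* (k ! ℕ.* (p ℕ.∸ k) !)) (nCk≡n!/k![n-k]! (ℕₚ.<⇒≤ k<p)))
                (m/n*n≡m {{k ℕₚ.!* (p ℕ.∸ k) !≢0}} (k![n∸k]!∣n! (ℕₚ.<⇒≤ k<p)))))
    (p∣p! pr)
... | inj₁ d = d
... | inj₂ d with euclidsLemma (k !) ((p ℕ.∸ k) !) pr d
...   | inj₁ d′ = ⊥-elim (ℕₚ.<⇒≱ k<p (p∣m!⇒p≤m pr k d′))
...   | inj₂ d′ = ⊥-elim (ℕₚ.<⇒≱ (ℕₚ.∸-monoʳ-< 0<k (ℕₚ.<⇒≤ k<p)) (p∣m!⇒p≤m pr (p ℕ.∸ k) d′))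

length-filter-split : ∀ {A : Set} {P : A → Set} (P? : ∀ x → Dec (P x)) xs →
                      length xs ≡ length (filter P? xs) ℕ.+ length (filter (¬? ∘ P?) xs)
length-filter-split P? [] = refl
length-filter-split P? (x ∷ xs) with does (P? x)
... | true  = cong suc (length-filter-split P? xs)
... | false = trans (cong suc (length-filter-split P? xs)) (sym (ℕₚ.+-suc _ _))

-- Powers, and the bound on the number of roots of a monic polynomial.

module Powers (K : Field) (p q : ℕ) where
  open Field K
  open FieldAlgebra K
  open Geometry K p q using (_^_)

  ^-homo-+ : ∀ x m n → x ^ (m ℕ.+ n) ≡ (x ^ m) * (x ^ n)
  ^-homo-+ x zero    n = sym (*-identityˡ _)
  ^-homo-+ x (suc m) n = trans (cong (x *_) (^-homo-+ x m n)) (sym (*-assoc _ _ _))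

  ^-distrib-* : ∀ x y n → (x * y) ^ n ≡ (x ^ n) * (y ^ n)
  ^-distrib-* x y zero    = sym (*-identityˡ _)
  ^-distrib-* x y (suc n) = trans (cong (x * y *_) (^-distrib-* x y n))
    (solve 4 (λ x y a b → x :* y :* (a :* b) := x :* a :* (y :* b)) refl x y (x ^ n) (y ^ n))
    where open Solver

  1^n≡1 : ∀ n → 1# ^ n ≡ 1#
  1^n≡1 zero    = refl
  1^n≡1 (suc n) = trans (*-identityˡ _) (1^n≡1 n)

  ^-homo-* : ∀ x m n → x ^ (m ℕ.* n) ≡ (x ^ m) ^ n
  ^-homo-* x zero    n = sym (1^n≡1 n)
  ^-homo-* x (suc m) n = trans (^-homo-+ x n (m ℕ.* n))
    (trans (cong ((x ^ n) *_) (^-homo-* x m n)) (sym (^-distrib-* x (x ^ m) n)))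

  ^-swap : ∀ x m n → (x ^ m) ^ n ≡ (x ^ n) ^ m
  ^-swap x m n = trans (sym (^-homo-* x m n)) (trans (cong (x ^_) (ℕₚ.*-comm m n)) (^-homo-* x n m))

  x^1≡x : ∀ x → x ^ 1 ≡ x
  x^1≡x x = *-identityʳ x

  x^2≡x*x : ∀ x → x ^ 2 ≡ x * x
  x^2≡x*x x = cong (x *_) (*-identityʳ x)

  ^-nonzero : ∀ {x} n → x ≢ 0# → x ^ n ≢ 0#
  ^-nonzero zero    x≢0 = 1≢0
  ^-nonzero (suc n) x≢0 = *-nonzero x≢0 (^-nonzero n x≢0)

  -- A polynomial is kept as its evaluation function; the Horner derivation records the degree and
  -- the leading coefficient 1.
  data Monic : ℕ → (Carrier → Carrier) → Set where
    unit   : Monic 0 (λ _ → 1#)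
    horner : ∀ {n f} → Monic n f → ∀ c → Monic (suc n) (λ x → x * f x + c)

  -- Synthetic division: if `g` is the quotient of `f` by X - r, then x·g(x) + f(r) is the quotient
  -- of x·f(x) + c, so the coefficients of the quotient are the successive Horner values at `r`.
  monic-factor : ∀ {n f} → Monic (suc n) f → ∀ r →
                 ∃ λ g → Monic n g × (∀ x → f x + - f r ≡ (x + - r) * g x)
  monic-factor (horner unit c) r = _ , unit , λ x →
    solve 3 (λ x r c → (x :* 1ₑ :+ c) :- (r :* 1ₑ :+ c) := (x :- r) :* 1ₑ) refl x r c
    where open Solver
  monic-factor (horner {f = f} m@(horner _ _) c) r with monic-factor m r
  ... | g , mg , eq = _ , horner mg (f r) , λ x → begin
    (x * f x + c) + - (r * f r + c)
      ≡⟨ solve 5 (λ x r c fx fr → (x :* fx :+ c) :- (r :* fr :+ c) := x :* (fx :- fr) :+ (x :- r) :* fr) refl x r c (f x) (f r) ⟩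
    x * (f x + - f r) + (x + - r) * f r
      ≡⟨ cong (λ t → x * t + (x + - r) * f r) (eq x) ⟩
    x * ((x + - r) * g x) + (x + - r) * f r
      ≡⟨ solve 4 (λ x r gx fr → x :* ((x :- r) :* gx) :+ (x :- r) :* fr := (x :- r) :* (x :* gx :+ fr)) refl x r (g x) (f r) ⟩
    (x + - r) * (x * g x + f r) ∎
    where open Solver
          open ≡-Reasoning

  monic-roots : ∀ {n f} → Monic n f → ∀ {xs} → Unique xs → All (λ x → f x ≡ 0#) xs → length xs ℕ.≤ n
  monic-roots m [] [] = z≤n
  monic-roots unit (_ ∷ _) (1≡0 ∷ _) = ⊥-elim (1≢0 1≡0)
  monic-roots {f = f} m@(horner _ _) {r ∷ xs} (r∉xs ∷ uniq) (fr≡0 ∷ roots) with monic-factor m r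
  ... | g , mg , eq = s≤s (monic-roots mg uniq (All.zipWith root (r∉xs , roots)))
    where
    root : ∀ {x} → r ≢ x × f x ≡ 0# → g x ≡ 0#
    root {x} (r≢x , fx≡0) = xy≡0⇒y≡0 (λ e → r≢x (sym (x-y≡0⇒x≡y e)))
      (trans (sym (eq x)) (x≡y⇒x-y≡0 (trans fx≡0 (sym fr≡0))))

  power-monic : ∀ n → ∃ λ f → Monic n f × (∀ x → f x ≡ x ^ n)
  power-monic zero = _ , unit , λ _ → refl
  power-monic (suc n) with power-monic n
  ... | f , m , eq = _ , horner m 0# , λ x → trans (+-identityʳ _) (cong (x *_) (eq x))

  power-roots : ∀ n → 0 ℕ.< n → ∀ c {xs} → Unique xs → All (λ x → x ^ n ≡ c) xs → length xs ℕ.≤ n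
  power-roots (suc n) _ c uniq roots with power-monic n
  ... | f , m , eq = monic-roots (horner m (- c)) uniq
    (All.map (λ {x} x^n≡c → x≡y⇒x-y≡0 (trans (cong (x *_) (eq x)) x^n≡c)) roots)

-- Finite fields: the additive order of 1, Fermat's theorem and the existence of roots.

module FiniteField (K : Field) (p q n : ℕ) (enum : Field.Carrier K ↔ Fin (suc n)) where
  open Field K
  open FieldAlgebra K
  open Geometry K p q using (_^_)
  open Powers K p q
  open ≡-Reasoning
  open Inverse enum using (to; from; strictlyInverseˡ; strictlyInverseʳ)

  to-injective : ∀ {x y} → to x ≡ to y → x ≡ y
  to-injective e = trans (sym (strictlyInverseʳ _)) (trans (cong from e) (strictlyInverseʳ _))

  infix 4 _≟_
  _≟_ : (x y : Carrier) → Dec (x ≡ y)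
  x ≟ y = map′ to-injective (cong to) (to x Fin.≟ to y)

  open Mult semiring using () renaming (_×_ to _×ₙ_)

  private
    z : Fin (suc n)
    z = to 0#

    unit# : Fin n → Carrier
    unit# i = from (punchIn z i)

    unit#-nonzero : ∀ i → unit# i ≢ 0#
    unit#-nonzero i e = Finₚ.punchInᵢ≢i z i (trans (sym (strictlyInverseˡ _)) (cong to e))

    unit#-injective : ∀ {i j} → unit# i ≡ unit# j → i ≡ j
    unit#-injective e = Finₚ.punchIn-injective z _ _ (trans (sym (strictlyInverseˡ _)) (trans (cong to e) (strictlyInverseˡ _)))

    index : ∀ x → x ≢ 0# → Fin n
    index x x≢0 = punchOut {i = z} {j = to x} (λ e → x≢0 (sym (to-injective e)))

    unit#-index : ∀ x (x≢0 : x ≢ 0#) → unit# (index x x≢0) ≡ x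
    unit#-index x x≢0 = trans (cong from (Finₚ.punchIn-punchOut _)) (strictlyInverseʳ x)

  -- Translation by 1 permutes the field, so the sum `s` of all elements equals `s` plus as many
  -- ones as there are elements.
  card×1≡0 : suc n ×ₙ 1# ≡ 0#
  card×1≡0 = begin
    m                       ≡⟨ solve 2 (λ s m → m := (s :+ m) :- s) refl s m ⟩
    (s + m) + - s           ≡⟨ cong (λ t → t + - s) (sym s≡s+m) ⟩
    s + - s                 ≡⟨ -‿inverseʳ s ⟩
    0#                      ∎
    where
    open Sum +-commutativeMonoid using (sum; sum-permute; sum-cong-≗; ∑-distrib-+; sum-replicate)
    open Solver
    m = suc n ×ₙ 1#
    s = sum from
    shift : Permutation (suc n) (suc n)
    shift = permutation (λ i → to (from i + 1#)) (λ i → to (from i + - 1#))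
      (λ i → trans (cong to (trans (cong (_+ 1#) (strictlyInverseʳ _)) (solve 1 (λ x → x :- 1ₑ :+ 1ₑ := x) refl (from i)))) (strictlyInverseˡ i))
      (λ i → trans (cong to (trans (cong (_+ - 1#) (strictlyInverseʳ _)) (solve 1 (λ x → x :+ 1ₑ :- 1ₑ := x) refl (from i)))) (strictlyInverseˡ i))
    s≡s+m : s ≡ s + m
    s≡s+m = begin
      s                                    ≡⟨ sum-permute from shift ⟩
      sum (λ i → from (to (from i + 1#)))  ≡⟨ sum-cong-≗ (λ i → strictlyInverseʳ (from i + 1#)) ⟩
      sum (λ i → from i + 1#)              ≡⟨ ∑-distrib-+ from (λ _ → 1#) ⟩
      s + sum {suc n} (λ _ → 1#)           ≡⟨ cong (s +_) (sum-replicate (suc n)) ⟩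
      s + m                                ∎

  -- Multiplication by `x` permutes the `n` non-zero elements, so their product is unchanged when
  -- multiplied by x^n; that product is non-zero and cancels.
  fermat : ∀ x → x ≢ 0# → x ^ n ≡ 1#
  fermat x x≢0 = *-cancelʳ (product-nonzero unit# unit#-nonzero) (begin
    (x ^ n) * product unit#                  ≡⟨ sym (product-scale x unit#) ⟩
    product (λ i → x * unit# i)              ≡⟨ sum-cong-≗ (λ i → sym (unit#-mulBy x x≢0 i)) ⟩
    product (λ i → unit# (shift i))          ≡⟨ sym (sum-permute unit# π) ⟩
    product unit#                            ≡⟨ sym (*-identityˡ _) ⟩
    1# * product unit#                       ∎)
    where
    open Sum *-commutativeMonoid using (sum-permute; sum-cong-≗) renaming (sum to product)
    product-nonzero : ∀ {m} (f : Fin m → Carrier) → (∀ i → f i ≢ 0#) → product f ≢ 0#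
    product-nonzero {zero}  f f≢0 = 1≢0
    product-nonzero {suc m} f f≢0 = *-nonzero (f≢0 zero) (product-nonzero (f ∘ suc) (f≢0 ∘ suc))
    product-scale : ∀ x {m} (f : Fin m → Carrier) → product (λ i → x * f i) ≡ (x ^ m) * product f
    product-scale x {zero}  f = sym (*-identityˡ _)
    product-scale x {suc m} f = trans (cong (x * f zero *_) (product-scale x (f ∘ suc)))
      (solve 4 (λ a b c d → a :* b :* (c :* d) := a :* c :* (b :* d)) refl x (f zero) (x ^ m) (product (f ∘ suc)))
      where open Solver
    mulBy : ∀ c → c ≢ 0# → Fin n → Fin n
    mulBy c c≢0 i = index (c * unit# i) (*-nonzero c≢0 (unit#-nonzero i))
    unit#-mulBy : ∀ c c≢0 i → unit# (mulBy c c≢0 i) ≡ c * unit# i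
    unit#-mulBy c c≢0 i = unit#-index (c * unit# i) (*-nonzero c≢0 (unit#-nonzero i))
    mulBy-inverse : ∀ c d (c≢0 : c ≢ 0#) (d≢0 : d ≢ 0#) → c * d ≡ 1# → ∀ i → mulBy c c≢0 (mulBy d d≢0 i) ≡ i
    mulBy-inverse c d c≢0 d≢0 cd≡1 i = unit#-injective (begin
      unit# (mulBy c c≢0 (mulBy d d≢0 i))   ≡⟨ unit#-mulBy c c≢0 _ ⟩
      c * unit# (mulBy d d≢0 i)             ≡⟨ cong (c *_) (unit#-mulBy d d≢0 i) ⟩
      c * (d * unit# i)                     ≡⟨ sym (*-assoc _ _ _) ⟩
      c * d * unit# i                       ≡⟨ cong (_* unit# i) cd≡1 ⟩
      1# * unit# i                          ≡⟨ *-identityˡ _ ⟩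
      unit# i                               ∎)
    shift = mulBy x x≢0
    π : Permutation n n
    π = permutation shift (mulBy (x≢0 ⁻¹) (⁻¹-nonzero x≢0))
      (mulBy-inverse x (x≢0 ⁻¹) x≢0 (⁻¹-nonzero x≢0) (inverseʳ x≢0))
      (mulBy-inverse (x≢0 ⁻¹) x (⁻¹-nonzero x≢0) x≢0 (inverseˡ x≢0))

  private
    -- The list is split by the value of the b-th power: the elements with value `y` are roots of
    -- X^b - y, hence at most `b`, and the others take values in the rest of the list.
    fibre-bound : ∀ b → 0 ℕ.< b → ∀ {xs} ys → Unique xs → All (λ x → x ^ b ∈ ys) xs → length xs ℕ.≤ length ys ℕ.* b
    fibre-bound b 0<b {[]} [] _ _ = z≤n
    fibre-bound b 0<b {x ∷ xs} [] _ (() ∷ _)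
    fibre-bound b 0<b {xs} (y ∷ ys) uniq inYs = ℕₚ.≤-trans (ℕₚ.≤-reflexive (length-filter-split P? xs))
      (ℕₚ.+-mono-≤ (power-roots b 0<b y (Uniqueₚ.filter⁺ P? uniq) (all-filter P? xs))
                   (fibre-bound b 0<b ys (Uniqueₚ.filter⁺ (¬? ∘ P?) uniq) (All.tabulate rest)))
      where
      P? = λ x → x ^ b ≟ y
      rest : ∀ {x} → x ∈ filter (¬? ∘ P?) xs → x ^ b ∈ ys
      rest x∈ with ∈-filter⁻ (¬? ∘ P?) x∈
      ... | x∈xs , x^b≢y with All.lookup inYs x∈xs
      ...   | here e  = ⊥-elim (x^b≢y e)
      ...   | there r = r

  -- If c were missed, the b-th powers would be at most a - 1 roots of X^a - 1, each hit at most b times.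
  root-exists : ∀ a b → 0 ℕ.< b → 0 ℕ.< n → n ≡ a ℕ.* b → ∀ c → c ^ a ≡ 1# → ∃ λ d → d ≢ 0# × d ^ b ≡ c
  root-exists zero b _ 0<n n≡0 = ⊥-elim (ℕₚ.<-irrefl (sym n≡0) 0<n)
  root-exists a@(suc _) b 0<b 0<n n≡ab c c^a≡1 with any? (λ d → d ^ b ≟ c) units
    where units = tabulate unit#
  ... | yes hit = let d , d∈ , e = find hit ; i , d≡ = ∈-tabulate⁻ d∈ in
                  d , (λ d≡0 → unit#-nonzero i (trans (sym d≡) d≡0)) , e
  ... | no miss = ⊥-elim (ℕₚ.<-irrefl refl too-many)
    where
    units = tabulate unit#
    Q? = λ x → x ^ a ≟ 1#
    R? = λ x → ¬? (x ≟ c)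
    roots = filter R? (filter Q? units)
    uniq : Unique units
    uniq = Uniqueₚ.tabulate⁺ unit#-injective
    root-bound : suc (length roots) ℕ.≤ a
    root-bound = power-roots a (s≤s z≤n) 1# {c ∷ roots}
      (All.map (λ x≢c c≡x → x≢c (sym c≡x)) (all-filter R? (filter Q? units)) ∷ Uniqueₚ.filter⁺ R? (Uniqueₚ.filter⁺ Q? uniq))
      (c^a≡1 ∷ All.tabulate (λ x∈ → proj₂ (∈-filter⁻ Q? {xs = units} (proj₁ (∈-filter⁻ R? x∈)))))
    power∈roots : ∀ {x} → x ∈ units → x ^ b ∈ roots
    power∈roots {x} x∈ with ∈-tabulate⁻ x∈
    ... | i , refl = ∈-filter⁺ R? (∈-filter⁺ Q?
            (subst (_∈ units) (unit#-index (x ^ b) x^b≢0) (∈-tabulate⁺ (index (x ^ b) x^b≢0)))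
            (trans (sym (^-homo-* x b a)) (trans (cong (x ^_) (trans (ℕₚ.*-comm b a) (sym n≡ab))) (fermat x (unit#-nonzero i)))))
          (λ e → miss (lose x∈ e))
      where x^b≢0 = ^-nonzero b (unit#-nonzero i)
    too-many : n ℕ.< n
    too-many = subst₂ ℕ._<_ (length-tabulate unit#) (sym n≡ab)
      (ℕₚ.≤-<-trans (fibre-bound b 0<b roots uniq (All.tabulate power∈roots))
                    (ℕₚ.*-monoˡ-< b {{ℕ.>-nonZero 0<b}} root-bound))

-- Characteristic p and additivity of the Frobenius map.

module Frobenius (K : Field) (p q : ℕ) (p-prime : Prime p) where
  open Field K
  open FieldAlgebra K
  open Geometry K p q using (_^_)
  open Powers K p q
  open Mult semiring using (×-assoc-*; ×1-homo-*; ×-assocˡ; ×-homo-1) renaming (_×_ to _×ₙ_)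
  open Exp semiring using () renaming (_^_ to _^ₛ_)
  open ≡-Reasoning

  -- The multiple p^m·1 is a product of `m` copies of p·1, and a field has no zero divisors. This
  -- extracts the characteristic from the order of the field.
  prime-power-torsion : (∀ x y → Dec (x ≡ y)) → ∀ m → (p ℕ.^ m) ×ₙ 1# ≡ 0# → p ×ₙ 1# ≡ 0#
  prime-power-torsion _≟_ zero e = ⊥-elim (1≢0 (trans (sym (×-homo-1 1#)) e))
  prime-power-torsion _≟_ (suc m) e with (p ×ₙ 1#) ≟ 0#
  ... | yes p≡0 = p≡0
  ... | no  p≢0 = prime-power-torsion _≟_ m (xy≡0⇒y≡0 p≢0 (trans (sym (×1-homo-* p (p ℕ.^ m))) e))

  module _ (p×1≡0 : p ×ₙ 1# ≡ 0#) where

    p×x≡0 : ∀ x → p ×ₙ x ≡ 0#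
    p×x≡0 x = begin
      p ×ₙ x          ≡⟨ cong (p ×ₙ_) (sym (*-identityˡ x)) ⟩
      p ×ₙ (1# * x)   ≡⟨ sym (×-assoc-* p 1# x) ⟩
      p ×ₙ 1# * x     ≡⟨ cong (_* x) p×1≡0 ⟩
      0# * x          ≡⟨ zeroˡ x ⟩
      0#              ∎

    multiple×x≡0 : ∀ {m} → p ∣ m → ∀ x → m ×ₙ x ≡ 0#
    multiple×x≡0 (divides j refl) x =
      trans (cong (_×ₙ x) (ℕₚ.*-comm j p)) (trans (sym (×-assocˡ x p j)) (p×x≡0 (j ×ₙ x)))

    ^≡^ₛ : ∀ x n → x ^ n ≡ x ^ₛ n
    ^≡^ₛ x zero    = refl
    ^≡^ₛ x (suc n) = cong (x *_) (^≡^ₛ x n)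

    -- In the binomial expansion all inner coefficients are multiples of `p`. The exponent is
    -- generalised to an `n` equal to `p`, so that the form `suc m` is exposed and the sum splits
    -- into first term, middle terms and last term.
    frobenius-+ : ∀ x y → (x + y) ^ p ≡ (x ^ p) + (y ^ p)
    frobenius-+ x y = go p refl
      where
      open Sum +-commutativeMonoid using (sum; sum-cong-≗; sum-init-last; sum-replicate-zero)
      open Binomial commutativeSemiring using (binomialTerm)
      go : ∀ n → n ≡ p → (x + y) ^ n ≡ (x ^ n) + (y ^ n)
      go zero    n≡p = ⊥-elim (ℕ.≢-nonZero⁻¹ 0 {{subst ℕ.NonZero (sym n≡p) (prime⇒nonZero p-prime)}} refl)
      go n@(suc m) n≡p = begin
        (x + y) ^ n                                 ≡⟨ ^≡^ₛ (x + y) n ⟩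
        (x + y) ^ₛ n                                ≡⟨ Binomial.theorem commutativeSemiring n x y ⟩
        t zero + sum (λ i → t (suc i))              ≡⟨ cong (t zero +_) (sum-init-last (λ i → t (suc i))) ⟩
        t zero + (sum (λ i → t (suc (inject₁ i))) + t (suc (fromℕ m)))
                                                    ≡⟨ cong (λ s → t zero + (s + t (suc (fromℕ m)))) (trans (sum-cong-≗ middle) (sum-replicate-zero m)) ⟩
        t zero + (0# + t (suc (fromℕ m)))           ≡⟨ cong₂ (λ a b → a + (0# + b)) first last ⟩
        y ^ n + (0# + x ^ n)                        ≡⟨ solve 2 (λ a b → a :+ (0ₑ :+ b) := b :+ a) refl (y ^ n) (x ^ n) ⟩
        x ^ n + y ^ n                               ∎
        where
        open Solver
        t = binomialTerm x y n
        first : t zero ≡ y ^ n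
        first = trans (×-homo-1 _) (trans (*-identityˡ _) (sym (^≡^ₛ y n)))
        last : t (suc (fromℕ m)) ≡ x ^ n
        last = begin
          (n choose suc (toℕ (fromℕ m))) ×ₙ (x ^ₛ suc (toℕ (fromℕ m)) * y ^ₛ (m ℕ.∸ toℕ (fromℕ m)))
            ≡⟨ cong (λ j → (n choose suc j) ×ₙ (x ^ₛ suc j * y ^ₛ (m ℕ.∸ j))) (Finₚ.toℕ-fromℕ m) ⟩
          (n choose n) ×ₙ (x ^ₛ n * y ^ₛ (m ℕ.∸ m))
            ≡⟨ cong₂ (λ c j → c ×ₙ (x ^ₛ n * y ^ₛ j)) (nCn≡1 n) (ℕₚ.n∸n≡0 m) ⟩
          1 ×ₙ (x ^ₛ n * 1#)
            ≡⟨ trans (×-homo-1 _) (trans (*-identityʳ _) (sym (^≡^ₛ x n))) ⟩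
          x ^ n ∎
        middle : ∀ i → t (suc (inject₁ i)) ≡ 0#
        middle i = multiple×x≡0 (subst (λ j → j ∣ n choose suc (toℕ (inject₁ i))) n≡p
          (prime∣binomial (subst Prime (sym n≡p) p-prime) _ (s≤s z≤n)
            (s≤s (subst (ℕ._< m) (sym (Finₚ.toℕ-inject₁ i)) (Finₚ.toℕ<n i))))) _

    frobenius^-+ : ∀ e x y → (x + y) ^ (p ℕ.^ e) ≡ (x ^ (p ℕ.^ e)) + (y ^ (p ℕ.^ e))
    frobenius^-+ zero    x y = trans (x^1≡x _) (cong₂ _+_ (sym (x^1≡x x)) (sym (x^1≡x y)))
    frobenius^-+ (suc e) x y = begin
      (x + y) ^ (p ℕ.* p ℕ.^ e)                             ≡⟨ ^-homo-* (x + y) p (p ℕ.^ e) ⟩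
      ((x + y) ^ p) ^ (p ℕ.^ e)                             ≡⟨ cong (_^ (p ℕ.^ e)) (frobenius-+ x y) ⟩
      ((x ^ p) + (y ^ p)) ^ (p ℕ.^ e)                       ≡⟨ frobenius^-+ e (x ^ p) (y ^ p) ⟩
      ((x ^ p) ^ (p ℕ.^ e)) + ((y ^ p) ^ (p ℕ.^ e))         ≡⟨ sym (cong₂ _+_ (^-homo-* x p (p ℕ.^ e)) (^-homo-* y p (p ℕ.^ e))) ⟩
      (x ^ (p ℕ.* p ℕ.^ e)) + (y ^ (p ℕ.* p ℕ.^ e))         ∎

-- Squares, norms and conjugation in the quadratic extension.

-- K is a quadratic extension of its subfield F_q of order q = 2k + 1.
record QuadraticExtension (K : Field) (p q k : ℕ) : Set where
  open Field K
  open Geometry K p q using (_^_; 2#; InFq)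
  open FieldAlgebra K using (semiring)
  open Mult semiring using () renaming (_×_ to _×ₙ_)
  field
    _≟_            : (x y : Carrier) → Dec (x ≡ y)
    q≡1+2k         : q ≡ suc (k ℕ.+ k)
    -- This is q ≡ 1 mod 4: -1 is a square in F_q and h = k+1 is odd.
    k-even         : ∃ λ r → k ≡ r ℕ.+ r
    p-odd          : ∃ λ m → p ≡ suc (m ℕ.+ m)
    p×x≡0          : ∀ x → p ×ₙ x ≡ 0#
    2≢0            : 2# ≢ 0#
    conj-+         : ∀ x y → (x + y) ^ q ≡ (x ^ q) + (y ^ q)
    conj-conj      : ∀ x → (x ^ q) ^ q ≡ x
    norm-onto      : ∀ {c} → c ≢ 0# → InFq c → ∃ λ β → β ^ (q ℕ.+ 1) ≡ c
    euler          : ∀ {c} → c ≢ 0# → InFq c → c ^ k ≡ 1# → ∃ λ s → InFq s × s * s ≡ c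
    nonsquare      : ∃ λ μ → μ ≢ 0# × InFq μ × μ ^ k ≡ - 1#
    notInFq        : ∃ λ b → ¬ InFq b

-- The existence statements are instances of `root-exists`, one for each factorisation of q²-1:
-- (q-1)·(q+1) gives surjectivity of the norm, k·2(q+1) gives Euler's criterion with square root
-- d^(q+1), and 2·(q+1)k gives an element `d` with d^((q+1)k) = -1, whose norm is a non-square.
quadraticExtension : ∀ (K : Field) p e → Prime p → p ≢ 2 → ∀ r → p ℕ.^ e ≡ suc ((r ℕ.+ r) ℕ.+ (r ℕ.+ r)) → 0 ℕ.< r →
  Field.Carrier K ↔ Fin (p ℕ.^ e ℕ.* p ℕ.^ e) → QuadraticExtension K p (p ℕ.^ e) (r ℕ.+ r)
quadraticExtension K p e p-prime p≢2 r q≡ 0<r enum = record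
  { _≟_ = _≟_
  ; q≡1+2k = q≡
  ; k-even = r , refl
  ; p-odd = p-odd
  ; p×x≡0 = p×x≡0 p×1≡0
  ; 2≢0 = 2≢0
  ; conj-+ = frobenius^-+ p×1≡0 e
  ; conj-conj = λ x → trans (sym (^-homo-* x q q)) (trans (cong (x ^_) qq≡1+n) (x^1+n≡x x))
  ; norm-onto = λ {c} c≢0 c∈Fq → let β , _ , eq = root-exists (q ℕ.∸ 1) (q ℕ.+ 1) 0<q+1 0<n n≡[q-1][q+1] c (c^[q-1]≡1 c≢0 c∈Fq) in β , eq
  ; euler = λ {c} c≢0 c∈Fq c^k≡1 → let d , d≢0 , eq = root-exists k (2 ℕ.* (q ℕ.+ 1)) 0<2q+2 0<n n≡k[2[q+1]] c c^k≡1 in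
      d ^ (q ℕ.+ 1) , norm-InFq d≢0 , trans (sym (x^2≡x*x _)) (trans (^-swap d (q ℕ.+ 1) 2) (trans (sym (^-homo-* d 2 (q ℕ.+ 1))) eq))
  ; nonsquare = let d , d≢0 , eq = ν in d ^ (q ℕ.+ 1) , ^-nonzero (q ℕ.+ 1) d≢0 , norm-InFq d≢0 , trans (sym (^-homo-* d (q ℕ.+ 1) k)) eq
  -- The same `d` lies outside F_q: since (q+1)k = (q-1)(k+1), membership would make d^((q+1)k)
  -- equal to 1 rather than -1.
  ; notInFq = let d , d≢0 , eq = ν in d , λ d∈Fq → -1≢1 (trans (sym eq) (begin
      d ^ ((q ℕ.+ 1) ℕ.* k)       ≡⟨ cong (d ^_) [q+1]k≡[q-1][1+k] ⟩
      d ^ ((q ℕ.∸ 1) ℕ.* suc k)   ≡⟨ ^-homo-* d (q ℕ.∸ 1) (suc k) ⟩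
      (d ^ (q ℕ.∸ 1)) ^ suc k     ≡⟨ cong (_^ suc k) (c^[q-1]≡1 d≢0 d∈Fq) ⟩
      1# ^ suc k                  ≡⟨ 1^n≡1 (suc k) ⟩
      1#                          ∎))
  }
  where
  open Field K
  q = p ℕ.^ e
  k = r ℕ.+ r
  n = q ℕ.* q ℕ.∸ 1
  q≡1+2k : q ≡ suc (k ℕ.+ k)
  q≡1+2k = q≡
  qq≡1+n : q ℕ.* q ≡ suc n
  qq≡1+n = subst (λ q → q ℕ.* q ≡ suc (q ℕ.* q ℕ.∸ 1)) (sym q≡) refl
  open FieldAlgebra K
  open Geometry K p q using (_^_; 2#; InFq)
  open Powers K p q
  open Frobenius K p q p-prime
  open FiniteField K p q n (subst (λ m → Carrier ↔ Fin m) qq≡1+n enum)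
  open Mult semiring using () renaming (_×_ to _×ₙ_)
  open ≡-Reasoning
  x^1+n≡x : ∀ x → x ^ suc n ≡ x
  x^1+n≡x x with x ≟ 0#
  ... | yes refl = zeroˡ _
  ... | no  x≢0  = trans (cong (x *_) (fermat x x≢0)) (*-identityʳ x)
  p×1≡0 : p ×ₙ 1# ≡ 0#
  p×1≡0 = prime-power-torsion _≟_ (e ℕ.+ e)
    (trans (cong (_×ₙ 1#) (trans (ℕₚ.^-distribˡ-+-* p e e) qq≡1+n)) card×1≡0)
  parity : ∀ m → (∃ λ j → m ≡ j ℕ.+ j) ⊎ (∃ λ j → m ≡ suc (j ℕ.+ j))
  parity zero = inj₁ (0 , refl)
  parity (suc m) with parity m
  ... | inj₁ (j , refl) = inj₂ (j , refl)
  ... | inj₂ (j , refl) = inj₁ (suc j , cong suc (sym (ℕₚ.+-suc j j)))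
  p-odd : ∃ λ m → p ≡ suc (m ℕ.+ m)
  p-odd with parity p
  ... | inj₂ odd = odd
  ... | inj₁ (j , p≡j+j) with prime⇒irreducible p-prime (divides j (trans p≡j+j (sym (trans (ℕₚ.*-comm j 2) (cong (j ℕ.+_) (ℕₚ.+-identityʳ j))))))
  ...   | inj₂ 2≡p = ⊥-elim (p≢2 (sym 2≡p))
  2≢0 : 2# ≢ 0#
  2≢0 2≡0 = 1≢0 (trans (sym (odd×1 (proj₁ p-odd))) (trans (cong (_×ₙ 1#) (sym (proj₂ p-odd))) p×1≡0))
    where
    odd×1 : ∀ m → suc (m ℕ.+ m) ×ₙ 1# ≡ 1#
    odd×1 zero    = +-identityʳ 1#
    odd×1 (suc m) = trans (cong (λ j → 1# + (1# + (j ×ₙ 1#))) (ℕₚ.+-suc m m))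
      (trans (sym (+-assoc _ _ _)) (trans (cong₂ _+_ 2≡0 (odd×1 m)) (+-identityˡ 1#)))
  -1≢1 : - 1# ≢ 1#
  -1≢1 e = 2≢0 (trans (cong (1# +_) (sym e)) (-‿inverseʳ 1#))
  0<q+1 : 0 ℕ.< q ℕ.+ 1
  0<q+1 = ℕₚ.m≤n+m 1 q
  0<2q+2 : 0 ℕ.< 2 ℕ.* (q ℕ.+ 1)
  0<2q+2 = ℕₚ.≤-trans 0<q+1 (ℕₚ.m≤n*m (q ℕ.+ 1) 2)
  module ℕSolver = Data.Nat.Solver.+-*-Solver
  n≡[q-1][q+1] : n ≡ (q ℕ.∸ 1) ℕ.* (q ℕ.+ 1)
  n≡[q-1][q+1] = subst (λ q → q ℕ.* q ℕ.∸ 1 ≡ (q ℕ.∸ 1) ℕ.* (q ℕ.+ 1)) (sym q≡)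
    (solve 1 (λ m → m :+ m :* (con 1 :+ m) := m :* (con 1 :+ m :+ con 1)) refl (k ℕ.+ k))
    where open ℕSolver
  n≡k[2[q+1]] : n ≡ k ℕ.* (2 ℕ.* (q ℕ.+ 1))
  n≡k[2[q+1]] = trans n≡[q-1][q+1] (subst (λ q → (q ℕ.∸ 1) ℕ.* (q ℕ.+ 1) ≡ k ℕ.* (2 ℕ.* (q ℕ.+ 1))) (sym q≡)
    (solve 2 (λ k s → (k :+ k) :* s := k :* (con 2 :* s)) refl k (suc (k ℕ.+ k) ℕ.+ 1)))
    where open ℕSolver
  n≡2[[q+1]k] : n ≡ 2 ℕ.* ((q ℕ.+ 1) ℕ.* k)
  n≡2[[q+1]k] = trans n≡k[2[q+1]] (solve 2 (λ k s → k :* (con 2 :* s) := con 2 :* (s :* k)) refl k (q ℕ.+ 1))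
    where open ℕSolver
  [q+1]k≡[q-1][1+k] : (q ℕ.+ 1) ℕ.* k ≡ (q ℕ.∸ 1) ℕ.* suc k
  [q+1]k≡[q-1][1+k] = subst (λ q → (q ℕ.+ 1) ℕ.* k ≡ (q ℕ.∸ 1) ℕ.* suc k) (sym q≡)
    (solve 1 (λ k → (con 1 :+ (k :+ k) :+ con 1) :* k := (k :+ k) :* (con 1 :+ k)) refl k)
    where open ℕSolver
  0<k : 0 ℕ.< k
  0<k = ℕₚ.≤-trans 0<r (ℕₚ.m≤m+n r r)
  0<[q+1]k : 0 ℕ.< (q ℕ.+ 1) ℕ.* k
  0<[q+1]k = ℕₚ.*-mono-≤ 0<q+1 0<k
  0<n : 0 ℕ.< n
  0<n = subst (0 ℕ.<_) (sym n≡2[[q+1]k]) (ℕₚ.≤-trans 0<[q+1]k (ℕₚ.m≤n*m _ 2))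
  c^[q-1]≡1 : ∀ {c} → c ≢ 0# → InFq c → c ^ (q ℕ.∸ 1) ≡ 1#
  c^[q-1]≡1 {c} c≢0 c∈Fq = *-cancelˡ c≢0 (trans (cong (c ^_) (trans (cong (λ q → suc (q ℕ.∸ 1)) q≡) (sym q≡))) (trans c∈Fq (sym (*-identityʳ c))))
  norm-InFq : ∀ {d} → d ≢ 0# → InFq (d ^ (q ℕ.+ 1))
  norm-InFq {d} d≢0 = trans (cong ((d ^ (q ℕ.+ 1)) ^_) (trans q≡ (cong (λ q → suc (q ℕ.∸ 1)) (sym q≡))))
    (trans (cong ((d ^ (q ℕ.+ 1)) *_) (trans (sym (^-homo-* d (q ℕ.+ 1) (q ℕ.∸ 1)))
      (trans (cong (d ^_) (trans (ℕₚ.*-comm (q ℕ.+ 1) (q ℕ.∸ 1)) (sym n≡[q-1][q+1]))) (fermat d d≢0)))) (*-identityʳ _))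
  ν : ∃ λ d → d ≢ 0# × d ^ ((q ℕ.+ 1) ℕ.* k) ≡ - 1#
  ν = root-exists 2 ((q ℕ.+ 1) ℕ.* k) 0<[q+1]k 0<n n≡2[[q+1]k] (- 1#)
    (Solver.solve 0 (Solver.:- Solver.1ₑ Solver.:* (Solver.:- Solver.1ₑ Solver.:* Solver.1ₑ) Solver.:= Solver.1ₑ) refl)

-- Matrices up to scalars and the symmetric-square normal form.

module Matrices (K : Field) (p q : ℕ) where
  open Field K
  open FieldAlgebra K
  open Geometry K p q
  open Solver

  private
    rows : ∀ {A : Set} → (Fin 4 → Fin 4 → A) → Vec (Vec A 4) 4
    rows A = Vec.tabulate (λ i → Vec.tabulate (A i))

    rows-injective : ∀ {A : Set} (f g : Fin 4 → Fin 4 → A) → rows f ≡ rows g → ∀ i j → f i j ≡ g i j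
    rows-injective f g e i j = trans (sym (entry f)) (trans (cong (λ m → lookup (lookup m i) j) e) (entry g))
      where
      entry : ∀ h → lookup (lookup (rows h) i) j ≡ h i j
      entry h = trans (cong (λ r → lookup r j) (Vecₚ.lookup∘tabulate (λ i → Vec.tabulate (h i)) i)) (Vecₚ.lookup∘tabulate (h i) j)

    tabulate-injective : ∀ {A : Set} {n} (f g : Fin n → A) → Vec.tabulate f ≡ Vec.tabulate g → ∀ i → f i ≡ g i
    tabulate-injective f g e i = trans (sym (Vecₚ.lookup∘tabulate f i)) (trans (cong (λ v → lookup v i) e) (Vecₚ.lookup∘tabulate g i))

    rows-cong : ∀ {A : Set} {f g : Fin 4 → Fin 4 → A} → (∀ i j → f i j ≡ g i j) → rows f ≡ rows g
    rows-cong e = Vecₚ.tabulate-cong (λ i → Vecₚ.tabulate-cong (e i))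

  Matₑ : ℕ → Set
  Matₑ n = Fin 4 → Fin 4 → Expr ℤ n

  -- Comparing all entries as one vector lets a single refl stand for sixteen.
  solveMat : ∀ n (f : N-ary n (Expr ℤ n) (Matₑ n × Matₑ n)) (ρ : Vec Carrier n) →
    let A , B = f $ⁿ Vec.map Ι (Vec.allFin n) in
    rows (λ i j → ⟦ A i j ⇓⟧ ρ) ≡ rows (λ i j → ⟦ B i j ⇓⟧ ρ) →
    ∀ {A′ B′ : Mat} → rows (λ i j → ⟦ A i j ⟧ ρ) ≡ rows A′ → rows (λ i j → ⟦ B i j ⟧ ρ) ≡ rows B′ →
    ∀ i j → A′ i j ≡ B′ i j
  solveMat n f ρ e {A′} {B′} eA eB = rows-injective A′ B′ (trans (sym eA) (trans (rows-cong λ i j →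
    trans (sym (correct (A i j) ρ)) (trans (rows-injective (λ i j → ⟦ A i j ⇓⟧ ρ) (λ i j → ⟦ B i j ⇓⟧ ρ) e i j) (correct (B i j) ρ))) eB))
    where
    A = proj₁ (f $ⁿ Vec.map Ι (Vec.allFin n))
    B = proj₂ (f $ⁿ Vec.map Ι (Vec.allFin n))

  solveVec : ∀ n (f : N-ary n (Expr ℤ n) ((Fin 4 → Expr ℤ n) × (Fin 4 → Expr ℤ n))) (ρ : Vec Carrier n) →
    let u , v = f $ⁿ Vec.map Ι (Vec.allFin n) in
    Vec.tabulate (λ i → ⟦ u i ⇓⟧ ρ) ≡ Vec.tabulate (λ i → ⟦ v i ⇓⟧ ρ) →
    ∀ {u′ v′ : Vec4} → Vec.tabulate (λ i → ⟦ u i ⟧ ρ) ≡ Vec.tabulate u′ → Vec.tabulate (λ i → ⟦ v i ⟧ ρ) ≡ Vec.tabulate v′ →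
    ∀ i → u′ i ≡ v′ i
  solveVec n f ρ e {u′} {v′} eu ev = tabulate-injective u′ v′ (trans (sym eu) (trans (Vecₚ.tabulate-cong λ i →
    trans (sym (correct (u i) ρ)) (trans (tabulate-injective (λ i → ⟦ u i ⇓⟧ ρ) (λ i → ⟦ v i ⇓⟧ ρ) e i) (correct (v i) ρ))) ev))
    where
    u = proj₁ (f $ⁿ Vec.map Ι (Vec.allFin n))
    v = proj₂ (f $ⁿ Vec.map Ι (Vec.allFin n))

  sum4-cong : ∀ {f g : Vec4} → (∀ j → f j ≡ g j) → sum4 f ≡ sum4 g
  sum4-cong e = cong₂ _+_ (cong₂ _+_ (cong₂ _+_ (e 0F) (e 1F)) (e 2F)) (e 3F)

  sum4-scaleˡ : ∀ c (f : Vec4) → sum4 (λ j → c * f j) ≡ c * sum4 f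
  sum4-scaleˡ c f = solve 5 (λ c x y z w → c :* x :+ c :* y :+ c :* z :+ c :* w := c :* (x :+ y :+ z :+ w))
    refl c (f 0F) (f 1F) (f 2F) (f 3F)

  sum4-scaleʳ : ∀ c (f : Vec4) → sum4 (λ j → f j * c) ≡ sum4 f * c
  sum4-scaleʳ c f = trans (sum4-cong (λ j → *-comm (f j) c)) (trans (sum4-scaleˡ c f) (*-comm c (sum4 f)))

  sum4-+ : ∀ (f g : Vec4) → sum4 (λ j → f j + g j) ≡ sum4 f + sum4 g
  sum4-+ f g = solve 8 (λ x y z w x′ y′ z′ w′ → (x :+ x′) :+ (y :+ y′) :+ (z :+ z′) :+ (w :+ w′) :=
    (x :+ y :+ z :+ w) :+ (x′ :+ y′ :+ z′ :+ w′)) refl (f 0F) (f 1F) (f 2F) (f 3F) (g 0F) (g 1F) (g 2F) (g 3F)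

  sum4-swap : ∀ (f : Mat) → sum4 (λ j → sum4 (λ k → f k j)) ≡ sum4 (λ k → sum4 (λ j → f k j))
  sum4-swap f = trans (sum4-+ (λ j → f 0F j + f 1F j + f 2F j) (f 3F)) (cong (_+ sum4 (f 3F))
    (trans (sum4-+ (λ j → f 0F j + f 1F j) (f 2F)) (cong (_+ sum4 (f 2F)) (sum4-+ (f 0F) (f 1F)))))

  ⊗-assoc : ∀ A B C i l → ((A ⊗ B) ⊗ C) i l ≡ (A ⊗ (B ⊗ C)) i l
  ⊗-assoc A B C i l = begin
    sum4 (λ j → sum4 (λ k → A i k * B k j) * C j l)     ≡⟨ sum4-cong (λ j → sym (sum4-scaleʳ (C j l) (λ k → A i k * B k j))) ⟩
    sum4 (λ j → sum4 (λ k → A i k * B k j * C j l))     ≡⟨ sum4-swap (λ k j → A i k * B k j * C j l) ⟩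
    sum4 (λ k → sum4 (λ j → A i k * B k j * C j l))     ≡⟨ sum4-cong (λ k → sum4-cong (λ j → *-assoc (A i k) (B k j) (C j l))) ⟩
    sum4 (λ k → sum4 (λ j → A i k * (B k j * C j l)))   ≡⟨ sum4-cong (λ k → sum4-scaleˡ (A i k) (λ j → B k j * C j l)) ⟩
    sum4 (λ k → A i k * sum4 (λ j → B k j * C j l))     ∎
    where open ≡-Reasoning

  ⊗-identityˡ : ∀ A i j → (Id ⊗ A) i j ≡ A i j
  ⊗-identityˡ A 0F j = solve 4 (λ x y z w → 1ₑ :* x :+ 0ₑ :* y :+ 0ₑ :* z :+ 0ₑ :* w := x) refl (A 0F j) (A 1F j) (A 2F j) (A 3F j)
  ⊗-identityˡ A 1F j = solve 4 (λ x y z w → 0ₑ :* x :+ 1ₑ :* y :+ 0ₑ :* z :+ 0ₑ :* w := y) refl (A 0F j) (A 1F j) (A 2F j) (A 3F j)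
  ⊗-identityˡ A 2F j = solve 4 (λ x y z w → 0ₑ :* x :+ 0ₑ :* y :+ 1ₑ :* z :+ 0ₑ :* w := z) refl (A 0F j) (A 1F j) (A 2F j) (A 3F j)
  ⊗-identityˡ A 3F j = solve 4 (λ x y z w → 0ₑ :* x :+ 0ₑ :* y :+ 0ₑ :* z :+ 1ₑ :* w := w) refl (A 0F j) (A 1F j) (A 2F j) (A 3F j)

  ⊗-identityʳ : ∀ A i j → (A ⊗ Id) i j ≡ A i j
  ⊗-identityʳ A i 0F = solve 4 (λ x y z w → x :* 1ₑ :+ y :* 0ₑ :+ z :* 0ₑ :+ w :* 0ₑ := x) refl (A i 0F) (A i 1F) (A i 2F) (A i 3F)
  ⊗-identityʳ A i 1F = solve 4 (λ x y z w → x :* 0ₑ :+ y :* 1ₑ :+ z :* 0ₑ :+ w :* 0ₑ := y) refl (A i 0F) (A i 1F) (A i 2F) (A i 3F)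
  ⊗-identityʳ A i 2F = solve 4 (λ x y z w → x :* 0ₑ :+ y :* 0ₑ :+ z :* 1ₑ :+ w :* 0ₑ := z) refl (A i 0F) (A i 1F) (A i 2F) (A i 3F)
  ⊗-identityʳ A i 3F = solve 4 (λ x y z w → x :* 0ₑ :+ y :* 0ₑ :+ z :* 0ₑ :+ w :* 1ₑ := w) refl (A i 0F) (A i 1F) (A i 2F) (A i 3F)

  -- A vector is read as the matrix all of whose columns equal it, so this is associativity in
  -- column `0F`.
  apply-⊗ : ∀ A B v i → apply (A ⊗ B) v i ≡ apply A (apply B v) i
  apply-⊗ A B v i = ⊗-assoc A B (λ j _ → v j) i 0F

  apply-Id : ∀ v i → apply Id v i ≡ v i
  apply-Id v i = ⊗-identityˡ (λ j _ → v j) i 0F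

  apply-cong : ∀ A {u v : Vec4} → (∀ i → u i ≡ v i) → ∀ i → apply A u i ≡ apply A v i
  apply-cong A e i = sum4-cong (λ j → cong (A i j *_) (e j))

  apply-scale : ∀ A c (v : Vec4) i → apply A (λ j → c * v j) i ≡ c * apply A v i
  apply-scale A c v i = trans (sum4-cong (λ j → solve 3 (λ a c v → a :* (c :* v) := c :* (a :* v)) refl (A i j) c (v j)))
    (sum4-scaleˡ c (λ j → A i j * v j))

  apply-comb : ∀ A a u b v i → apply A (comb a u b v) i ≡ comb a (apply A u) b (apply A v) i
  apply-comb A a u b v i = trans (sum4-cong (λ j → distribˡ (A i j) (a * u j) (b * v j)))
    (trans (sum4-+ (λ j → A i j * (a * u j)) (λ j → A i j * (b * v j)))
           (cong₂ _+_ (apply-scale A a u i) (apply-scale A b v i)))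

  ≡⇒≃ : ∀ {A B} → (∀ i j → A i j ≡ B i j) → A ≃ B
  ≡⇒≃ e = 1# , 1≢0 , λ i j → trans (sym (e i j)) (sym (*-identityˡ _))

  ≃-refl : ∀ A → A ≃ A
  ≃-refl A = ≡⇒≃ {A} {A} (λ _ _ → refl)

  ≃-sym : ∀ {A B} → A ≃ B → B ≃ A
  ≃-sym {A} {B} (c , c≢0 , e) = c≢0 ⁻¹ , ⁻¹-nonzero c≢0 , λ i j → begin
    A i j                    ≡⟨ sym (*-identityˡ _) ⟩
    1# * A i j               ≡⟨ cong (_* A i j) (sym (inverseˡ c≢0)) ⟩
    c≢0 ⁻¹ * c * A i j       ≡⟨ *-assoc _ _ _ ⟩
    c≢0 ⁻¹ * (c * A i j)     ≡⟨ cong (c≢0 ⁻¹ *_) (sym (e i j)) ⟩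
    c≢0 ⁻¹ * B i j           ∎
    where open ≡-Reasoning

  ≃-trans : ∀ {A B C} → A ≃ B → B ≃ C → A ≃ C
  ≃-trans (c , c≢0 , e) (c′ , c′≢0 , e′) = c′ * c , *-nonzero c′≢0 c≢0 ,
    λ i j → trans (e′ i j) (trans (cong (c′ *_) (e i j)) (sym (*-assoc _ _ _)))

  ⊗-cong : ∀ {A A′ B B′} → A ≃ A′ → B ≃ B′ → (A ⊗ B) ≃ (A′ ⊗ B′)
  ⊗-cong {A} {A′} {B} {B′} (c , c≢0 , e) (c′ , c′≢0 , e′) = c * c′ , *-nonzero c≢0 c′≢0 , λ i j →
    trans (sum4-cong (λ m → trans (cong₂ _*_ (e i m) (e′ m j))
             (solve 4 (λ c a c′ b → (c :* a) :* (c′ :* b) := (c :* c′) :* (a :* b)) refl c (A i m) c′ (B m j))))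
          (sum4-scaleˡ (c * c′) (λ m → A i m * B m j))

  -- The usual `C` = C(AB) = (CA)B = `B`, up to scalars. It serves the constructor `inv`, where the
  -- inverse is an arbitrary matrix about which only `A ⊗ B` is known.
  inverse-unique : ∀ {A B C} → (C ⊗ A) ≃ Id → (A ⊗ B) ≃ Id → C ≃ B
  inverse-unique {A} {B} {C} CA AB = ≃-trans (≃-sym (≡⇒≃ (⊗-identityʳ C))) (≃-trans (⊗-cong (≃-refl C) (≃-sym AB))
    (≃-trans (≡⇒≃ (λ i j → sym (⊗-assoc C A B i j))) (≃-trans (⊗-cong CA (≃-refl B)) (≡⇒≃ (⊗-identityˡ B)))))

  -- Rows 0, 2 and 3 hold the coefficients of (cy+d)², (cy+d)(ay+b) and (ay+b)² in 1, y, y²: the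
  -- symmetric square of a 2×2 matrix, with `κ` acting on X₁ alone. The ring operations are
  -- parameters so that the same rows yield both the matrix and its solver expression.
  stdRows : ∀ {C : Set} (_+_ _*_ : C → C → C) (0# 2# a b c d κ : C) → Vec (Vec C 4) 4
  stdRows _+_ _*_ 0# 2# a b c d κ =
    (d * d ∷ 0# ∷ (2# * (c * d)) ∷ c * c ∷ []) ∷
    (0# ∷ κ ∷ 0# ∷ 0# ∷ []) ∷
    (b * d ∷ 0# ∷ ((a * d) + (b * c)) ∷ a * c ∷ []) ∷
    (b * b ∷ 0# ∷ (2# * (a * b)) ∷ a * a ∷ []) ∷ []

  -- The collineation of X⁺ induced by y ↦ (ay + b)/(cy + d), x ↦ κx/(cy + d)².
  Std : (a b c d κ : Carrier) → Mat
  Std a b c d κ = fromRows (stdRows _+_ _*_ 0# 2# a b c d κ)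

  Stdₑ : ∀ {n} (a b c d κ : Expr ℤ n) → Matₑ n
  Stdₑ a b c d κ i j = lookup (lookup (stdRows _:+_ _:*_ 0ₑ 2ₑ a b c d κ) i) j

  sum4ₑ : ∀ {n} → (Fin 4 → Expr ℤ n) → Expr ℤ n
  sum4ₑ f = f 0F :+ f 1F :+ f 2F :+ f 3F

  applyₑ : ∀ {n} → Matₑ n → (Fin 4 → Expr ℤ n) → Fin 4 → Expr ℤ n
  applyₑ A v i = sum4ₑ (λ j → A i j :* v j)

  vecₑ : ∀ {n} (a b c d : Expr ℤ n) → Fin 4 → Expr ℤ n
  vecₑ a b c d = lookup (a ∷ b ∷ c ∷ d ∷ [])

  -- The symmetric square is multiplicative, so these matrices multiply as pairs of a 2×2 matrix and
  -- a scalar `κ`.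
  Std-⊗ : ∀ a b c d κ a′ b′ c′ d′ κ′ i j → (Std a b c d κ ⊗ Std a′ b′ c′ d′ κ′) i j ≡
    Std (a * a′ + b * c′) (a * b′ + b * d′) (c * a′ + d * c′) (c * b′ + d * d′) (κ * κ′) i j
  Std-⊗ a b c d κ a′ b′ c′ d′ κ′ = solveMat 10
    (λ a b c d κ a′ b′ c′ d′ κ′ → (λ i l → sum4ₑ (λ j → Stdₑ a b c d κ i j :* Stdₑ a′ b′ c′ d′ κ′ j l)) ,
      Stdₑ (a :* a′ :+ b :* c′) (a :* b′ :+ b :* d′) (c :* a′ :+ d :* c′) (c :* b′ :+ d :* d′) (κ :* κ′))
    (a ∷ b ∷ c ∷ d ∷ κ ∷ a′ ∷ b′ ∷ c′ ∷ d′ ∷ κ′ ∷ []) refl refl refl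

  -- The entries are quadratic in `a`, `b`, `c`, `d` but linear in `κ`; hence `κ` has to absorb u²
  -- for the collineation to stay the same.
  Std-scale : ∀ u a b c d κ i j → Std (u * a) (u * b) (u * c) (u * d) (u * u * κ) i j ≡ u * u * Std a b c d κ i j
  Std-scale u a b c d κ = solveMat 6
    (λ u a b c d κ → Stdₑ (u :* a) (u :* b) (u :* c) (u :* d) (u :* u :* κ) , (λ i j → u :* u :* Stdₑ a b c d κ i j))
    (u ∷ a ∷ b ∷ c ∷ d ∷ κ ∷ []) refl refl refl

  Std-cong : ∀ {a b c d κ a′ b′ c′ d′ κ′} → a ≡ a′ → b ≡ b′ → c ≡ c′ → d ≡ d′ → κ ≡ κ′ →
    Std a b c d κ ≃ Std a′ b′ c′ d′ κ′
  Std-cong refl refl refl refl refl = ≃-refl _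

  Std-Id : Std 1# 0# 0# 1# 1# ≃ Id
  Std-Id = ≡⇒≃ (solveMat 0 (Stdₑ 1ₑ 0ₑ 0ₑ 1ₑ 1ₑ , (λ i j → lookup (lookup ((1ₑ ∷ 0ₑ ∷ 0ₑ ∷ 0ₑ ∷ []) ∷ (0ₑ ∷ 1ₑ ∷ 0ₑ ∷ 0ₑ ∷ []) ∷
                 (0ₑ ∷ 0ₑ ∷ 1ₑ ∷ 0ₑ ∷ []) ∷ (0ₑ ∷ 0ₑ ∷ 0ₑ ∷ 1ₑ ∷ []) ∷ []) i) j)) [] refl refl refl)

-- Conjugation x ↦ x^q and the exponents k and h.

module Conjugation (K : Field) (p q k : ℕ) (E : QuadraticExtension K p q k) where
  open Field K
  open FieldAlgebra K
  open Geometry K p q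
  open Powers K p q
  open QuadraticExtension E
  open Solver
  open ≡-Reasoning

  half≡1+k : half ≡ suc k
  half≡1+k = trans (cong (λ q → (q ℕ.+ 1) / 2) q≡1+2k)
    (trans (cong (_/ 2) (ℕSolver.solve 1 (λ k → con 1 :+ℕ (k :+ℕ k) :+ℕ con 1 :=ℕ (con 1 :+ℕ k) :*ℕ con 2) refl k)) (m*n/n≡m (suc k) 2))
    where
    module ℕSolver = Data.Nat.Solver.+-*-Solver
    open ℕSolver using (con) renaming (_:+_ to _:+ℕ_; _:*_ to _:*ℕ_; _:=_ to _:=ℕ_)

  conj : Carrier → Carrier
  conj x = x ^ q

  ^half : ∀ x → x ^ half ≡ x * (x ^ k)
  ^half x = cong (x ^_) half≡1+k

  conj≡ : ∀ x → conj x ≡ x * ((x ^ k) * (x ^ k))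
  conj≡ x = trans (cong (x ^_) q≡1+2k) (cong (x *_) (^-homo-+ x k k))

  norm≡ : ∀ x → x ^ (q ℕ.+ 1) ≡ x * conj x
  norm≡ x = trans (^-homo-+ x q 1) (trans (cong (conj x *_) (x^1≡x x)) (*-comm _ _))

  -- The identity 2h = q+1, written with q = 2k+1 and h = k+1. It is the bridge between the curve,
  -- which involves h-th powers, and the Hermitian form, which involves norms.
  half²≡norm : ∀ x → (x ^ half) * (x ^ half) ≡ x * conj x
  half²≡norm x = trans (cong₂ _*_ (^half x) (^half x)) (trans
    (solve 2 (λ x y → (x :* y) :* (x :* y) := x :* (x :* (y :* y))) refl x (x ^ k)) (cong (x *_) (sym (conj≡ x))))

  conj-* : ∀ x y → conj (x * y) ≡ conj x * conj y
  conj-* x y = ^-distrib-* x y q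

  conj-0 : conj 0# ≡ 0#
  conj-0 = trans (conj≡ 0#) (zeroˡ _)

  conj-1 : conj 1# ≡ 1#
  conj-1 = 1^n≡1 q

  conj-neg : ∀ x → conj (- x) ≡ - conj x
  conj-neg x = x-y≡0⇒x≡y (begin
    conj (- x) + - - conj x    ≡⟨ solve 2 (λ a b → a :- :- b := a :+ b) refl (conj (- x)) (conj x) ⟩
    conj (- x) + conj x        ≡⟨ sym (conj-+ (- x) x) ⟩
    conj (- x + x)             ≡⟨ cong conj (-‿inverseˡ x) ⟩
    conj 0#                    ≡⟨ conj-0 ⟩
    0#                         ∎)

  conj-nonzero : ∀ {x} → x ≢ 0# → conj x ≢ 0#
  conj-nonzero = ^-nonzero q

  Fq-0 : InFq 0#
  Fq-0 = conj-0

  Fq-1 : InFq 1#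
  Fq-1 = conj-1

  Fq-+ : ∀ {x y} → InFq x → InFq y → InFq (x + y)
  Fq-+ {x} {y} x∈ y∈ = trans (conj-+ x y) (cong₂ _+_ x∈ y∈)

  Fq-* : ∀ {x y} → InFq x → InFq y → InFq (x * y)
  Fq-* {x} {y} x∈ y∈ = trans (conj-* x y) (cong₂ _*_ x∈ y∈)

  Fq-neg : ∀ {x} → InFq x → InFq (- x)
  Fq-neg {x} x∈ = trans (conj-neg x) (cong -_ x∈)

  Fq-2 : InFq 2#
  Fq-2 = Fq-+ Fq-1 Fq-1

  Fq-⁻¹ : ∀ {x y} → y * x ≡ 1# → InFq x → InFq y
  Fq-⁻¹ {x} {y} e x∈ = *-cancelʳ (proj₂ (factor-nonzero e 1≢0)) (begin
    conj y * x        ≡⟨ cong (conj y *_) (sym x∈) ⟩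
    conj y * conj x   ≡⟨ sym (conj-* y x) ⟩
    conj (y * x)      ≡⟨ cong conj e ⟩
    conj 1#           ≡⟨ conj-1 ⟩
    1#                ≡⟨ sym e ⟩
    y * x             ∎)

  Fq-^k : ∀ {x} → x ≢ 0# → InFq x → (x ^ k) * (x ^ k) ≡ 1#
  Fq-^k {x} x≢0 x∈ = *-cancelˡ x≢0 (trans (sym (conj≡ x)) (trans x∈ (sym (*-identityʳ x))))

  Fq-square^k : ∀ {x} → x ≢ 0# → InFq x → (x * x) ^ k ≡ 1#
  Fq-square^k {x} x≢0 x∈ = trans (^-distrib-* x x k) (Fq-^k x≢0 x∈)

  -1≢1 : - 1# ≢ 1#
  -1≢1 e = 2≢0 (trans (cong (1# +_) (sym e)) (-‿inverseʳ 1#))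

  ±1 : ∀ {ε} → ε * ε ≡ 1# → ε ≡ 1# ⊎ ε ≡ - 1#
  ±1 {ε} e with ε ≟ 1#
  ... | yes ε≡1 = inj₁ ε≡1
  ... | no  ε≢1 = inj₂ (x-y≡0⇒x≡y (xy≡0⇒y≡0 (λ z → ε≢1 (x-y≡0⇒x≡y z))
    (trans (solve 1 (λ ε → (ε :- 1ₑ) :* (ε :- :- 1ₑ) := ε :* ε :- 1ₑ) refl ε) (x≡y⇒x-y≡0 e))))

  -1*-1≡1 : - 1# * - 1# ≡ 1#
  -1*-1≡1 = solve 0 (:- 1ₑ :* :- 1ₑ := 1ₑ) refl

  -- This is where q ≡ 1 mod 4 takes effect; `neg^k`, `neg^half` and all the signs attached to ζ =
  -- -1 derive from it.
  -1^k≡1 : (- 1#) ^ k ≡ 1#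
  -1^k≡1 with k-even
  ... | r , refl = trans (^-homo-+ (- 1#) r r) (trans (sym (^-distrib-* (- 1#) (- 1#) r)) (trans (cong (_^ r) -1*-1≡1) (1^n≡1 r)))

  neg^k : ∀ x → (- x) ^ k ≡ x ^ k
  neg^k x = begin
    (- x) ^ k                ≡⟨ cong (_^ k) (solve 1 (λ x → :- x := :- 1ₑ :* x) refl x) ⟩
    (- 1# * x) ^ k           ≡⟨ ^-distrib-* (- 1#) x k ⟩
    ((- 1#) ^ k) * (x ^ k)   ≡⟨ cong (_* (x ^ k)) -1^k≡1 ⟩
    1# * (x ^ k)             ≡⟨ *-identityˡ _ ⟩
    x ^ k                    ∎

  neg^half : ∀ x → (- x) ^ half ≡ - (x ^ half)
  neg^half x = begin
    (- x) ^ half      ≡⟨ ^half (- x) ⟩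
    - x * ((- x) ^ k) ≡⟨ cong (- x *_) (neg^k x) ⟩
    - x * (x ^ k)     ≡⟨ solve 2 (λ x y → :- x :* y := :- (x :* y)) refl x (x ^ k) ⟩
    - (x * (x ^ k))   ≡⟨ cong -_ (sym (^half x)) ⟩
    - (x ^ half)      ∎

  1^half : 1# ^ half ≡ 1#
  1^half = 1^n≡1 half

  -1^half : (- 1#) ^ half ≡ - 1#
  -1^half = trans (neg^half 1#) (cong -_ 1^half)

  0^half : 0# ^ half ≡ 0#
  0^half = trans (^half 0#) (zeroˡ _)

  square≡0 : ∀ {x} → x * x ≡ 0# → x ≡ 0#
  square≡0 {x} e with x ≟ 0#
  ... | yes x≡0 = x≡0
  ... | no  x≢0 = xy≡0⇒y≡0 x≢0 e

  norm≡0 : ∀ {x} → x * conj x ≡ 0# → x ≡ 0#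
  norm≡0 {x} e with x ≟ 0#
  ... | yes x≡0 = x≡0
  ... | no  x≢0 = ⊥-elim (*-nonzero x≢0 (conj-nonzero x≢0) e)

-- The quadratic character on 𝔊, and ℌ as its kernel.

module Group (K : Field) (p q k : ℕ) (E : QuadraticExtension K p q k) where
  open Field K
  open FieldAlgebra K
  open Geometry K p q
  open Powers K p q
  open Matrices K p q
  open QuadraticExtension E
  open Conjugation K p q k E
  open Mult semiring using () renaming (_×_ to _×ₙ_)
  open Solver
  open ≡-Reasoning

  det : (a b c d : Carrier) → Carrier
  det a b c d = a * d + - (b * c)

  -- ε is the quadratic character of the determinant, so ε = 1 singles out ℌ inside 𝔊.
  record Rep (ε : Carrier) (A : Mat) : Set where
    constructor rep
    field
      {a b c d κ} : Carrier
      a∈ : InFq a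
      b∈ : InFq b
      c∈ : InFq c
      d∈ : InFq d
      det≢0  : det a b c d ≢ 0#
      κ^half : κ ^ half ≡ det a b c d
      det^k  : det a b c d ^ k ≡ ε
      std    : Std a b c d κ ≃ A

    det∈ : InFq (det a b c d)
    det∈ = Fq-+ (Fq-* a∈ d∈) (Fq-neg (Fq-* b∈ c∈))

  rep-≃ : ∀ {ε A B} → Rep ε A → A ≃ B → Rep ε B
  rep-≃ (rep a∈ b∈ c∈ d∈ D≢0 κ^h D^k S≃A) A≃B = rep a∈ b∈ c∈ d∈ D≢0 κ^h D^k (≃-trans S≃A A≃B)

  rep-sign : ∀ {ε A} → Rep ε A → ε ≡ 1# ⊎ ε ≡ - 1#
  rep-sign R = ±1 (trans (cong₂ _*_ (sym det^k) (sym det^k)) (Fq-^k det≢0 det∈))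
    where open Rep R

  rep-Id : Rep 1# Id
  rep-Id = rep Fq-1 Fq-0 Fq-0 Fq-1 (λ e → 1≢0 (trans (sym det≡1) e)) (trans 1^half (sym det≡1))
    (trans (cong (_^ k) det≡1) (1^n≡1 k)) Std-Id
    where
    det≡1 : det 1# 0# 0# 1# ≡ 1#
    det≡1 = solve 0 (1ₑ :* 1ₑ :- 0ₑ :* 0ₑ := 1ₑ) refl

  rep-⊗ : ∀ {ε ε′ A B} → Rep ε A → Rep ε′ B → Rep (ε * ε′) (A ⊗ B)
  rep-⊗ {ε} {ε′} {A} {B} RA RB = rep
    (Fq-+ (Fq-* a∈ a∈′) (Fq-* b∈ c∈′)) (Fq-+ (Fq-* a∈ b∈′) (Fq-* b∈ d∈′))
    (Fq-+ (Fq-* c∈ a∈′) (Fq-* d∈ c∈′)) (Fq-+ (Fq-* c∈ b∈′) (Fq-* d∈ d∈′))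
    (λ e → *-nonzero det≢0 det≢0′ (trans (sym det-⊗) e))
    (trans (^-distrib-* κ κ′ half) (trans (cong₂ _*_ κ^half κ^half′) (sym det-⊗)))
    (trans (cong (_^ k) det-⊗) (trans (^-distrib-* _ _ k) (cong₂ _*_ det^k det^k′)))
    (≃-trans (≃-sym (≡⇒≃ (Std-⊗ a b c d κ a′ b′ c′ d′ κ′))) (⊗-cong std std′))
    where
    open Rep RA
    open Rep RB using () renaming (a to a′; b to b′; c to c′; d to d′; κ to κ′; a∈ to a∈′; b∈ to b∈′; c∈ to c∈′; d∈ to d∈′;
                                   det≢0 to det≢0′; κ^half to κ^half′; det^k to det^k′; std to std′)
    det-⊗ : det (a * a′ + b * c′) (a * b′ + b * d′) (c * a′ + d * c′) (c * b′ + d * d′) ≡ det a b c d * det a′ b′ c′ d′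
    det-⊗ = solve 8 (λ a b c d a′ b′ c′ d′ →
      (a :* a′ :+ b :* c′) :* (c :* b′ :+ d :* d′) :- (a :* b′ :+ b :* d′) :* (c :* a′ :+ d :* c′) :=
      (a :* d :- b :* c) :* (a′ :* d′ :- b′ :* c′)) refl a b c d a′ b′ c′ d′

  -- The inverse is the adjugate (d, -b, -c, a), of the same determinant `D`. With `κ′` = D²/κ both
  -- products become `D * D` times the identity, and `κ′` satisfies its own condition because
  -- (κ′κ)^h = D^(2h) = D², as `D` lies in F_q.
  rep-inverse : ∀ {ε A} → Rep ε A → ∃ λ B → Rep ε B × (B ⊗ A) ≃ Id × (A ⊗ B) ≃ Id
  rep-inverse {ε} {A} RA = S′ , rep d∈ (Fq-neg b∈) (Fq-neg c∈) a∈
      (λ e → det≢0 (trans (sym det′≡det) e)) κ′^half (trans (cong (_^ k) det′≡det) det^k) (≃-refl S′) ,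
    ≃-trans (⊗-cong (≃-refl S′) (≃-sym std)) (≃-trans (≡⇒≃ (Std-⊗ d (- b) (- c) a κ′ a b c d κ)) (scalar _ _ _ _ _
      (solve 4 (λ a b c d → d :* a :+ :- b :* c := a :* d :- b :* c) refl a b c d)
      (solve 2 (λ b d → d :* b :+ :- b :* d := 0ₑ) refl b d)
      (solve 2 (λ a c → :- c :* a :+ a :* c := 0ₑ) refl a c)
      (solve 4 (λ a b c d → :- c :* b :+ a :* d := a :* d :- b :* c) refl a b c d) κ′κ)) ,
    ≃-trans (⊗-cong (≃-sym std) (≃-refl S′)) (≃-trans (≡⇒≃ (Std-⊗ a b c d κ d (- b) (- c) a κ′)) (scalar _ _ _ _ _
      (solve 4 (λ a b c d → a :* d :+ b :* :- c := a :* d :- b :* c) refl a b c d)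
      (solve 2 (λ a b → a :* :- b :+ b :* a := 0ₑ) refl a b)
      (solve 2 (λ c d → c :* d :+ d :* :- c := 0ₑ) refl c d)
      (solve 4 (λ a b c d → c :* :- b :+ d :* a := a :* d :- b :* c) refl a b c d) (trans (*-comm κ κ′) κ′κ)))
    where
    open Rep RA
    D = det a b c d
    κ≢0 : κ ≢ 0#
    κ≢0 κ≡0 = det≢0 (trans (sym κ^half) (trans (cong (_^ half) κ≡0) 0^half))
    κ′ = D * D * κ≢0 ⁻¹
    S′ = Std d (- b) (- c) a κ′
    κ′κ : κ′ * κ ≡ D * D * 1#
    κ′κ = trans (*-assoc _ _ _) (cong (D * D *_) (inverseˡ κ≢0))
    det′≡det : det d (- b) (- c) a ≡ D
    det′≡det = solve 4 (λ a b c d → d :* a :- (:- b) :* (:- c) := a :* d :- b :* c) refl a b c d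
    κ′^half : κ′ ^ half ≡ det d (- b) (- c) a
    κ′^half = trans (*-cancelʳ det≢0 (begin
      (κ′ ^ half) * D             ≡⟨ cong ((κ′ ^ half) *_) (sym κ^half) ⟩
      (κ′ ^ half) * (κ ^ half)    ≡⟨ sym (^-distrib-* κ′ κ half) ⟩
      (κ′ * κ) ^ half             ≡⟨ cong (_^ half) (trans κ′κ (*-identityʳ _)) ⟩
      (D * D) ^ half              ≡⟨ ^-distrib-* D D half ⟩
      (D ^ half) * (D ^ half)     ≡⟨ half²≡norm D ⟩
      D * conj D                  ≡⟨ cong (D *_) det∈ ⟩
      D * D                       ∎)) (sym det′≡det)
    scalar : ∀ a′ b′ c′ d′ κ″ → a′ ≡ D → b′ ≡ 0# → c′ ≡ 0# → d′ ≡ D → κ″ ≡ D * D * 1# → Std a′ b′ c′ d′ κ″ ≃ Id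
    scalar _ _ _ _ _ refl refl refl refl refl = ≃-trans
      (Std-cong (sym (*-identityʳ D)) (sym (zeroʳ D)) (sym (zeroʳ D)) (sym (*-identityʳ D)) refl)
      (≃-trans (≃-sym (D * D , *-nonzero det≢0 det≢0 , Std-scale D 1# 0# 0# 1# 1#)) Std-Id)

  rep-inv : ∀ {ε A B} → Rep ε A → (A ⊗ B) ≃ Id → Rep ε B
  rep-inv {A = A} RA AB = let C , RC , CA , _ = rep-inverse RA in rep-≃ RC (inverse-unique {A = A} CA AB)

  rep-mpow : ∀ {ε A} → Rep ε A → ∀ n → Rep (ε ^ n) (mpow A n)
  rep-mpow R zero    = rep-Id
  rep-mpow R (suc n) = rep-⊗ R (rep-mpow R n)

  -- In a scalar matrix the corner entries c² and b² vanish, and comparing ad+bc with d² gives `D` =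
  -- d², a square in F_q. Through `rep-unique` this makes the character well defined.
  rep-Id⇒1 : ∀ {ε} → Rep ε Id → ε ≡ 1#
  rep-Id⇒1 R with Rep.std R
  ... | t , t≢0 , e = trans (sym det^k) (trans (cong (_^ k) det≡dd) (Fq-square^k d≢0 d∈))
    where
    open Rep R
    c≡0 : c ≡ 0#
    c≡0 = square≡0 (xy≡0⇒y≡0 t≢0 (sym (e 0F 3F)))
    b≡0 : b ≡ 0#
    b≡0 = square≡0 (xy≡0⇒y≡0 t≢0 (sym (e 3F 0F)))
    d≢0 : d ≢ 0#
    d≢0 = proj₁ (factor-nonzero refl (proj₂ (factor-nonzero (sym (e 0F 0F)) 1≢0)))
    ad≡dd : a * d + b * c ≡ d * d
    ad≡dd = *-cancelˡ t≢0 (trans (sym (e 2F 2F)) (e 0F 0F))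
    det≡dd : det a b c d ≡ d * d
    det≡dd = trans (trans (cong (λ z → a * d + - (z * c)) b≡0)
      (trans (solve 3 (λ a c d → a :* d :- 0ₑ :* c := a :* d :+ 0ₑ :* c) refl a c d) (cong (λ z → a * d + z * c) (sym b≡0)))) ad≡dd

  rep-unique : ∀ {ε ε′ A} → Rep ε A → Rep ε′ A → ε * ε′ ≡ 1#
  rep-unique RA RA′ = let B , RB , _ , AB = rep-inverse RA′ in rep-Id⇒1 (rep-≃ (rep-⊗ RA RB) AB)

  rep-exclusive : ∀ {A} → Rep 1# A → ¬ Rep (- 1#) A
  rep-exclusive R R′ = -1≢1 (trans (sym (*-identityˡ _)) (rep-unique R R′))

  rep-std : ∀ {a b c d κ D} → InFq a → InFq b → InFq c → InFq d → det a b c d ≡ D → D ≢ 0# → κ ^ half ≡ D →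
            ∀ {A} → Std a b c d κ ≃ A → Rep (D ^ k) A
  rep-std a∈ b∈ c∈ d∈ refl D≢0 κ^h S≃A = rep a∈ b∈ c∈ d∈ D≢0 κ^h refl S≃A

  rowsₑ : ∀ {n} → Vec (Vec (Expr ℤ n) 4) 4 → Matₑ n
  rowsₑ m i j = lookup (lookup m i) j

  T≃ : ∀ α → Std 1# α 0# 1# 1# ≃ T α
  T≃ α = ≡⇒≃ (solveMat 1 (λ α → Stdₑ 1ₑ α 0ₑ 1ₑ 1ₑ , rowsₑ ((1ₑ ∷ 0ₑ ∷ 0ₑ ∷ 0ₑ ∷ []) ∷ (0ₑ ∷ 1ₑ ∷ 0ₑ ∷ 0ₑ ∷ []) ∷
    (α ∷ 0ₑ ∷ 1ₑ ∷ 0ₑ ∷ []) ∷ (α :* α ∷ 0ₑ ∷ 2ₑ :* α ∷ 1ₑ ∷ []) ∷ [])) (α ∷ []) refl refl refl)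

  L≃ : ∀ lam → Std 1# 0# 0# 1# lam ≃ L lam
  L≃ lam = ≡⇒≃ (solveMat 1 (λ lam → Stdₑ 1ₑ 0ₑ 0ₑ 1ₑ lam , rowsₑ ((1ₑ ∷ 0ₑ ∷ 0ₑ ∷ 0ₑ ∷ []) ∷ (0ₑ ∷ lam ∷ 0ₑ ∷ 0ₑ ∷ []) ∷
    (0ₑ ∷ 0ₑ ∷ 1ₑ ∷ 0ₑ ∷ []) ∷ (0ₑ ∷ 0ₑ ∷ 0ₑ ∷ 1ₑ ∷ []) ∷ [])) (lam ∷ []) refl refl refl)

  N≃ : ∀ σ → Std 0# 1# 1# 0# σ ≃ N σ
  N≃ σ = ≡⇒≃ (solveMat 1 (λ σ → Stdₑ 0ₑ 1ₑ 1ₑ 0ₑ σ , rowsₑ ((0ₑ ∷ 0ₑ ∷ 0ₑ ∷ 1ₑ ∷ []) ∷ (0ₑ ∷ σ ∷ 0ₑ ∷ 0ₑ ∷ []) ∷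
    (0ₑ ∷ 0ₑ ∷ 1ₑ ∷ 0ₑ ∷ []) ∷ (1ₑ ∷ 0ₑ ∷ 0ₑ ∷ 0ₑ ∷ []) ∷ [])) (σ ∷ []) refl refl refl)

  -- diag(ρ⁻¹, 1, 1, ρ) is ρ⁻¹ times diag(1, ρ, ρ, ρ²). The solver does not know that `ρinv * ρ` is
  -- 1, so it works with the unreduced products and `cong₂` reduces them afterwards; likewise in
  -- `R≃`.
  M≃ : ∀ ρinv ρ → ρinv * ρ ≡ 1# → Std ρ 0# 0# 1# ρ ≃ M ρinv ρ
  M≃ ρinv ρ e = ρinv , proj₁ (factor-nonzero e 1≢0) , solveMat 2 (λ ρinv ρ →
    rowsₑ ((ρinv ∷ 0ₑ ∷ 0ₑ ∷ 0ₑ ∷ []) ∷ (0ₑ ∷ ρinv :* ρ ∷ 0ₑ ∷ 0ₑ ∷ []) ∷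
           (0ₑ ∷ 0ₑ ∷ ρinv :* ρ ∷ 0ₑ ∷ []) ∷ (0ₑ ∷ 0ₑ ∷ 0ₑ ∷ ρinv :* ρ :* ρ ∷ []) ∷ []) ,
    λ i j → ρinv :* Stdₑ ρ 0ₑ 0ₑ 1ₑ ρ i j) (ρinv ∷ ρ ∷ []) refl
    (cong₂ (λ v w → (ρinv ∷ 0# ∷ 0# ∷ 0# ∷ []) ∷ (0# ∷ v ∷ 0# ∷ 0# ∷ []) ∷ (0# ∷ 0# ∷ v ∷ 0# ∷ []) ∷ (0# ∷ 0# ∷ 0# ∷ w ∷ []) ∷ [])
      e (trans (cong (_* ρ) e) (*-identityˡ ρ))) refl

  R≃ : ∀ μinv μ → μinv * μ ≡ 1# → Std 0# μ 1# 0# μ ≃ R μinv μ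
  R≃ μinv μ e = μinv , proj₁ (factor-nonzero e 1≢0) , solveMat 2 (λ μinv μ →
    rowsₑ ((0ₑ ∷ 0ₑ ∷ 0ₑ ∷ μinv ∷ []) ∷ (0ₑ ∷ μinv :* μ ∷ 0ₑ ∷ 0ₑ ∷ []) ∷
           (0ₑ ∷ 0ₑ ∷ μinv :* μ ∷ 0ₑ ∷ []) ∷ (μinv :* μ :* μ ∷ 0ₑ ∷ 0ₑ ∷ 0ₑ ∷ []) ∷ []) ,
    λ i j → μinv :* Stdₑ 0ₑ μ 1ₑ 0ₑ μ i j) (μinv ∷ μ ∷ []) refl
    (cong₂ (λ v w → (0# ∷ 0# ∷ 0# ∷ μinv ∷ []) ∷ (0# ∷ v ∷ 0# ∷ 0# ∷ []) ∷ (0# ∷ 0# ∷ v ∷ 0# ∷ []) ∷ (w ∷ 0# ∷ 0# ∷ 0# ∷ []) ∷ [])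
      e (trans (cong (_* μ) e) (*-identityˡ μ))) refl

  nonsquare^k : ∀ {μ} → μ ≢ 0# → NonSquareFq μ → μ ^ k ≡ - 1#
  nonsquare^k μ≢0 (μ∈ , ¬square) with ±1 (Fq-^k μ≢0 μ∈)
  ... | inj₁ μ^k≡1  = ⊥-elim (¬square (euler μ≢0 μ∈ μ^k≡1))
  ... | inj₂ μ^k≡-1 = μ^k≡-1

  rep-L : ∀ lam → lam ^ half ≡ 1# → Rep 1# (L lam)
  rep-L lam lam^h = subst (λ ε → Rep ε (L lam)) (1^n≡1 k) (rep-std Fq-1 Fq-0 Fq-0 Fq-1
    (solve 0 (1ₑ :* 1ₑ :- 0ₑ :* 0ₑ := 1ₑ) refl) 1≢0 lam^h (L≃ lam))

  -- Here `D` = -μ and `κ` = μ. Since μ^k = -1, μ^h = -μ = `D`; and (-μ)^k = μ^k = -1 because `k` is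
  -- even.
  rep-R : ∀ μinv μ → InFq μ → μ ^ k ≡ - 1# → μinv * μ ≡ 1# → Rep (- 1#) (R μinv μ)
  rep-R μinv μ μ∈ μ^k e = subst (λ ε → Rep ε (R μinv μ)) (trans (neg^k μ) μ^k) (rep-std Fq-0 μ∈ Fq-1 Fq-0
    (solve 1 (λ μ → 0ₑ :* 0ₑ :- μ :* 1ₑ := :- μ) refl μ) (neg-nonzero (proj₂ (factor-nonzero e 1≢0)))
    (trans (^half μ) (trans (cong (μ *_) μ^k) (solve 1 (λ μ → μ :* :- 1ₑ := :- μ) refl μ))) (R≃ μinv μ e))

  -- The side condition of each generator supplies κ^h = D: (κ, D) is (1, 1) for `T`, (ρ, ρ) for `M`
  -- with ρ^k = 1, (lam, 1) for `L`, (σ, -1) for `N` and (μ, -μ) for `R` with μ^k = -1.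
  generator-rep : ∀ {A} → GenG A → ∃ λ ε → Rep ε A
  generator-rep (genT α α∈) = _ , rep-std Fq-1 α∈ Fq-0 Fq-1
    (solve 1 (λ α → 1ₑ :* 1ₑ :- α :* 0ₑ := 1ₑ) refl α) 1≢0 1^half (T≃ α)
  generator-rep (genM ρinv ρ (ρ∈ , ρ≢0 , s , s∈ , refl) e) = _ , rep-std ρ∈ Fq-0 Fq-0 Fq-1
    (solve 1 (λ ρ → ρ :* 1ₑ :- 0ₑ :* 0ₑ := ρ) refl ρ) ρ≢0
    (trans (^half ρ) (trans (cong (ρ *_) (Fq-square^k (proj₁ (factor-nonzero refl ρ≢0)) s∈)) (*-identityʳ ρ))) (M≃ ρinv ρ e)
  generator-rep (genL lam lam^h) = _ , rep-L lam lam^h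
  generator-rep (genN σ σ^h) = _ , rep-std Fq-0 Fq-1 Fq-1 Fq-0
    (solve 0 (0ₑ :* 0ₑ :- 1ₑ :* 1ₑ := :- 1ₑ) refl) (neg-nonzero 1≢0) σ^h (N≃ σ)
  generator-rep (genR μinv μ ns e) = _ , rep-R μinv μ (proj₁ ns) (nonsquare^k (proj₂ (factor-nonzero e 1≢0)) ns) e

  𝔊⇒rep : ∀ {A} → 𝔊 A → ∃ λ ε → Rep ε A
  𝔊⇒rep (gen g)      = generator-rep g
  𝔊⇒rep one          = _ , rep-Id
  𝔊⇒rep (mul g h)    = _ , rep-⊗ (proj₂ (𝔊⇒rep g)) (proj₂ (𝔊⇒rep h))
  𝔊⇒rep (inv {A} g AB) = _ , rep-inv {A = A} (proj₂ (𝔊⇒rep g)) AB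
  𝔊⇒rep (resc g A≃B) = _ , rep-≃ (proj₂ (𝔊⇒rep g)) A≃B

  -1^odd : ∀ n → (∃ λ m → n ≡ suc (m ℕ.+ m)) → (- 1#) ^ n ≡ - 1#
  -1^odd _ (m , refl) = trans (cong (- 1# *_) (trans (^-homo-+ (- 1#) m m)
    (trans (sym (^-distrib-* (- 1#) (- 1#) m)) (trans (cong (_^ m) -1*-1≡1) (1^n≡1 m))))) (*-identityʳ _)

  -1^[p^k] : ∀ k → (- 1#) ^ (p ℕ.^ k) ≡ - 1#
  -1^[p^k] zero    = x^1≡x _
  -1^[p^k] (suc k) = trans (^-homo-* (- 1#) p (p ℕ.^ k)) (trans (cong (_^ (p ℕ.^ k)) (-1^odd p p-odd)) (-1^[p^k] k))

  -- `p` is odd, so an element of character -1 has p^m-th power of character -1, which cannot be the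
  -- identity.
  p-element-rep : ∀ {A} → 𝔊 A → PPowerOrder A → Rep 1# A
  p-element-rep g (m , A^[p^m]≃Id) with 𝔊⇒rep g
  ... | ε , R with rep-sign R
  ...   | inj₁ refl = R
  ...   | inj₂ refl = ⊥-elim (-1≢1 (trans (sym (-1^[p^k] m)) (rep-Id⇒1 (rep-≃ (rep-mpow R (p ℕ.^ m)) A^[p^m]≃Id))))

  ℌ⇒rep : ∀ {A} → ℌ A → Rep 1# A
  ℌ⇒rep (gen (genP g pp))      = p-element-rep g pp
  ℌ⇒rep (gen (genL lam lam^h)) = rep-L lam lam^h
  ℌ⇒rep one                    = rep-Id
  ℌ⇒rep (mul {A} {B} g h)      = subst (λ ε → Rep ε (A ⊗ B)) (*-identityˡ 1#) (rep-⊗ (ℌ⇒rep g) (ℌ⇒rep h))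
  ℌ⇒rep (inv {A} g AB)         = rep-inv {A = A} (ℌ⇒rep g) AB
  ℌ⇒rep (resc g A≃B)           = rep-≃ (ℌ⇒rep g) A≃B

  ℌ⇒𝔊 : ∀ {A} → ℌ A → 𝔊 A
  ℌ⇒𝔊 (gen (genP g _))       = g
  ℌ⇒𝔊 (gen (genL lam lam^h)) = gen (genL lam lam^h)
  ℌ⇒𝔊 one                    = one
  ℌ⇒𝔊 (mul g h)              = mul (ℌ⇒𝔊 g) (ℌ⇒𝔊 h)
  ℌ⇒𝔊 (inv g AB)             = inv (ℌ⇒𝔊 g) AB
  ℌ⇒𝔊 (resc g A≃B)           = resc (ℌ⇒𝔊 g) A≃B

  upper lower : Carrier → Mat
  upper α = Std 1# α 0# 1# 1#
  lower γ = Std 1# 0# γ 1# 1#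

  private
    Std-⊗≃ : ∀ a b c d κ a′ b′ c′ d′ κ′ {a″ b″ c″ d″ κ″} →
      a * a′ + b * c′ ≡ a″ → a * b′ + b * d′ ≡ b″ → c * a′ + d * c′ ≡ c″ → c * b′ + d * d′ ≡ d″ → κ * κ′ ≡ κ″ →
      (Std a b c d κ ⊗ Std a′ b′ c′ d′ κ′) ≃ Std a″ b″ c″ d″ κ″
    Std-⊗≃ a b c d κ a′ b′ c′ d′ κ′ e₁ e₂ e₃ e₄ e₅ = ≃-trans (≡⇒≃ (Std-⊗ a b c d κ a′ b′ c′ d′ κ′)) (Std-cong e₁ e₂ e₃ e₄ e₅)

  upper-⊗ : ∀ α β → (upper α ⊗ upper β) ≃ upper (α + β)
  upper-⊗ α β = Std-⊗≃ 1# α 0# 1# 1# 1# β 0# 1# 1#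
    (solve 1 (λ α → 1ₑ :* 1ₑ :+ α :* 0ₑ := 1ₑ) refl α) (solve 2 (λ α β → 1ₑ :* β :+ α :* 1ₑ := α :+ β) refl α β)
    (solve 0 (0ₑ :* 1ₑ :+ 1ₑ :* 0ₑ := 0ₑ) refl) (solve 1 (λ β → 0ₑ :* β :+ 1ₑ :* 1ₑ := 1ₑ) refl β) (*-identityˡ 1#)

  lower-⊗ : ∀ α β → (lower α ⊗ lower β) ≃ lower (α + β)
  lower-⊗ α β = Std-⊗≃ 1# 0# α 1# 1# 1# 0# β 1# 1#
    (solve 1 (λ β → 1ₑ :* 1ₑ :+ 0ₑ :* β := 1ₑ) refl β) (solve 0 (1ₑ :* 0ₑ :+ 0ₑ :* 1ₑ := 0ₑ) refl)
    (solve 2 (λ α β → α :* 1ₑ :+ 1ₑ :* β := α :+ β) refl α β) (solve 1 (λ α → α :* 0ₑ :+ 1ₑ :* 1ₑ := 1ₑ) refl α) (*-identityˡ 1#)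

  -- `U` carries addition to multiplication, so the p-th power of `U α` is `U` at pα = 0. The
  -- witness 1 says that the order divides p^1.
  additive-p-element : (U : Carrier → Mat) → U 0# ≃ Id → (∀ α β → (U α ⊗ U β) ≃ U (α + β)) → ∀ α → PPowerOrder (U α)
  additive-p-element U U0 U+ α = 1 , ≃-trans (subst (λ m → mpow (U α) m ≃ U (p ×ₙ α)) (sym (ℕₚ.*-identityʳ p)) (power p))
    (subst (λ z → U z ≃ Id) (sym (p×x≡0 α)) U0)
    where
    power : ∀ n → mpow (U α) n ≃ U (n ×ₙ α)
    power zero    = ≃-sym U0
    power (suc n) = ≃-trans (⊗-cong (≃-refl (U α)) (power n)) (U+ α (n ×ₙ α))

  upper∈ℌ : ∀ {α} → InFq α → ℌ (upper α)
  upper∈ℌ {α} α∈ = gen (genP (resc (gen (genT α α∈)) (≃-sym (T≃ α))) (additive-p-element upper Std-Id upper-⊗ α))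

  -- Conjugation of the upper matrix by the involution `N (- 1#)`, available because (-1)^h = -1,
  -- places `lower γ` in 𝔊; its order `p` then places it in ℌ.
  lower∈ℌ : ∀ {γ} → InFq γ → ℌ (lower γ)
  lower∈ℌ {γ} γ∈ = gen (genP (resc (mul n (mul (ℌ⇒𝔊 (upper∈ℌ γ∈)) n)) N⊗T⊗N) (additive-p-element lower Std-Id lower-⊗ γ))
    where
    S = Std 0# 1# 1# 0# (- 1#)
    n : 𝔊 S
    n = resc (gen (genN (- 1#) -1^half)) (≃-sym (N≃ (- 1#)))
    N⊗T⊗N : (S ⊗ (upper γ ⊗ S)) ≃ lower γ
    N⊗T⊗N = ≃-trans (⊗-cong (≃-refl S) (≡⇒≃ (Std-⊗ 1# γ 0# 1# 1# 0# 1# 1# 0# (- 1#)))) (Std-⊗≃ 0# 1# 1# 0# (- 1#) _ _ _ _ _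
      (solve 1 (λ γ → 0ₑ :* (1ₑ :* 0ₑ :+ γ :* 1ₑ) :+ 1ₑ :* (0ₑ :* 0ₑ :+ 1ₑ :* 1ₑ) := 1ₑ) refl γ)
      (solve 1 (λ γ → 0ₑ :* (1ₑ :* 1ₑ :+ γ :* 0ₑ) :+ 1ₑ :* (0ₑ :* 1ₑ :+ 1ₑ :* 0ₑ) := 0ₑ) refl γ)
      (solve 1 (λ γ → 1ₑ :* (1ₑ :* 0ₑ :+ γ :* 1ₑ) :+ 0ₑ :* (0ₑ :* 0ₑ :+ 1ₑ :* 1ₑ) := γ) refl γ)
      (solve 1 (λ γ → 1ₑ :* (1ₑ :* 1ₑ :+ γ :* 0ₑ) :+ 0ₑ :* (0ₑ :* 1ₑ :+ 1ₑ :* 0ₑ) := 1ₑ) refl γ)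
      (solve 0 (:- 1ₑ :* (1ₑ :* :- 1ₑ) := 1ₑ) refl))

  SL₂∈ℌ : ∀ {a b c d} → InFq a → InFq b → InFq c → InFq d → det a b c d ≡ 1# → ℌ (Std a b c d 1#)
  SL₂∈ℌ {a} {b} {c} {d} a∈ b∈ c∈ d∈ det≡1 = case (c ≟ 0#)
    where
    -- With c ≠ 0 an element of SL₂ is a product of three elementary matrices.
    bruhat : ∀ {a b c d} → InFq a → InFq c → InFq d → det a b c d ≡ 1# → c ≢ 0# → ℌ (Std a b c d 1#)
    bruhat {a} {b} {c} {d} a∈ c∈ d∈ det≡1 c≢0 =
      resc (mul (mul (upper∈ℌ x∈) (lower∈ℌ c∈)) (upper∈ℌ y∈))
        (≃-trans (⊗-cong (≡⇒≃ (Std-⊗ 1# x 0# 1# 1# 1# 0# c 1# 1#)) (≃-refl (upper y))) (Std-⊗≃ _ _ _ _ _ 1# y 0# 1# 1#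
          (trans (solve 2 (λ c x → (1ₑ :* 1ₑ :+ x :* c) :* 1ₑ :+ (1ₑ :* 0ₑ :+ x :* 1ₑ) :* 0ₑ := 1ₑ :+ x :* c) refl c x) 1+xc≡a)
          (trans (solve 3 (λ c x y → (1ₑ :* 1ₑ :+ x :* c) :* y :+ (1ₑ :* 0ₑ :+ x :* 1ₑ) :* 1ₑ := (1ₑ :+ x :* c) :* y :+ x) refl c x y)
            (trans (cong (λ t → t * y + x) 1+xc≡a) ay+x≡b))
          (solve 1 (λ c → (0ₑ :* 1ₑ :+ 1ₑ :* c) :* 1ₑ :+ (0ₑ :* 0ₑ :+ 1ₑ :* 1ₑ) :* 0ₑ := c) refl c)
          (trans (solve 2 (λ c y → (0ₑ :* 1ₑ :+ 1ₑ :* c) :* y :+ (0ₑ :* 0ₑ :+ 1ₑ :* 1ₑ) :* 1ₑ := 1ₑ :+ y :* c) refl c y) 1+yc≡d)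
          (solve 0 (1ₑ :* 1ₑ :* 1ₑ := 1ₑ) refl)))
      where
      i = c≢0 ⁻¹
      i∈ : InFq i
      i∈ = Fq-⁻¹ (inverseˡ c≢0) c∈
      -- The product of `upper x`, `lower c` and `upper y` has diagonal 1+xc and 1+cy and lower left
      -- entry `c`. Matching the diagonal determines `x` and `y`; the entry `b` then agrees because
      -- the determinant is 1.
      x = (a + - 1#) * i
      y = (d + - 1#) * i
      x∈ : InFq x
      x∈ = Fq-* (Fq-+ a∈ (Fq-neg Fq-1)) i∈
      y∈ : InFq y
      y∈ = Fq-* (Fq-+ d∈ (Fq-neg Fq-1)) i∈
      1+xc : ∀ z → 1# + (z + - 1#) * i * c ≡ z
      1+xc z = begin
        1# + (z + - 1#) * i * c      ≡⟨ cong (1# +_) (trans (*-assoc _ _ _) (cong ((z + - 1#) *_) (inverseˡ c≢0))) ⟩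
        1# + (z + - 1#) * 1#         ≡⟨ solve 1 (λ z → 1ₑ :+ (z :- 1ₑ) :* 1ₑ := z) refl z ⟩
        z                            ∎
      1+xc≡a = 1+xc a
      1+yc≡d = 1+xc d
      ay+x≡b : a * y + x ≡ b
      ay+x≡b = *-cancelʳ c≢0 (begin
        (a * y + x) * c                        ≡⟨ solve 4 (λ a c x y → (a :* y :+ x) :* c := a :* (1ₑ :+ y :* c) :- a :+ (1ₑ :+ x :* c) :- 1ₑ) refl a c x y ⟩
        a * (1# + y * c) + - a + (1# + x * c) + - 1#  ≡⟨ cong₂ (λ s t → a * s + - a + t + - 1#) 1+yc≡d 1+xc≡a ⟩
        a * d + - a + a + - 1#                 ≡⟨ cong (λ t → a * d + - a + a + - t) (sym det≡1) ⟩
        a * d + - a + a + - det a b c d        ≡⟨ solve 4 (λ a b c d → a :* d :- a :+ a :- (a :* d :- b :* c) := b :* c) refl a b c d ⟩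
        b * c                                  ∎)
    case : Dec (c ≡ 0#) → ℌ (Std a b c d 1#)
    case (no c≢0)  = bruhat a∈ c∈ d∈ det≡1 c≢0
    -- Multiplying on the right by `lower 1#` replaces the zero entry `c` by c+d, which is non-zero
    -- as ad = 1; the factor `lower (- 1#)` undoes this.
    case (yes c≡0) = resc (mul (bruhat (Fq-+ a∈ b∈) (Fq-+ c∈ d∈) d∈
        (trans (solve 4 (λ a b c d → (a :+ b) :* d :- b :* (c :+ d) := a :* d :- b :* c) refl a b c d) det≡1) c+d≢0)
        (lower∈ℌ (Fq-neg Fq-1)))
      (Std-⊗≃ (a + b) b (c + d) d 1# 1# 0# (- 1#) 1# 1#
        (solve 2 (λ a b → (a :+ b) :* 1ₑ :+ b :* :- 1ₑ := a) refl a b) (solve 2 (λ a b → (a :+ b) :* 0ₑ :+ b :* 1ₑ := b) refl a b)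
        (solve 2 (λ a b → (a :+ b) :* 1ₑ :+ b :* :- 1ₑ := a) refl c d) (solve 2 (λ a b → (a :+ b) :* 0ₑ :+ b :* 1ₑ := b) refl c d)
        (*-identityˡ 1#))
      where
      c+d≢0 : c + d ≢ 0#
      c+d≢0 e = 1≢0 (begin
        1#                          ≡⟨ sym det≡1 ⟩
        a * d + - (b * c)           ≡⟨ solve 4 (λ a b c d → a :* d :- b :* c := a :* (c :+ d) :- (a :+ b) :* c) refl a b c d ⟩
        a * (c + d) + - ((a + b) * c) ≡⟨ cong₂ (λ s t → a * s + - ((a + b) * t)) e c≡0 ⟩
        a * 0# + - ((a + b) * 0#)   ≡⟨ solve 2 (λ a b → a :* 0ₑ :- (a :+ b) :* 0ₑ := 0ₑ) refl a b ⟩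
        0#                          ∎)

  -- Character 1 makes `D` a square s² in F_q. Scaling by `u` = 1/s reaches determinant 1 and turns
  -- `κ` into u²κ, whose h-th power is u²D = 1; the matrix is then an element of SL₂(q) times some
  -- `L`.
  rep⇒ℌ : ∀ {A} → Rep 1# A → ℌ A
  rep⇒ℌ {A} RA with euler (Rep.det≢0 RA) (Rep.det∈ RA) (Rep.det^k RA)
  ... | s , s∈ , ss≡D = resc (mul (SL₂∈ℌ (Fq-* u∈ a∈) (Fq-* u∈ b∈) (Fq-* u∈ c∈) (Fq-* u∈ d∈) det≡1) (gen (genL (u * u * κ) κ′^half)))
      (≃-trans (⊗-cong (≃-refl (Std (u * a) (u * b) (u * c) (u * d) 1#)) (≃-sym (L≃ (u * u * κ))))
        (≃-trans (Std-⊗≃ (u * a) (u * b) (u * c) (u * d) 1# 1# 0# 0# 1# (u * u * κ) (id₁ _ _) (id₂ _ _) (id₁ _ _) (id₂ _ _) (*-identityˡ _))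
          (≃-trans (≃-sym (u * u , *-nonzero u≢0 u≢0 , Std-scale u a b c d κ)) std)))
    where
    open Rep RA
    D = det a b c d
    s≢0 = proj₁ (factor-nonzero ss≡D det≢0)
    u = s≢0 ⁻¹
    u≢0 = ⁻¹-nonzero s≢0
    u∈ : InFq u
    u∈ = Fq-⁻¹ (inverseˡ s≢0) s∈
    uuD≡1 : u * u * D ≡ 1#
    uuD≡1 = begin
      u * u * D           ≡⟨ cong (u * u *_) (sym ss≡D) ⟩
      u * u * (s * s)     ≡⟨ solve 2 (λ u s → u :* u :* (s :* s) := (u :* s) :* (u :* s)) refl u s ⟩
      (u * s) * (u * s)   ≡⟨ cong₂ _*_ (inverseˡ s≢0) (inverseˡ s≢0) ⟩
      1# * 1#             ≡⟨ *-identityˡ 1# ⟩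
      1#                  ∎
    det≡1 : det (u * a) (u * b) (u * c) (u * d) ≡ 1#
    det≡1 = trans (solve 5 (λ u a b c d → (u :* a) :* (u :* d) :- (u :* b) :* (u :* c) := u :* u :* (a :* d :- b :* c)) refl u a b c d) uuD≡1
    κ′^half : (u * u * κ) ^ half ≡ 1#
    κ′^half = begin
      (u * u * κ) ^ half             ≡⟨ ^-distrib-* (u * u) κ half ⟩
      ((u * u) ^ half) * (κ ^ half)  ≡⟨ cong₂ _*_ (trans (^-distrib-* u u half) (trans (half²≡norm u) (cong (u *_) u∈))) κ^half ⟩
      u * u * D                      ≡⟨ uuD≡1 ⟩
      1#                             ∎
    id₁ : ∀ x y → x * 1# + y * 0# ≡ x
    id₁ x y = solve 2 (λ x y → x :* 1ₑ :+ y :* 0ₑ := x) refl x y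
    id₂ : ∀ x y → x * 0# + y * 1# ≡ y
    id₂ x y = solve 2 (λ x y → x :* 0ₑ :+ y :* 1ₑ := y) refl x y

  private
    μ = proj₁ nonsquare
    μ≢0 = proj₁ (proj₂ nonsquare)
    μ∈ = proj₁ (proj₂ (proj₂ nonsquare))
    μ^k = proj₂ (proj₂ (proj₂ nonsquare))

  g₀ : Mat
  g₀ = R (μ≢0 ⁻¹) μ

  g₀-rep : Rep (- 1#) g₀
  g₀-rep = rep-R (μ≢0 ⁻¹) μ μ∈ μ^k (inverseˡ μ≢0)

  g₀∈𝔊 : 𝔊 g₀
  g₀∈𝔊 = gen (genR (μ≢0 ⁻¹) μ (μ∈ , nonsq) (inverseˡ μ≢0))
    where
    nonsq : ¬ (∃ λ s → InFq s × s * s ≡ μ)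
    nonsq (s , s∈ , ss≡μ) = -1≢1 (trans (sym μ^k) (trans (cong (_^ k) (sym ss≡μ)) (Fq-square^k (proj₁ (factor-nonzero ss≡μ μ≢0)) s∈)))

  odd-coset : ∀ {A} → Rep (- 1#) A → ∃ λ h → ℌ h × A ≃ (g₀ ⊗ h)
  odd-coset {A} RA = let B , RB , _ , g₀B = rep-inverse g₀-rep in
    B ⊗ A , rep⇒ℌ (subst (λ ε → Rep ε (B ⊗ A)) -1*-1≡1 (rep-⊗ RB RA)) ,
    ≃-trans (≃-sym (≡⇒≃ (⊗-identityˡ A))) (≃-trans (⊗-cong (≃-sym g₀B) (≃-refl A)) (≡⇒≃ (⊗-assoc g₀ B A)))

  rep⇒𝔊 : ∀ {ε A} → Rep ε A → 𝔊 A
  rep⇒𝔊 RA with rep-sign RA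
  ... | inj₁ refl = ℌ⇒𝔊 (rep⇒ℌ RA)
  ... | inj₂ refl = let h , h∈ , A≃g₀h = odd-coset RA in resc (mul g₀∈𝔊 (ℌ⇒𝔊 h∈)) (≃-sym A≃g₀h)

  indexTwo : IndexTwo
  indexTwo = g₀ , g₀∈𝔊 , (λ g₀∈ℌ → rep-exclusive (ℌ⇒rep g₀∈ℌ) g₀-rep) , coset
    where
    coset : ∀ g → 𝔊 g → ℌ g ⊎ ∃ λ h → ℌ h × g ≃ (g₀ ⊗ h)
    coset g g∈ with 𝔊⇒rep g∈
    ... | ε , R with rep-sign R
    ...   | inj₁ refl = inj₁ (rep⇒ℌ R)
    ...   | inj₂ refl = inj₂ (odd-coset R)

-- Projective equality of vectors and images of lines.

module Lines (K : Field) (p q : ℕ) where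
  open Field K
  open FieldAlgebra K
  open Geometry K p q
  open Matrices K p q
  open Solver

  ≡⇒∼ : ∀ {u v : Vec4} → (∀ i → u i ≡ v i) → u ∼ v
  ≡⇒∼ e = 1# , 1≢0 , λ i → trans (sym (e i)) (sym (*-identityˡ _))

  ∼-sym : ∀ {u v : Vec4} → u ∼ v → v ∼ u
  ∼-sym {u} (c , c≢0 , e) = c≢0 ⁻¹ , ⁻¹-nonzero c≢0 , λ i → trans (sym (*-identityˡ (u i)))
    (trans (cong (_* u i) (sym (inverseˡ c≢0))) (trans (*-assoc _ _ _) (cong (c≢0 ⁻¹ *_) (sym (e i)))))

  ∼-trans : ∀ {u v w : Vec4} → u ∼ v → v ∼ w → u ∼ w
  ∼-trans (c , c≢0 , e) (c′ , c′≢0 , e′) = c′ * c , *-nonzero c′≢0 c≢0 ,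
    λ i → trans (e′ i) (trans (cong (c′ *_) (e i)) (sym (*-assoc _ _ _)))

  apply-∼ : ∀ A {u v : Vec4} → u ∼ v → apply A u ∼ apply A v
  apply-∼ A {u} (c , c≢0 , e) = c , c≢0 , λ i → trans (apply-cong A e i) (apply-scale A c u i)

  apply-≃ : ∀ {A B} → A ≃ B → ∀ v → apply A v ∼ apply B v
  apply-≃ {A} (c , c≢0 , e) v = c , c≢0 , λ i → trans (sum4-cong (λ j → trans (cong (_* v j) (e i j)) (*-assoc _ _ _)))
    (sum4-scaleˡ c (λ j → A i j * v j))

  apply-inverse : ∀ A B → (A ⊗ B) ≃ Id → ∀ v → apply A (apply B v) ∼ v
  apply-inverse A B AB v = ∼-trans (≡⇒∼ (λ i → sym (apply-⊗ A B v i))) (∼-trans (apply-≃ AB v) (≡⇒∼ (apply-Id v)))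

  onLine-left : ∀ u v → OnLine (u , v) u
  onLine-left u v = 1# , 0# , λ i → solve 2 (λ u v → u := 1ₑ :* u :+ 0ₑ :* v) refl (u i) (v i)

  onLine-right : ∀ u v → OnLine (u , v) v
  onLine-right u v = 0# , 1# , λ i → solve 2 (λ u v → v := 0ₑ :* u :+ 1ₑ :* v) refl (u i) (v i)

  onLine-trans : ∀ {u v u′ v′ w : Vec4} → OnLine (u , v) u′ → OnLine (u , v) v′ → OnLine (u′ , v′) w → OnLine (u , v) w
  onLine-trans {u} {v} (a , b , e) (a′ , b′ , e′) (c , d , f) = c * a + d * a′ , c * b + d * b′ , λ i →
    trans (f i) (trans (cong₂ (λ s t → c * s + d * t) (e i) (e′ i))
      (solve 8 (λ a b a′ b′ c d u v → c :* (a :* u :+ b :* v) :+ d :* (a′ :* u :+ b′ :* v) :=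
                 (c :* a :+ d :* a′) :* u :+ (c :* b :+ d :* b′) :* v) refl a b a′ b′ c d (u i) (v i)))

  onLine-apply : ∀ A {u v w : Vec4} → OnLine (u , v) w → OnLine (apply A u , apply A v) (apply A w)
  onLine-apply A {u} {v} (a , b , e) = a , b , λ i → trans (apply-cong A e i) (apply-comb A a u b v i)

  onLine-∼ : ∀ {u v w w′ : Vec4} → OnLine (u , v) w → w ∼ w′ → OnLine (u , v) w′
  onLine-∼ {u} {v} (a , b , e) (c , _ , e′) = c * a , c * b , λ i → trans (e′ i) (trans (cong (c *_) (e i))
    (solve 5 (λ a b c u v → c :* (a :* u :+ b :* v) := c :* a :* u :+ c :* b :* v) refl a b c (u i) (v i)))

  sameLine-sym : ∀ {l l′} → SameLine l l′ → SameLine l′ l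
  sameLine-sym (a , b , c , d) = c , d , a , b

  sameLine-trans : ∀ {l l′ l″} → SameLine l l′ → SameLine l′ l″ → SameLine l l″
  sameLine-trans (a , b , c , d) (a′ , b′ , c′ , d′) =
    onLine-trans a b a′ , onLine-trans a b b′ , onLine-trans c′ d′ c , onLine-trans c′ d′ d

  sameLine-∼ : ∀ {u v u′ v′ : Vec4} → u ∼ u′ → v ∼ v′ → SameLine (u , v) (u′ , v′)
  sameLine-∼ {u} {v} {u′} {v′} e e′ = onLine-∼ (onLine-left u v) e , onLine-∼ (onLine-right u v) e′ ,
    onLine-∼ (onLine-left u′ v′) (∼-sym e) , onLine-∼ (onLine-right u′ v′) (∼-sym e′)

  image : Mat → Line → Line
  image A (u , v) = apply A u , apply A v

  sameLine-image : ∀ A {l l′} → SameLine l l′ → SameLine (image A l) (image A l′)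
  sameLine-image A (a , b , c , d) = onLine-apply A a , onLine-apply A b , onLine-apply A c , onLine-apply A d

  image-⊗ : ∀ A B l → SameLine (image (A ⊗ B) l) (image A (image B l))
  image-⊗ A B (u , v) = sameLine-∼ (≡⇒∼ (apply-⊗ A B u)) (≡⇒∼ (apply-⊗ A B v))

  image-inverse : ∀ A B → (A ⊗ B) ≃ Id → ∀ l → SameLine (image A (image B l)) l
  image-inverse A B AB (u , v) = sameLine-∼ (apply-inverse A B AB u) (apply-inverse A B AB v)

-- The Hermitian form, isotropic lines and similitudes.

module Hermitian (K : Field) (p q k : ℕ) (E : QuadraticExtension K p q k) where
  open Field K
  open FieldAlgebra K
  open Geometry K p q
  open Matrices K p q
  open Lines K p q
  open QuadraticExtension E
  open Conjugation K p q k E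
  open Group K p q k E
  open Solver
  open ≡-Reasoning

  -- Conjugation is left out here and applied in `herm`, so that the solver can treat a vector and
  -- its conjugate as independent variables.
  bil : Vec4 → Vec4 → Carrier
  bil u w = u X1 * w X1 + 2# * (u X2 * w X2) + - (u X3 * w X0 + u X0 * w X3)

  herm : Vec4 → Vec4 → Carrier
  herm u v = bil u (conj ∘ v)

  bilₑ : ∀ {n} (u w : Fin 4 → Expr ℤ n) → Expr ℤ n
  bilₑ u w = u 1F :* w 1F :+ 2ₑ :* (u 2F :* w 2F) :- (u 3F :* w 0F :+ u 0F :* w 3F)

  herm-cong : ∀ {u u′ v v′ : Vec4} → (∀ i → u i ≡ u′ i) → (∀ i → v i ≡ v′ i) → herm u v ≡ herm u′ v′
  herm-cong {u} {u′} {v} {v′} e f = cong₂ (λ x y → x + - y)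
    (cong₂ (λ x y → x + 2# * y) (cong₂ _*_ (e 1F) (cong conj (f 1F))) (cong₂ _*_ (e 2F) (cong conj (f 2F))))
    (cong₂ _+_ (cong₂ _*_ (e 3F) (cong conj (f 0F))) (cong₂ _*_ (e 0F) (cong conj (f 3F))))

  herm-combˡ : ∀ a u b v w → herm (comb a u b v) w ≡ a * herm u w + b * herm v w
  herm-combˡ a u b v w = solve 14 (λ a b u0 u1 u2 u3 v0 v1 v2 v3 w0 w1 w2 w3 →
      bilₑ (vecₑ (a :* u0 :+ b :* v0) (a :* u1 :+ b :* v1) (a :* u2 :+ b :* v2) (a :* u3 :+ b :* v3)) (vecₑ w0 w1 w2 w3) :=
      a :* bilₑ (vecₑ u0 u1 u2 u3) (vecₑ w0 w1 w2 w3) :+ b :* bilₑ (vecₑ v0 v1 v2 v3) (vecₑ w0 w1 w2 w3))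
    refl a b (u 0F) (u 1F) (u 2F) (u 3F) (v 0F) (v 1F) (v 2F) (v 3F) (conj (w 0F)) (conj (w 1F)) (conj (w 2F)) (conj (w 3F))

  conj-2 : conj 2# ≡ 2#
  conj-2 = Fq-2

  herm-sym : ∀ u v → herm v u ≡ conj (herm u v)
  herm-sym u v = sym (begin
    conj (u 1F * v̄ 1F + 2# * (u 2F * v̄ 2F) + - (u 3F * v̄ 0F + u 0F * v̄ 3F))
      ≡⟨ trans (conj-+ _ _) (cong₂ _+_ (trans (conj-+ _ _) (cong₂ _+_ (term 1F 1F) (trans (conj-* _ _) (cong₂ _*_ conj-2 (term 2F 2F)))))
                                       (trans (conj-neg _) (cong -_ (trans (conj-+ _ _) (cong₂ _+_ (term 3F 0F) (term 0F 3F)))))) ⟩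
    ū 1F * v 1F + 2# * (ū 2F * v 2F) + - (ū 3F * v 0F + ū 0F * v 3F)
      ≡⟨ solve 8 (λ u0 u1 u2 u3 v0 v1 v2 v3 → bilₑ (vecₑ u0 u1 u2 u3) (vecₑ v0 v1 v2 v3) := bilₑ (vecₑ v0 v1 v2 v3) (vecₑ u0 u1 u2 u3))
           refl (ū 0F) (ū 1F) (ū 2F) (ū 3F) (v 0F) (v 1F) (v 2F) (v 3F) ⟩
    herm v u ∎)
    where
    ū = conj ∘ u
    v̄ = conj ∘ v
    term : ∀ i j → conj (u i * conj (v j)) ≡ conj (u i) * v j
    term i j = trans (conj-* _ _) (cong (conj (u i) *_) (conj-conj (v j)))

  herm-combʳ : ∀ a u b v w → herm w (comb a u b v) ≡ conj a * herm w u + conj b * herm w v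
  herm-combʳ a u b v w = begin
    herm w (comb a u b v)                             ≡⟨ herm-sym (comb a u b v) w ⟩
    conj (herm (comb a u b v) w)                      ≡⟨ cong conj (herm-combˡ a u b v w) ⟩
    conj (a * herm u w + b * herm v w)                ≡⟨ trans (conj-+ _ _) (cong₂ _+_ (conj-* _ _) (conj-* _ _)) ⟩
    conj a * conj (herm u w) + conj b * conj (herm v w) ≡⟨ sym (cong₂ (λ s t → conj a * s + conj b * t) (herm-sym u w) (herm-sym v w)) ⟩
    conj a * herm w u + conj b * herm w v             ∎

  onU3⇒isotropic : ∀ {v} → OnU3 v → herm v v ≡ 0#
  onU3⇒isotropic {v} e = trans (cong₂ (λ s t → s + 2# * t + - (v X3 * conj (v X0) + v X0 * conj (v X3))) (sym (norm≡ (v X1))) (sym (norm≡ (v X2))))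
    (x≡y⇒x-y≡0 (trans e (solve 4 (λ a b c d → d :* a :+ c :* b := c :* b :+ a :* d) refl (v X0) (conj (v X0)) (v X3) (conj (v X3)))))

  isotropic⇒onU3 : ∀ {v} → herm v v ≡ 0# → OnU3 v
  isotropic⇒onU3 {v} e = trans (cong₂ (λ s t → s + 2# * t) (norm≡ (v X1)) (norm≡ (v X2)))
    (trans (x-y≡0⇒x≡y e) (solve 4 (λ a b c d → c :* b :+ a :* d := d :* a :+ c :* b) refl (v X0) (conj (v X0)) (v X3) (conj (v X3))))

  Isotropic : Line → Set
  Isotropic (u , v) = herm u u ≡ 0# × herm v v ≡ 0# × herm u v ≡ 0#

  -- herm u v is skew (b = 1), and multiplying v by some b ∉ F_q then forces it to vanish.
  generator⇒isotropic : ∀ {l} → IsGenerator l → Isotropic l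
  generator⇒isotropic {u , v} (_ , onU3) = uu , vv , H≡0
    where
    at : ∀ a b → a * (conj a * herm u u + conj b * herm u v) + b * (conj a * herm v u + conj b * herm v v) ≡ 0#
    at a b = trans (sym (cong₂ (λ s t → a * s + b * t) (herm-combʳ a u b v u) (herm-combʳ a u b v v)))
      (trans (sym (herm-combˡ a u b v (comb a u b v))) (onU3⇒isotropic {comb a u b v} (onU3 a b)))
    uu : herm u u ≡ 0#
    uu = trans (sym (trans (cong₂ (λ s t → 1# * (s * herm u u + t * herm u v) + 0# * (s * herm v u + t * herm v v)) conj-1 conj-0)
      (solve 4 (λ a b c d → 1ₑ :* (1ₑ :* a :+ 0ₑ :* b) :+ 0ₑ :* (1ₑ :* c :+ 0ₑ :* d) := a) refl (herm u u) (herm u v) (herm v u) (herm v v)))) (at 1# 0#)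
    vv : herm v v ≡ 0#
    vv = trans (sym (trans (cong₂ (λ s t → 0# * (s * herm u u + t * herm u v) + 1# * (s * herm v u + t * herm v v)) conj-0 conj-1)
      (solve 4 (λ a b c d → 0ₑ :* (0ₑ :* a :+ 1ₑ :* b) :+ 1ₑ :* (0ₑ :* c :+ 1ₑ :* d) := d) refl (herm u u) (herm u v) (herm v u) (herm v v)))) (at 0# 1#)
    H = herm u v
    mixed : ∀ b → conj b * H + b * herm v u ≡ 0#
    mixed b = trans (sym (trans (cong (λ s → 1# * (s * herm u u + conj b * H) + b * (s * herm v u + conj b * herm v v)) conj-1)
      (trans (cong₂ (λ s t → 1# * (1# * s + conj b * H) + b * (1# * herm v u + conj b * t)) uu vv)
        (solve 4 (λ b b̄ H G → 1ₑ :* (1ₑ :* 0ₑ :+ b̄ :* H) :+ b :* (1ₑ :* G :+ b̄ :* 0ₑ) := b̄ :* H :+ b :* G) refl b (conj b) H (herm v u))))) (at 1# b)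
    skew : H + herm v u ≡ 0#
    skew = trans (sym (trans (cong (λ s → s * H + 1# * herm v u) conj-1) (cong₂ _+_ (*-identityˡ H) (*-identityˡ _)))) (mixed 1#)
    b = proj₁ notInFq
    H≡0 : H ≡ 0#
    H≡0 = xy≡0⇒y≡0 (λ e → proj₂ notInFq (x-y≡0⇒x≡y e)) (begin
      (conj b + - b) * H                                ≡⟨ solve 4 (λ b b̄ H G → (b̄ :- b) :* H := (b̄ :* H :+ b :* G) :- b :* (H :+ G)) refl b (conj b) H (herm v u) ⟩
      (conj b * H + b * herm v u) + - (b * (H + herm v u))  ≡⟨ cong₂ (λ s t → s + - (b * t)) (mixed b) skew ⟩
      0# + - (b * 0#)                                   ≡⟨ solve 1 (λ b → 0ₑ :- b :* 0ₑ := 0ₑ) refl b ⟩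
      0#                                                ∎)

  isotropic-on : ∀ {l w w′} → Isotropic l → OnLine l w → OnLine l w′ → herm w w′ ≡ 0#
  isotropic-on {u , v} {w} {w′} (uu , vv , uv) (a , b , e) (c , d , f) = begin
    herm w w′                                   ≡⟨ herm-cong e f ⟩
    herm (comb a u b v) (comb c u d v)          ≡⟨ herm-combˡ a u b v (comb c u d v) ⟩
    a * herm u (comb c u d v) + b * herm v (comb c u d v)
      ≡⟨ cong₂ (λ s t → a * s + b * t) (herm-combʳ c u d v u) (herm-combʳ c u d v v) ⟩
    a * (conj c * herm u u + conj d * herm u v) + b * (conj c * herm v u + conj d * herm v v)
      ≡⟨ cong₂ (λ s t → a * s + b * t) (cong₂ (λ s t → conj c * s + conj d * t) uu uv) (cong₂ (λ s t → conj c * s + conj d * t) vu vv) ⟩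
    a * (conj c * 0# + conj d * 0#) + b * (conj c * 0# + conj d * 0#)
      ≡⟨ solve 4 (λ a b c d → a :* (c :* 0ₑ :+ d :* 0ₑ) :+ b :* (c :* 0ₑ :+ d :* 0ₑ) := 0ₑ) refl a b (conj c) (conj d) ⟩
    0# ∎
    where
    vu : herm v u ≡ 0#
    vu = trans (herm-sym u v) (trans (cong conj uv) conj-0)

  isotropic⇒generator : ∀ {l} → Independent l → Isotropic l → IsGenerator l
  isotropic⇒generator {u , v} ind iso = ind , λ a b →
    isotropic⇒onU3 {comb a u b v} (isotropic-on {u , v} iso (a , b , λ _ → refl) (a , b , λ _ → refl))

  conj-Std : ∀ {a b c d} κ → InFq a → InFq b → InFq c → InFq d → ∀ i j → conj (Std a b c d κ i j) ≡ Std a b c d (conj κ) i j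
  conj-Std κ a∈ b∈ c∈ d∈ = entry
    where
    entry : ∀ i j → conj (Std _ _ _ _ κ i j) ≡ Std _ _ _ _ (conj κ) i j
    entry 0F 0F = Fq-* d∈ d∈
    entry 0F 1F = conj-0
    entry 0F 2F = Fq-* Fq-2 (Fq-* c∈ d∈)
    entry 0F 3F = Fq-* c∈ c∈
    entry 1F 0F = conj-0
    entry 1F 1F = refl
    entry 1F 2F = conj-0
    entry 1F 3F = conj-0
    entry 2F 0F = Fq-* b∈ d∈
    entry 2F 1F = conj-0
    entry 2F 2F = Fq-+ (Fq-* a∈ d∈) (Fq-* b∈ c∈)
    entry 2F 3F = Fq-* a∈ c∈
    entry 3F 0F = Fq-* b∈ b∈
    entry 3F 1F = conj-0
    entry 3F 2F = Fq-* Fq-2 (Fq-* a∈ b∈)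
    entry 3F 3F = Fq-* a∈ a∈

  conj-sum4 : ∀ (f : Vec4) → conj (sum4 f) ≡ sum4 (conj ∘ f)
  conj-sum4 f = trans (conj-+ _ _) (cong (_+ conj (f 3F)) (trans (conj-+ _ _) (cong (_+ conj (f 2F)) (conj-+ _ _))))

  bil-congʳ : ∀ u {w w′ : Vec4} → (∀ i → w i ≡ w′ i) → bil u w ≡ bil u w′
  bil-congʳ u f = cong₂ (λ x y → x + - y)
    (cong₂ (λ x y → x + 2# * y) (cong (u 1F *_) (f 1F)) (cong (u 2F *_) (f 2F)))
    (cong₂ _+_ (cong (u 3F *_) (f 0F)) (cong (u 0F *_) (f 3F)))

  -- The symmetric square multiplies the part of the form in X₀, X₂, X₃ by D², while the X₁ term is
  -- multiplied by κκ′. The two sides differ by (κκ′ - D²) times the X₁ term.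
  bil-Std : ∀ a b c d κ κ′ u w → κ * κ′ ≡ det a b c d * det a b c d →
    bil (apply (Std a b c d κ) u) (apply (Std a b c d κ′) w) ≡ det a b c d * det a b c d * bil u w
  bil-Std a b c d κ κ′ u w e = x-y≡0⇒x≡y (begin
    bil (apply (Std a b c d κ) u) (apply (Std a b c d κ′) w) + - (D * D * bil u w)
      ≡⟨ solve 14 (λ a b c d κ κ′ u0 u1 u2 u3 w0 w1 w2 w3 →
           let D = a :* d :- b :* c ; u = vecₑ u0 u1 u2 u3 ; w = vecₑ w0 w1 w2 w3 in
           bilₑ (applyₑ (Stdₑ a b c d κ) u) (applyₑ (Stdₑ a b c d κ′) w) :- D :* D :* bilₑ u w := (κ :* κ′ :- D :* D) :* (u1 :* w1))
         refl a b c d κ κ′ (u 0F) (u 1F) (u 2F) (u 3F) (w 0F) (w 1F) (w 2F) (w 3F) ⟩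
    (κ * κ′ + - (D * D)) * (u 1F * w 1F)   ≡⟨ cong (_* (u 1F * w 1F)) (x≡y⇒x-y≡0 e) ⟩
    0# * (u 1F * w 1F)                     ≡⟨ zeroˡ _ ⟩
    0#                                     ∎)
    where D = det a b c d

  -- Conjugation fixes all entries of `Std` except `κ`, and κ·κ^q = (κ^h)² = D², which is the
  -- condition in `bil-Std`. So every represented matrix is a similitude.
  rep-herm : ∀ {ε A} → Rep ε A → ∃ λ τ → ∀ u v → herm (apply A u) (apply A v) ≡ τ * herm u v
  rep-herm {A = A} RA with Rep.std RA
  ... | t , _ , e = t * conj t * (D * D) , λ u v → begin
    herm (apply A u) (apply A v)
      ≡⟨ herm-cong (scaled u) (scaled v) ⟩
    herm (λ i → t * apply S u i) (λ i → t * apply S v i)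
      ≡⟨ bil-congʳ (λ i → t * apply S u i) (λ i → trans (conj-* t _) (cong (conj t *_) (conj-apply v i))) ⟩
    bil (λ i → t * apply S u i) (λ i → conj t * apply S̄ (conj ∘ v) i)
      ≡⟨ pull t (conj t) (apply S u) (apply S̄ (conj ∘ v)) ⟩
    t * conj t * bil (apply S u) (apply S̄ (conj ∘ v))
      ≡⟨ cong (t * conj t *_) (bil-Std a b c d κ (conj κ) u (conj ∘ v) κκ̄≡DD) ⟩
    t * conj t * (D * D * herm u v)
      ≡⟨ sym (*-assoc _ _ _) ⟩
    t * conj t * (D * D) * herm u v ∎
    where
    open Rep RA
    D = det a b c d
    S = Std a b c d κ
    S̄ = Std a b c d (conj κ)
    κκ̄≡DD : κ * conj κ ≡ D * D
    κκ̄≡DD = trans (sym (half²≡norm κ)) (cong₂ _*_ κ^half κ^half)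
    scaled : ∀ u i → apply A u i ≡ t * apply S u i
    scaled u i = trans (sum4-cong (λ j → trans (cong (_* u j) (e i j)) (*-assoc _ _ _))) (sum4-scaleˡ t (λ j → S i j * u j))
    conj-apply : ∀ v i → conj (apply S v i) ≡ apply S̄ (conj ∘ v) i
    conj-apply v i = trans (conj-sum4 (λ j → S i j * v j))
      (sum4-cong (λ j → trans (conj-* _ _) (cong (_* conj (v j)) (conj-Std κ a∈ b∈ c∈ d∈ i j))))
    pull : ∀ s t (u w : Vec4) → bil (λ i → s * u i) (λ i → t * w i) ≡ s * t * bil u w
    pull s t u w = solve 10 (λ s t u0 u1 u2 u3 w0 w1 w2 w3 →
        bilₑ (vecₑ (s :* u0) (s :* u1) (s :* u2) (s :* u3)) (vecₑ (t :* w0) (t :* w1) (t :* w2) (t :* w3)) :=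
        s :* t :* bilₑ (vecₑ u0 u1 u2 u3) (vecₑ w0 w1 w2 w3))
      refl s t (u 0F) (u 1F) (u 2F) (u 3F) (w 0F) (w 1F) (w 2F) (w 3F)

  image-generator : ∀ A B τ → (B ⊗ A) ≃ Id → (∀ u v → herm (apply A u) (apply A v) ≡ τ * herm u v) →
                    ∀ {l} → IsGenerator l → IsGenerator (image A l)
  image-generator A B τ BA hermA {l@(u , v)} gl@(ind , _) = isotropic⇒generator {image A l} ind′ (iso u u uu , iso v v vv , iso u v uv)
    where
    uu = proj₁ (generator⇒isotropic {l} gl)
    vv = proj₁ (proj₂ (generator⇒isotropic {l} gl))
    uv = proj₂ (proj₂ (generator⇒isotropic {l} gl))
    iso : ∀ u v → herm u v ≡ 0# → herm (apply A u) (apply A v) ≡ 0#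
    iso u v e = trans (hermA u v) (trans (cong (τ *_) e) (zeroʳ τ))
    apply-0 : ∀ i → apply B (λ _ → 0#) i ≡ 0#
    apply-0 i = trans (sum4-scaleʳ 0# (B i)) (zeroʳ _)
    ind′ : Independent (image A l)
    ind′ a b e = ind a b λ i → let c , _ , f = apply-inverse B A BA (comb a u b v) in
      trans (f i) (trans (cong (c *_) (trans (apply-cong B (λ j → trans (apply-comb A a u b v j) (e j)) i) (apply-0 i))) (zeroʳ c))

  rep-generator : ∀ {ε A} → Rep ε A → ∀ {l} → IsGenerator l → IsGenerator (image A l)
  rep-generator {A = A} RA {l} = let B , _ , BA , _ = rep-inverse RA ; τ , hermA = rep-herm RA in image-generator A B τ BA hermA {l}

-- Frames, the generators through a framed point, and the transitivity statements there.

module Frames (K : Field) (p q k : ℕ) (E : QuadraticExtension K p q k) where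
  open Field K
  open FieldAlgebra K
  open Geometry K p q
  open Matrices K p q
  open Lines K p q
  open QuadraticExtension E
  open Conjugation K p q k E
  open Group K p q k E
  open Hermitian K p q k E
  open Solver
  open ≡-Reasoning

  -- The character is kept as an index: orbits of lines under 𝔊 and under ℌ are then handled
  -- together, with signs multiplying under composition.
  RepOrbit : Carrier → Line → Line → Set
  RepOrbit ε l l′ = ∃ λ A → Rep ε A × SameLine (image A l) l′

  repOrbit-sym : ∀ {ε l l′} → RepOrbit ε l l′ → RepOrbit ε l′ l
  repOrbit-sym {l = l} (A , RA , same) = let B , RB , BA , _ = rep-inverse RA in
    B , RB , sameLine-trans (sameLine-image B (sameLine-sym same)) (image-inverse B A BA l)

  repOrbit-trans : ∀ {ε ε′ l l′ l″} → RepOrbit ε l l′ → RepOrbit ε′ l′ l″ → RepOrbit (ε′ * ε) l l″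
  repOrbit-trans {l = l} (A , RA , same) (B , RB , same′) = B ⊗ A , rep-⊗ RB RA ,
    sameLine-trans (image-⊗ B A l) (sameLine-trans (sameLine-image B same) same′)

  -- A basis P, V, W of the tangent plane of U₃ at P, orthogonal for the Hermitian form: the generators
  -- through P join P to V + βW with β^(q+1) = ν, and the stabiliser of P multiplies β by the
  -- (q+1)-th roots of unity ζ, lying in ℌ when ζ^((q+1)/2) = 1.
  record Frame (P : Vec4) : Set where
    field
      V W   : Vec4
      ν η   : Carrier
      ν∈    : InFq ν
      ν≢0   : ν ≢ 0#
      η≢0   : η ≢ 0#
      PP    : herm P P ≡ 0#
      PV    : herm P V ≡ 0#
      PW    : herm P W ≡ 0#
      VW    : herm V W ≡ 0#
      VV    : herm V V ≡ - (ν * η)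
      WW    : herm W W ≡ η
      span  : ∀ v → herm v P ≡ 0# → ∃ λ α → ∃₂ λ γ δ → ∀ i → v i ≡ α * P i + γ * V i + δ * W i
      indep : ∀ α γ δ → (∀ i → α * P i + γ * V i + δ * W i ≡ 0#) → α ≡ 0# × γ ≡ 0# × δ ≡ 0#
      act   : ∀ ζ → ζ * conj ζ ≡ 1# → ∃ λ A → Rep (ζ ^ half) A × apply A P ∼ P ×
              ∃ λ s → s ≢ 0# × (∀ i → apply A V i ≡ s * V i) × (∀ i → apply A W i ≡ s * (ζ * W i))

    line : Carrier → Line
    line β = P , comb 1# V β W

    field
      unswapped : ∀ {A β} → Rep 1# A → β ≢ 0# → Isotropic (line (- β)) → ¬ SameLine (image A (line β)) (line (- β))

  PartDAt : Vec4 → Set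
  PartDAt P = (∀ l l′ → InGo P l → InGo P l′ → LineOrbit 𝔊 l l′)
            × (∃₂ λ l₁ l₂ → InGo P l₁ × InGo P l₂ × ¬ LineOrbit ℌ l₁ l₂ ×
                 (∀ l → InGo P l → LineOrbit ℌ l₁ l ⊎ LineOrbit ℌ l₂ l))

  module AtFrame {P : Vec4} (F : Frame P) where
    open Frame F

    WV : herm W V ≡ 0#
    WV = trans (herm-sym V W) (trans (cong conj VW) conj-0)

    herm-VW : ∀ γ δ → herm (comb γ V δ W) (comb γ V δ W) ≡ (δ * conj δ + - (ν * (γ * conj γ))) * η
    herm-VW γ δ = begin
      herm (comb γ V δ W) (comb γ V δ W)
        ≡⟨ herm-combˡ γ V δ W (comb γ V δ W) ⟩
      γ * herm V (comb γ V δ W) + δ * herm W (comb γ V δ W)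
        ≡⟨ cong₂ (λ s t → γ * s + δ * t) (herm-combʳ γ V δ W V) (herm-combʳ γ V δ W W) ⟩
      γ * (conj γ * herm V V + conj δ * herm V W) + δ * (conj γ * herm W V + conj δ * herm W W)
        ≡⟨ cong₂ (λ s t → γ * s + δ * t) (cong₂ (λ s t → conj γ * s + conj δ * t) VV VW) (cong₂ (λ s t → conj γ * s + conj δ * t) WV WW) ⟩
      γ * (conj γ * - (ν * η) + conj δ * 0#) + δ * (conj γ * 0# + conj δ * η)
        ≡⟨ solve 6 (λ γ γ̄ δ δ̄ ν η → γ :* (γ̄ :* :- (ν :* η) :+ δ̄ :* 0ₑ) :+ δ :* (γ̄ :* 0ₑ :+ δ̄ :* η) :=
                     (δ :* δ̄ :- ν :* (γ :* γ̄)) :* η) refl γ (conj γ) δ (conj δ) ν η ⟩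
      (δ * conj δ + - (ν * (γ * conj γ))) * η ∎

    line-isotropic : ∀ {β} → β * conj β ≡ ν → Isotropic (line β)
    line-isotropic {β} ββ̄≡ν = PP , TT , PT
      where
      TT : herm (comb 1# V β W) (comb 1# V β W) ≡ 0#
      TT = begin
        herm (comb 1# V β W) (comb 1# V β W)          ≡⟨ herm-VW 1# β ⟩
        (β * conj β + - (ν * (1# * conj 1#))) * η     ≡⟨ cong₂ (λ s t → (s + - (ν * (1# * t))) * η) ββ̄≡ν conj-1 ⟩
        (ν + - (ν * (1# * 1#))) * η                   ≡⟨ solve 2 (λ ν η → (ν :- ν :* (1ₑ :* 1ₑ)) :* η := 0ₑ) refl ν η ⟩
        0#                                            ∎
      PT : herm P (comb 1# V β W) ≡ 0#
      PT = trans (herm-combʳ 1# V β W P) (trans (cong₂ (λ s t → conj 1# * s + conj β * t) PV PW)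
        (solve 2 (λ a b → a :* 0ₑ :+ b :* 0ₑ := 0ₑ) refl (conj 1#) (conj β)))

    line-generator : ∀ {β} → β * conj β ≡ ν → IsGenerator (line β)
    line-generator {β} ββ̄≡ν = isotropic⇒generator {line β} independent (line-isotropic ββ̄≡ν)
      where
      independent : Independent (line β)
      independent a b e with indep a (b * 1#) (b * β) (λ i → trans
        (solve 6 (λ a b β P V W → a :* P :+ b :* 1ₑ :* V :+ b :* β :* W := a :* P :+ b :* (1ₑ :* V :+ β :* W)) refl a b β (P i) (V i) (W i)) (e i))
      ... | a≡0 , b1≡0 , _ = a≡0 , trans (sym (*-identityʳ b)) b1≡0

    P-nonzero : NonZeroVec P
    P-nonzero P≡0 = 1≢0 (proj₁ (indep 1# 0# 0# (λ i → trans (cong (λ z → 1# * z + 0# * V i + 0# * W i) (P≡0 i))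
      (solve 2 (λ V W → 1ₑ :* 0ₑ :+ 0ₑ :* V :+ 0ₑ :* W := 0ₑ) refl (V i) (W i)))))

    -- Because `a` is non-zero, `P` and `v` span the line, and γV + δW lies on it. Isotropy gives
    -- δδ^q = νγγ^q. If `γ` were 0 then so would be `δ`, and `v` would be a multiple of `P`, against
    -- the independence of `u` and `v`. Hence `β` = δ/γ exists and has norm `ν`.
    module Joined (u v : Vec4) (a b : Carrier) (ind : Independent (u , v)) (iso : Isotropic (u , v))
                  (P≡ : ∀ i → P i ≡ a * u i + b * v i) (a≢0 : a ≢ 0#)
                  (α γ δ : Carrier) (v≡ : ∀ i → v i ≡ α * P i + γ * V i + δ * W i) where

      P∈ : OnLine (u , v) P
      P∈ = a , b , P≡

      u∈ : OnLine (P , v) u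
      u∈ = a≢0 ⁻¹ , - (a≢0 ⁻¹ * b) , λ i → begin
        u i                                                       ≡⟨ sym (*-identityˡ (u i)) ⟩
        1# * u i                                                  ≡⟨ cong (_* u i) (sym (inverseˡ a≢0)) ⟩
        a≢0 ⁻¹ * a * u i                                          ≡⟨ solve 5 (λ a a′ b u v → a′ :* a :* u := a′ :* (a :* u :+ b :* v) :+ (:- (a′ :* b)) :* v) refl a (a≢0 ⁻¹) b (u i) (v i) ⟩
        a≢0 ⁻¹ * (a * u i + b * v i) + - (a≢0 ⁻¹ * b) * v i       ≡⟨ cong (λ z → a≢0 ⁻¹ * z + - (a≢0 ⁻¹ * b) * v i) (sym (P≡ i)) ⟩
        a≢0 ⁻¹ * P i + - (a≢0 ⁻¹ * b) * v i                       ∎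

      VW∈ : OnLine (P , v) (comb γ V δ W)
      VW∈ = - α , 1# , λ i → trans (solve 6 (λ α γ δ P V W → γ :* V :+ δ :* W := (:- α) :* P :+ 1ₑ :* (α :* P :+ γ :* V :+ δ :* W)) refl α γ δ (P i) (V i) (W i))
        (cong (λ z → - α * P i + 1# * z) (sym (v≡ i)))

      norms : δ * conj δ + - (ν * (γ * conj γ)) ≡ 0#
      norms = *-cancelʳ η≢0 (trans (sym (herm-VW γ δ)) (trans
        (isotropic-on {P , v} {comb γ V δ W} {comb γ V δ W} (PP , proj₁ (proj₂ iso) , isotropic-on {u , v} {P} {v} iso P∈ (onLine-right u v)) VW∈ VW∈)
        (sym (zeroˡ η))))

      γ≢0 : γ ≢ 0#
      γ≢0 γ≡0 = 1≢0 (begin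
        1#                      ≡⟨ solve 1 (λ b → 1ₑ := :- (0ₑ :* b :- 1ₑ)) refl b ⟩
        - (0# * b + - 1#)       ≡⟨ cong (λ z → - (z * b + - 1#)) (sym α≡0) ⟩
        - (α * b + - 1#)        ≡⟨ cong -_ (proj₂ dependence) ⟩
        - 0#                    ≡⟨ solve 0 (:- 0ₑ := 0ₑ) refl ⟩
        0#                      ∎)
        where
        δδ̄≡0 : δ * conj δ ≡ 0#
        δδ̄≡0 = trans (solve 4 (λ δ δ̄ ν γ̄ → δ :* δ̄ := (δ :* δ̄ :- ν :* (0ₑ :* γ̄))) refl δ (conj δ) ν (conj γ))
          (trans (cong (λ z → δ * conj δ + - (ν * (z * conj γ))) (sym γ≡0)) norms)
        δ≡0 : δ ≡ 0#
        δ≡0 = norm≡0 δδ̄≡0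
        dependence : α * a ≡ 0# × α * b + - 1# ≡ 0#
        dependence = ind (α * a) (α * b + - 1#) (λ i → begin
          α * a * u i + (α * b + - 1#) * v i          ≡⟨ solve 5 (λ α a b u v → α :* a :* u :+ (α :* b :- 1ₑ) :* v := α :* (a :* u :+ b :* v) :- v) refl α a b (u i) (v i) ⟩
          α * (a * u i + b * v i) + - v i             ≡⟨ cong₂ (λ s t → α * s + - t) (sym (P≡ i)) (v≡ i) ⟩
          α * P i + - (α * P i + γ * V i + δ * W i)   ≡⟨ cong₂ (λ s t → α * P i + - (α * P i + s * V i + t * W i)) γ≡0 δ≡0 ⟩
          α * P i + - (α * P i + 0# * V i + 0# * W i) ≡⟨ solve 3 (λ αP V W → αP :- (αP :+ 0ₑ :* V :+ 0ₑ :* W) := 0ₑ) refl (α * P i) (V i) (W i) ⟩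
          0#                                          ∎)
        α≡0 : α ≡ 0#
        α≡0 = xy≡0⇒y≡0 a≢0 (trans (*-comm a α) (proj₁ dependence))

      γ⁻¹ β : Carrier
      γ⁻¹ = γ≢0 ⁻¹
      β = δ * γ⁻¹

      γβ≡δ : γ * β ≡ δ
      γβ≡δ = trans (solve 3 (λ γ δ g → γ :* (δ :* g) := δ :* (g :* γ)) refl γ δ γ⁻¹) (trans (cong (δ *_) (inverseˡ γ≢0)) (*-identityʳ δ))

      ββ̄≡ν : β * conj β ≡ ν
      ββ̄≡ν = *-cancelʳ (*-nonzero γ≢0 (conj-nonzero γ≢0)) (begin
        β * conj β * (γ * conj γ)         ≡⟨ solve 4 (λ β β̄ γ γ̄ → β :* β̄ :* (γ :* γ̄) := (γ :* β) :* (γ̄ :* β̄)) refl β (conj β) γ (conj γ) ⟩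
        (γ * β) * (conj γ * conj β)       ≡⟨ cong ((γ * β) *_) (sym (conj-* γ β)) ⟩
        (γ * β) * conj (γ * β)            ≡⟨ cong (λ z → z * conj z) γβ≡δ ⟩
        δ * conj δ                        ≡⟨ x-y≡0⇒x≡y norms ⟩
        ν * (γ * conj γ)                  ∎)

      split : ∀ i → v i ≡ α * P i + γ * comb 1# V β W i
      split i = trans (v≡ i) (trans (cong (λ z → α * P i + γ * V i + z * W i) (sym γβ≡δ))
        (solve 5 (λ αP γ V β W → αP :+ γ :* V :+ γ :* β :* W := αP :+ γ :* (1ₑ :* V :+ β :* W)) refl (α * P i) γ (V i) β (W i)))

      line∈ : OnLine (P , v) (comb 1# V β W)
      line∈ = - (γ⁻¹ * α) , γ⁻¹ , λ i → begin
        comb 1# V β W i                                   ≡⟨ sym (*-identityˡ _) ⟩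
        1# * comb 1# V β W i                              ≡⟨ cong (_* comb 1# V β W i) (sym (inverseˡ γ≢0)) ⟩
        γ⁻¹ * γ * comb 1# V β W i                         ≡⟨ solve 5 (λ g γ α P T → g :* γ :* T := (:- (g :* α)) :* P :+ g :* (α :* P :+ γ :* T)) refl γ⁻¹ γ α (P i) (comb 1# V β W i) ⟩
        - (γ⁻¹ * α) * P i + γ⁻¹ * (α * P i + γ * comb 1# V β W i) ≡⟨ cong (λ z → - (γ⁻¹ * α) * P i + γ⁻¹ * z) (sym (split i)) ⟩
        - (γ⁻¹ * α) * P i + γ⁻¹ * v i                     ∎

      sameLine : SameLine (line β) (u , v)
      sameLine = sameLine-trans {line β} {P , v} {u , v}
        (onLine-left P (comb 1# V β W) , (α , γ , split) , onLine-left P v , line∈)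
        (u∈ , onLine-right P v , P∈ , onLine-right u v)

    joined : ∀ u v a b → Independent (u , v) → Isotropic (u , v) → (∀ i → P i ≡ a * u i + b * v i) → a ≢ 0# →
             ∃ λ β → β * conj β ≡ ν × SameLine (line β) (u , v)
    joined u v a b ind iso P≡ a≢0 =
      let α , γ , δ , v≡ = span v (isotropic-on {u , v} {v} {P} iso (onLine-right u v) (a , b , P≡))
          module J = Joined u v a b ind iso P≡ a≢0 α γ δ v≡
      in J.β , J.ββ̄≡ν , J.sameLine

    -- `P` is a non-zero combination of `u` and `v`. If its coefficient at `u` vanishes, the
    -- spanning pair is reversed before `joined` applies.
    generator-through : ∀ {l} → IsGenerator l → OnLine l P → ∃ λ β → β * conj β ≡ ν × SameLine (line β) l
    generator-through {u , v} gl@(ind , _) (a , b , P≡) = decide (a ≟ 0#)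
      where
      Through : Line → Set
      Through l = ∃ λ β → β * conj β ≡ ν × SameLine (line β) l
      iso : Isotropic (u , v)
      iso = generator⇒isotropic {u , v} gl
      iso′ : Isotropic (v , u)
      iso′ = proj₁ (proj₂ iso) , proj₁ iso , trans (herm-sym u v) (trans (cong conj (proj₂ (proj₂ iso))) conj-0)
      ind′ : Independent (v , u)
      ind′ x y e = swap (ind y x (λ i → trans (+-comm _ _) (e i)))
      flip : Through (v , u) → Through (u , v)
      flip (β , ββ̄≡ν , same) = β , ββ̄≡ν , sameLine-trans {line β} {v , u} {u , v} same
        (onLine-right v u , onLine-left v u , onLine-right u v , onLine-left u v)
      decide : Dec (a ≡ 0#) → Through (u , v)
      decide (no a≢0)  = joined u v a b ind iso P≡ a≢0
      decide (yes a≡0) = flip (joined v u b a ind′ iso′ (λ i → trans (P≡ i) (+-comm _ _)) b≢0)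
        where
        b≢0 : b ≢ 0#
        b≢0 b≡0 = P-nonzero (λ i → trans (P≡ i) (trans (cong₂ (λ s t → s * u i + t * v i) a≡0 b≡0)
          (solve 2 (λ u v → 0ₑ :* u :+ 0ₑ :* v := 0ₑ) refl (u i) (v i))))

    act-line : ∀ ζ → ζ * conj ζ ≡ 1# → ∀ β → RepOrbit (ζ ^ half) (line β) (line (ζ * β))
    act-line ζ ζζ̄≡1 β with act ζ ζζ̄≡1
    ... | A , RA , AP∼P , s , s≢0 , AV , AW = A , RA , sameLine-∼ AP∼P (∼-sym (s , s≢0 , λ i → begin
      apply A (comb 1# V β W) i                     ≡⟨ apply-comb A 1# V β W i ⟩
      1# * apply A V i + β * apply A W i            ≡⟨ cong₂ (λ x y → 1# * x + β * y) (AV i) (AW i) ⟩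
      1# * (s * V i) + β * (s * (ζ * W i))          ≡⟨ solve 5 (λ s V β ζ W → 1ₑ :* (s :* V) :+ β :* (s :* (ζ :* W)) := s :* (1ₑ :* V :+ ζ :* β :* W)) refl s (V i) β ζ (W i) ⟩
      s * (1# * V i + ζ * β * W i)                  ∎))

    private
      β₀ = proj₁ (norm-onto ν≢0 ν∈)
      β₀β̄₀ : β₀ * conj β₀ ≡ ν
      β₀β̄₀ = trans (sym (norm≡ β₀)) (proj₂ (norm-onto ν≢0 ν∈))
      β₀≢0 : β₀ ≢ 0#
      β₀≢0 = proj₁ (factor-nonzero β₀β̄₀ ν≢0)
      -1-norm : - 1# * conj (- 1#) ≡ 1#
      -1-norm = trans (cong (- 1# *_) (trans (conj-neg 1#) (cong -_ conj-1))) -1*-1≡1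
      neg-norm : - β₀ * conj (- β₀) ≡ ν
      neg-norm = trans (cong (- β₀ *_) (conj-neg β₀)) (trans (solve 2 (λ a b → :- a :* :- b := a :* b) refl β₀ (conj β₀)) β₀β̄₀)

    odd-stabiliser : ∃ λ A → Rep (- 1#) A × apply A P ∼ P
    odd-stabiliser with act (- 1#) -1-norm
    ... | A , RA , AP∼P , _ = A , subst (λ ε → Rep ε A) -1^half RA , AP∼P

    reach-β : ∀ {β} → β * conj β ≡ ν → ∃ λ ε → RepOrbit ε (line β₀) (line β)
    reach-β {β} ββ̄≡ν = ζ ^ half , subst (λ z → RepOrbit (ζ ^ half) (line β₀) (line z)) ζβ₀≡β (act-line ζ ζζ̄≡1 β₀)
      where
      ζ = β * β₀≢0 ⁻¹
      ζβ₀≡β : ζ * β₀ ≡ β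
      ζβ₀≡β = trans (*-assoc _ _ _) (trans (cong (β *_) (inverseˡ β₀≢0)) (*-identityʳ β))
      ζζ̄≡1 : ζ * conj ζ ≡ 1#
      ζζ̄≡1 = *-cancelʳ ν≢0 (begin
        ζ * conj ζ * ν                        ≡⟨ cong (ζ * conj ζ *_) (sym β₀β̄₀) ⟩
        ζ * conj ζ * (β₀ * conj β₀)           ≡⟨ solve 4 (λ a b c d → a :* b :* (c :* d) := (a :* c) :* (b :* d)) refl ζ (conj ζ) β₀ (conj β₀) ⟩
        (ζ * β₀) * (conj ζ * conj β₀)         ≡⟨ cong ((ζ * β₀) *_) (sym (conj-* ζ β₀)) ⟩
        (ζ * β₀) * conj (ζ * β₀)              ≡⟨ cong (λ z → z * conj z) ζβ₀≡β ⟩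
        β * conj β                            ≡⟨ ββ̄≡ν ⟩
        ν                                     ≡⟨ sym (*-identityˡ ν) ⟩
        1# * ν                                ∎)

    -- The line meets the orbit in some `w` proportional to AP; its image under the inverse `B` of
    -- `A` passes through `P`, where the stabiliser already reaches every generator from `line β₀`.
    reach : ∀ {l} → InGo P l → ∃ λ ε → RepOrbit ε (line β₀) l
    reach {l} (gl , w , w∈l , _ , A , A∈𝔊 , AP∼w) =
      let ε , RA              = 𝔊⇒rep A∈𝔊
          B , RB , BA , AB    = rep-inverse RA
          P∈Bl                = onLine-∼ (onLine-apply B w∈l) (∼-trans {apply B w} {apply B (apply A P)} {P} (apply-∼ B (∼-sym AP∼w)) (apply-inverse B A BA P))
          β , ββ̄≡ν , same     = generator-through {image B l} (rep-generator RB {l} gl) P∈Bl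
          ε′ , orbit          = reach-β ββ̄≡ν
      in ε * ε′ , repOrbit-trans {l = line β₀} {line β} {l} orbit
           (A , RA , sameLine-trans {image A (line β)} {image A (image B l)} {l} (sameLine-image A same) (image-inverse A B AB l))

    -- The representatives are `line β₀` and `line (- β₀)`, separated by `unswapped`. A generator
    -- reached from the first by an element of character -1 is reached from the second by one of
    -- character 1, since ζ = -1 exchanges the two with character -1.
    partD : PartDAt P
    partD = transitive , line β₀ , line (- β₀) , inGo β₀β̄₀ , inGo neg-norm ,
      (λ { (A , A∈ℌ , same) → unswapped (ℌ⇒rep A∈ℌ) β₀≢0 (line-isotropic neg-norm) same }) , two
      where
      transitive : ∀ l l′ → InGo P l → InGo P l′ → LineOrbit 𝔊 l l′
      transitive l l′ l∈ l′∈ =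
        let A , RA , same = repOrbit-trans {l = l} {line β₀} {l′} (repOrbit-sym {l = line β₀} {l} (proj₂ (reach {l} l∈))) (proj₂ (reach {l′} l′∈))
        in A , rep⇒𝔊 RA , same
      inGo : ∀ {β} → β * conj β ≡ ν → InGo P (line β)
      inGo ββ̄≡ν = line-generator ββ̄≡ν , P , onLine-left P _ , P-nonzero , Id , one , ≡⇒∼ (apply-Id P)
      swapped : RepOrbit (- 1#) (line (- β₀)) (line β₀)
      swapped = subst₂ (λ ε z → RepOrbit ε (line (- β₀)) (line z)) -1^half
        (solve 1 (λ b → :- 1ₑ :* :- b := b) refl β₀) (act-line (- 1#) -1-norm (- β₀))
      by-sign : ∀ {ε l} → ε ≡ 1# ⊎ ε ≡ - 1# → RepOrbit ε (line β₀) l → LineOrbit ℌ (line β₀) l ⊎ LineOrbit ℌ (line (- β₀)) l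
      by-sign (inj₁ refl) (A , RA , same) = inj₁ (A , rep⇒ℌ RA , same)
      by-sign {l = l} (inj₂ refl) orbit =
        let B , RB , same = repOrbit-trans {l = line (- β₀)} {line β₀} {l} swapped orbit
        in inj₂ (B , rep⇒ℌ (subst (λ ε → Rep ε B) -1*-1≡1 RB) , same)
      two : ∀ l → InGo P l → LineOrbit ℌ (line β₀) l ⊎ LineOrbit ℌ (line (- β₀)) l
      two l l∈ = by-sign {l = l} (rep-sign (proj₁ (proj₂ (proj₂ (reach {l} l∈))))) (proj₂ (reach {l} l∈))

-- Construction of frames at the point at infinity and at the points with x ≠ 0.

module XPlusFrames (K : Field) (p q k : ℕ) (E : QuadraticExtension K p q k) where
  open Field K
  open FieldAlgebra K
  open Geometry K p q
  open Powers K p q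
  open Matrices K p q
  open Lines K p q
  open QuadraticExtension E
  open Conjugation K p q k E
  open Group K p q k E
  open Hermitian K p q k E
  open Frames K p q k E
  open Solver
  open ≡-Reasoning

  herm-vec : ∀ u {a b c d a′ b′ c′ d′} → conj a ≡ a′ → conj b ≡ b′ → conj c ≡ c′ → conj d ≡ d′ →
             herm u (vec a b c d) ≡ bil u (vec a′ b′ c′ d′)
  herm-vec u {a} {b} {c} {d} {a′} {b′} {c′} {d′} ea eb ec ed = bil-congʳ u {conj ∘ vec a b c d} {vec a′ b′ c′ d′} entry
    where
    entry : ∀ i → conj (vec a b c d i) ≡ vec a′ b′ c′ d′ i
    entry 0F = ea
    entry 1F = eb
    entry 2F = ec
    entry 3F = ed

  conj-minus : ∀ x y → conj (x + - y) ≡ conj x + - conj y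
  conj-minus x y = trans (conj-+ x (- y)) (cong (conj x +_) (conj-neg y))

  apply-std : ∀ {ε A} (RA : Rep ε A) → let open Rep RA in ∃ λ t → t ≢ 0# × (∀ v i → apply A v i ≡ t * apply (Std a b c d κ) v i)
  apply-std RA with Rep.std RA
  ... | t , t≢0 , e = t , t≢0 , λ v i → trans (sum4-cong (λ j → trans (cong (_* v j) (e i j)) (*-assoc _ _ _)))
                                          (sum4-scaleˡ t (λ j → Std a b c d κ i j * v j))
    where open Rep RA

  P∞ : Vec4
  P∞ = vec 0# 0# 0# 1#

  -- The tangent plane is X₀ = 0, and on the points (0, β, 1, 0) the surface reads β^(q+1) + 2 = 0;
  -- this is the origin of ν = -2 and η = 1.
  frame∞ : Frame P∞
  frame∞ = record
    { V = V ; W = W ; ν = - 2# ; η = 1#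
    ; ν∈ = Fq-neg Fq-2
    ; ν≢0 = neg-nonzero 2≢0
    ; η≢0 = 1≢0
    ; PP = trans (herm-vec P∞ conj-0 conj-0 conj-0 conj-1) (solve 0 (bilₑ (vecₑ 0ₑ 0ₑ 0ₑ 1ₑ) (vecₑ 0ₑ 0ₑ 0ₑ 1ₑ) := 0ₑ) refl)
    ; PV = trans (herm-vec P∞ conj-0 conj-0 conj-1 conj-0) (solve 0 (bilₑ (vecₑ 0ₑ 0ₑ 0ₑ 1ₑ) (vecₑ 0ₑ 0ₑ 1ₑ 0ₑ) := 0ₑ) refl)
    ; PW = trans (herm-vec P∞ conj-0 conj-1 conj-0 conj-0) (solve 0 (bilₑ (vecₑ 0ₑ 0ₑ 0ₑ 1ₑ) (vecₑ 0ₑ 1ₑ 0ₑ 0ₑ) := 0ₑ) refl)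
    ; VW = trans (herm-vec V conj-0 conj-1 conj-0 conj-0) (solve 0 (bilₑ (vecₑ 0ₑ 0ₑ 1ₑ 0ₑ) (vecₑ 0ₑ 1ₑ 0ₑ 0ₑ) := 0ₑ) refl)
    ; VV = trans (herm-vec V conj-0 conj-0 conj-1 conj-0) (solve 0 (bilₑ (vecₑ 0ₑ 0ₑ 1ₑ 0ₑ) (vecₑ 0ₑ 0ₑ 1ₑ 0ₑ) := :- (:- 2ₑ :* 1ₑ)) refl)
    ; WW = trans (herm-vec W conj-0 conj-1 conj-0 conj-0) (solve 0 (bilₑ (vecₑ 0ₑ 1ₑ 0ₑ 0ₑ) (vecₑ 0ₑ 1ₑ 0ₑ 0ₑ) := 1ₑ) refl)
    ; span = λ v hv → v 3F , v 2F , v 1F , spanned v hv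
    ; indep = λ α γ δ e → trans (sym (at₃ α γ δ)) (e 3F) , trans (sym (at₂ α γ δ)) (e 2F) , trans (sym (at₁ α γ δ)) (e 1F)
    ; act = act
    ; unswapped = unswapped
    }
    where
    V W : Vec4
    V = vec 0# 0# 1# 0#
    W = vec 0# 1# 0# 0#
    at₀ : ∀ α γ δ → α * 0# + γ * 0# + δ * 0# ≡ 0#
    at₀ = solve 3 (λ α γ δ → α :* 0ₑ :+ γ :* 0ₑ :+ δ :* 0ₑ := 0ₑ) refl
    at₁ : ∀ α γ δ → α * 0# + γ * 0# + δ * 1# ≡ δ
    at₁ = solve 3 (λ α γ δ → α :* 0ₑ :+ γ :* 0ₑ :+ δ :* 1ₑ := δ) refl
    at₂ : ∀ α γ δ → α * 0# + γ * 1# + δ * 0# ≡ γ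
    at₂ = solve 3 (λ α γ δ → α :* 0ₑ :+ γ :* 1ₑ :+ δ :* 0ₑ := γ) refl
    at₃ : ∀ α γ δ → α * 1# + γ * 0# + δ * 0# ≡ α
    at₃ = solve 3 (λ α γ δ → α :* 1ₑ :+ γ :* 0ₑ :+ δ :* 0ₑ := α) refl
    spanned : ∀ v → herm v P∞ ≡ 0# → ∀ i → v i ≡ v 3F * P∞ i + v 2F * V i + v 1F * W i
    spanned v hv 0F = trans v0≡0 (sym (at₀ (v 3F) (v 2F) (v 1F)))
      where
      v0≡0 : v 0F ≡ 0#
      v0≡0 = begin
        v 0F                            ≡⟨ solve 4 (λ v0 v1 v2 v3 → v0 := :- bilₑ (vecₑ v0 v1 v2 v3) (vecₑ 0ₑ 0ₑ 0ₑ 1ₑ)) refl (v 0F) (v 1F) (v 2F) (v 3F) ⟩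
        - bil v (vec 0# 0# 0# 1#)       ≡⟨ cong -_ (trans (sym (herm-vec v conj-0 conj-0 conj-0 conj-1)) hv) ⟩
        - 0#                            ≡⟨ solve 0 (:- 0ₑ := 0ₑ) refl ⟩
        0#                              ∎
    spanned v hv 1F = sym (at₁ (v 3F) (v 2F) (v 1F))
    spanned v hv 2F = sym (at₂ (v 3F) (v 2F) (v 1F))
    spanned v hv 3F = sym (at₃ (v 3F) (v 2F) (v 1F))

    act : ∀ ζ → ζ * conj ζ ≡ 1# → ∃ λ A → Rep (ζ ^ half) A × apply A P∞ ∼ P∞ ×
          ∃ λ s → s ≢ 0# × (∀ i → apply A V i ≡ s * V i) × (∀ i → apply A W i ≡ s * (ζ * W i))
    act ζ ζζ̄≡1 = S , subst (λ ε → Rep ε S) a^k (rep-std a∈ Fq-0 Fq-0 Fq-1 (solve 1 (λ a → a :* 1ₑ :- 0ₑ :* 0ₑ := a) refl a) a≢0 κ^half (≃-refl S)) ,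
      ∼-sym (a * a , *-nonzero a≢0 a≢0 , solveVec 2 (λ a ζ → applyₑ (Stdₑ a 0ₑ 0ₑ 1ₑ (ζ :* a)) (vecₑ 0ₑ 0ₑ 0ₑ 1ₑ) ,
        (λ i → a :* a :* vecₑ 0ₑ 0ₑ 0ₑ 1ₑ i)) (a ∷ ζ ∷ []) refl refl refl) ,
      a , a≢0 ,
      solveVec 2 (λ a ζ → applyₑ (Stdₑ a 0ₑ 0ₑ 1ₑ (ζ :* a)) (vecₑ 0ₑ 0ₑ 1ₑ 0ₑ) , (λ i → a :* vecₑ 0ₑ 0ₑ 1ₑ 0ₑ i)) (a ∷ ζ ∷ []) refl refl refl ,
      solveVec 2 (λ a ζ → applyₑ (Stdₑ a 0ₑ 0ₑ 1ₑ (ζ :* a)) (vecₑ 0ₑ 1ₑ 0ₑ 0ₑ) , (λ i → a :* (ζ :* vecₑ 0ₑ 1ₑ 0ₑ 0ₑ i))) (a ∷ ζ ∷ []) refl refl refl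
      where
      ε = ζ ^ half
      εε≡1 : ε * ε ≡ 1#
      εε≡1 = trans (half²≡norm ζ) ζζ̄≡1
      -- The diagonal matrix (a, 1) has determinant `a`, and `κ` = ζa makes `W` pick up the extra
      -- factor `ζ`. The condition κ^h = a becomes ζ^h·a^k = 1, so `a` needs the character value
      -- ζ^h: 1 or a non-square will do.
      withCharacter : ∃ λ a → a ≢ 0# × InFq a × a ^ k ≡ ε
      withCharacter with ±1 εε≡1
      ... | inj₁ ε≡1  = 1# , 1≢0 , Fq-1 , trans (1^n≡1 k) (sym ε≡1)
      ... | inj₂ ε≡-1 with nonsquare
      ...   | μ , μ≢0 , μ∈ , μ^k = μ , μ≢0 , μ∈ , trans μ^k (sym ε≡-1)
      a = proj₁ withCharacter
      a≢0 = proj₁ (proj₂ withCharacter)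
      a∈ = proj₁ (proj₂ (proj₂ withCharacter))
      a^k = proj₂ (proj₂ (proj₂ withCharacter))
      S = Std a 0# 0# 1# (ζ * a)
      κ^half : (ζ * a) ^ half ≡ a
      κ^half = begin
        (ζ * a) ^ half       ≡⟨ ^-distrib-* ζ a half ⟩
        ε * (a ^ half)       ≡⟨ cong (ε *_) (trans (^half a) (cong (a *_) a^k)) ⟩
        ε * (a * ε)          ≡⟨ solve 2 (λ ε a → ε :* (a :* ε) := ε :* ε :* a) refl ε a ⟩
        ε * ε * a            ≡⟨ cong (_* a) εε≡1 ⟩
        1# * a               ≡⟨ *-identityˡ a ⟩
        a                    ∎

    -- All points of the target line have X₀ = 0, so `c` = 0. Comparing the X₁ and X₂ coordinates of
    -- the image of V + βW forces κ = -D, hence κ^h = -D^h = -D, because h is odd and D^k = 1. This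
    -- contradicts κ^h = D.
    unswapped : ∀ {A β} → Rep 1# A → β ≢ 0# → Isotropic (P∞ , comb 1# V (- β) W) →
                ¬ SameLine (image A (P∞ , comb 1# V β W)) (P∞ , comb 1# V (- β) W)
    unswapped {A} {β} RA β≢0 _ (_ , _ , (x , y , e) , (x′ , y′ , e′)) = ⊥-elim (2≢0 (xy≡0⇒y≡0 det≢0 (begin
      D * 2#                  ≡⟨ solve 1 (λ D → D :* 2ₑ := D :+ D) refl D ⟩
      D + D                   ≡⟨ cong (D +_) (trans (sym κ^half) κ^half≡-D) ⟩
      D + - D                 ≡⟨ -‿inverseʳ D ⟩
      0#                      ∎)))
      where
      open Rep RA
      D = det a b c d
      t = proj₁ (apply-std RA)
      t≢0 = proj₁ (proj₂ (apply-std RA))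
      A≡ = proj₂ (proj₂ (apply-std RA))
      c≡0 : c ≡ 0#
      c≡0 = square≡0 (xy≡0⇒y≡0 t≢0 (begin
        t * (c * c)                               ≡⟨ cong (t *_) (solve 4 (λ a b c d → c :* c := applyₑ (Stdₑ a b c d 0ₑ) (vecₑ 0ₑ 0ₑ 0ₑ 1ₑ) 0F) refl a b c d) ⟩
        t * apply (Std a b c d κ) P∞ 0F           ≡⟨ sym (A≡ P∞ 0F) ⟩
        apply A P∞ 0F                             ≡⟨ e 0F ⟩
        x * 0# + y * (1# * 0# + - β * 0#)         ≡⟨ solve 3 (λ x y β → x :* 0ₑ :+ y :* (1ₑ :* 0ₑ :+ :- β :* 0ₑ) := 0ₑ) refl x y β ⟩
        0#                                        ∎))
      Tβ = comb 1# V β W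
      second : t * (β * κ) ≡ - (β * y′)
      second = begin
        t * (β * κ)                               ≡⟨ cong (t *_) (solve 6 (λ a b c d κ β → β :* κ := applyₑ (Stdₑ a b c d κ) (vecₑ (1ₑ :* 0ₑ :+ β :* 0ₑ) (1ₑ :* 0ₑ :+ β :* 1ₑ) (1ₑ :* 1ₑ :+ β :* 0ₑ) (1ₑ :* 0ₑ :+ β :* 0ₑ)) 1F) refl a b c d κ β) ⟩
        t * apply (Std a b c d κ) Tβ 1F            ≡⟨ sym (A≡ Tβ 1F) ⟩
        apply A Tβ 1F                              ≡⟨ e′ 1F ⟩
        x′ * 0# + y′ * (1# * 0# + - β * 1#)       ≡⟨ solve 3 (λ x y β → x :* 0ₑ :+ y :* (1ₑ :* 0ₑ :+ :- β :* 1ₑ) := :- (β :* y)) refl x′ y′ β ⟩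
        - (β * y′)                                ∎
      third : t * (a * d + b * c) ≡ y′
      third = begin
        t * (a * d + b * c)                       ≡⟨ cong (t *_) (solve 6 (λ a b c d κ β → a :* d :+ b :* c := applyₑ (Stdₑ a b c d κ) (vecₑ (1ₑ :* 0ₑ :+ β :* 0ₑ) (1ₑ :* 0ₑ :+ β :* 1ₑ) (1ₑ :* 1ₑ :+ β :* 0ₑ) (1ₑ :* 0ₑ :+ β :* 0ₑ)) 2F) refl a b c d κ β) ⟩
        t * apply (Std a b c d κ) Tβ 2F            ≡⟨ sym (A≡ Tβ 2F) ⟩
        apply A Tβ 2F                              ≡⟨ e′ 2F ⟩
        x′ * 0# + y′ * (1# * 1# + - β * 0#)       ≡⟨ solve 3 (λ x y β → x :* 0ₑ :+ y :* (1ₑ :* 1ₑ :+ :- β :* 0ₑ) := y) refl x′ y′ β ⟩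
        y′                                        ∎
      κ≡-D : κ ≡ - D
      κ≡-D = *-cancelˡ (*-nonzero t≢0 β≢0) (begin
        t * β * κ                                 ≡⟨ *-assoc _ _ _ ⟩
        t * (β * κ)                               ≡⟨ second ⟩
        - (β * y′)                                ≡⟨ cong (λ z → - (β * z)) (sym third) ⟩
        - (β * (t * (a * d + b * c)))             ≡⟨ cong (λ z → - (β * (t * (a * d + b * z)))) c≡0 ⟩
        - (β * (t * (a * d + b * 0#)))            ≡⟨ solve 5 (λ β t a b d → :- (β :* (t :* (a :* d :+ b :* 0ₑ))) := t :* β :* :- (a :* d :- b :* 0ₑ)) refl β t a b d ⟩
        t * β * - (a * d + - (b * 0#))            ≡⟨ cong (λ z → t * β * - (a * d + - (b * z))) (sym c≡0) ⟩
        t * β * - D                               ∎)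
      κ^half≡-D : κ ^ half ≡ - D
      κ^half≡-D = begin
        κ ^ half          ≡⟨ cong (_^ half) κ≡-D ⟩
        (- D) ^ half      ≡⟨ neg^half D ⟩
        - (D ^ half)      ≡⟨ cong -_ (trans (^half D) (trans (cong (D *_) det^k) (*-identityʳ D))) ⟩
        - D               ∎

  affine : Carrier → Carrier → Vec4
  affine x y = vec 1# x y (y * y)

  -- The polarisation of y ↦ (1, 0, y, y²), doubled to avoid denominators: in the plane X₁ = 0, the
  -- pole of the chord joining the points with parameters `y` and `y′` of the conic X₂² = X₀X₃.
  polar : Carrier → Carrier → Vec4
  polar y y′ = vec 2# 0# (y + y′) (2# * (y * y′))

  Std-affine : ∀ a b c d κ x y i → apply (Std a b c d κ) (affine x y) i ≡
    vec ((c * y + d) * (c * y + d)) (κ * x) ((c * y + d) * (a * y + b)) ((a * y + b) * (a * y + b)) i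
  Std-affine a b c d κ x y = solveVec 7 (λ a b c d κ x y → applyₑ (Stdₑ a b c d κ) (vecₑ 1ₑ x y (y :* y)) ,
      vecₑ ((c :* y :+ d) :* (c :* y :+ d)) (κ :* x) ((c :* y :+ d) :* (a :* y :+ b)) ((a :* y :+ b) :* (a :* y :+ b)))
    (a ∷ b ∷ c ∷ d ∷ κ ∷ x ∷ y ∷ []) refl refl refl

  Std-polar : ∀ a b c d κ y y′ i → apply (Std a b c d κ) (polar y y′) i ≡
    vec (2# * ((c * y + d) * (c * y′ + d))) 0# ((c * y + d) * (a * y′ + b) + (c * y′ + d) * (a * y + b)) (2# * ((a * y + b) * (a * y′ + b))) i
  Std-polar a b c d κ y y′ = solveVec 7 (λ a b c d κ y y′ → applyₑ (Stdₑ a b c d κ) (vecₑ 2ₑ 0ₑ (y :+ y′) (2ₑ :* (y :* y′))) ,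
      vecₑ (2ₑ :* ((c :* y :+ d) :* (c :* y′ :+ d))) 0ₑ ((c :* y :+ d) :* (a :* y′ :+ b) :+ (c :* y′ :+ d) :* (a :* y :+ b)) (2ₑ :* ((a :* y :+ b) :* (a :* y′ :+ b))))
    (a ∷ b ∷ c ∷ d ∷ κ ∷ y ∷ y′ ∷ []) refl refl refl

  -- If (y, 1) and (y′, 1) are eigenvectors of (a b; c d), with eigenvalues z and z′, then the
  -- points (1, 0, y, y²), (1, 0, y′, y′²) and their pole are eigenvectors of Std a b c d κ.
  Std-eigen-affine : ∀ a b c d κ x y z κx → c * y + d ≡ z → a * y + b ≡ z * y → κ * x ≡ z * z * κx → ∀ i →
    apply (Std a b c d κ) (affine x y) i ≡ z * z * affine κx y i
  Std-eigen-affine a b c d κ x y z κx ez ew eκ i = trans (Std-affine a b c d κ x y i)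
    (trans (cong (λ f → f i) (cong₂ (λ z w → vec (z * z) (κ * x) (z * w) (w * w)) ez ew))
      (trans (cong (λ t → vec (z * z) t (z * (z * y)) (z * y * (z * y)) i) eκ)
        (solveVec 3 (λ z κx y → vecₑ (z :* z) (z :* z :* κx) (z :* (z :* y)) (z :* y :* (z :* y)) , (λ i → z :* z :* vecₑ 1ₑ κx y (y :* y) i))
          (z ∷ κx ∷ y ∷ []) refl {vec (z * z) (z * z * κx) (z * (z * y)) (z * y * (z * y))} {λ i → z * z * affine κx y i} refl refl i)))

  Std-eigen-polar : ∀ a b c d κ y y′ z z′ → c * y + d ≡ z → a * y + b ≡ z * y → c * y′ + d ≡ z′ → a * y′ + b ≡ z′ * y′ → ∀ i →
    apply (Std a b c d κ) (polar y y′) i ≡ z * z′ * polar y y′ i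
  Std-eigen-polar a b c d κ y y′ z z′ ez ew ez′ ew′ i = trans (Std-polar a b c d κ y y′ i)
    (trans (cong₂ (λ f g → entry f g i) (cong₂ _,_ ez ew) (cong₂ _,_ ez′ ew′))
      (solveVec 4 (λ z z′ y y′ → vecₑ (2ₑ :* (z :* z′)) 0ₑ (z :* (z′ :* y′) :+ z′ :* (z :* y)) (2ₑ :* (z :* y :* (z′ :* y′))) ,
        (λ i → z :* z′ :* vecₑ 2ₑ 0ₑ (y :+ y′) (2ₑ :* (y :* y′)) i)) (z ∷ z′ ∷ y ∷ y′ ∷ []) refl
        {entry (z , z * y) (z′ , z′ * y′)} {λ i → z * z′ * polar y y′ i} refl refl i))
    where
    entry : Carrier × Carrier → Carrier × Carrier → Vec4
    entry (z , w) (z′ , w′) = vec (2# * (z * z′)) 0# (z * w′ + z′ * w) (2# * (w * w′))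

  -- Conjugation exchanges `y` and `y′`, so the form against `V` is `bil` against the conic point
  -- (1, 0, y, y²); this annihilates `P`, whose X₁ coordinate drops out. `W` is the pole of the
  -- chord of `y` and `y′`, hence orthogonal to `P` and `V`. The values of the form at `V` and `W`
  -- are -s² and 2s², whence ν = 1/2 and η = 2s².
  module AffinePoint (x y : Carrier) (x≢0 : x ≢ 0#) (curve : conj y + - y ≡ x ^ half) where

    P V W : Vec4
    P = affine x y
    V = affine 0# (conj y)
    W = polar y (conj y)

    y′ x̄ s ν η : Carrier
    y′ = conj y
    x̄ = conj x
    s = y′ + - y
    ν = 2≢0 ⁻¹
    η = 2# * (s * s)

    s≢0 : s ≢ 0#
    s≢0 e = ^-nonzero half x≢0 (trans (sym curve) e)

    conj-y′ : conj y′ ≡ y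
    conj-y′ = conj-conj y

    conj-s : conj s ≡ - s
    conj-s = trans (conj-minus y′ y) (trans (cong (_+ - y′) conj-y′) (solve 2 (λ y y′ → y :- y′ := :- (y′ :- y)) refl y y′))

    xx̄≡ss : x * x̄ ≡ s * s
    xx̄≡ss = trans (sym (half²≡norm x)) (cong₂ _*_ (sym curve) (sym curve))

    herm-P : ∀ u → herm u P ≡ bil u (vec 1# x̄ y′ (y′ * y′))
    herm-P u = herm-vec u conj-1 refl refl (conj-* y y)

    herm-V : ∀ u → herm u V ≡ bil u (vec 1# 0# y (y * y))
    herm-V u = herm-vec u conj-1 conj-0 conj-y′ (trans (conj-* y′ y′) (cong₂ _*_ conj-y′ conj-y′))

    herm-W : ∀ u → herm u W ≡ bil u (vec 2# 0# (y′ + y) (2# * (y′ * y)))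
    herm-W u = herm-vec u conj-2 conj-0 (trans (conj-+ y y′) (cong (y′ +_) conj-y′))
      (trans (conj-* 2# (y * y′)) (cong₂ _*_ conj-2 (trans (conj-* y y′) (cong (y′ *_) conj-y′))))

    PP : herm P P ≡ 0#
    PP = trans (herm-P P) (trans (solve 4 (λ x x̄ y y′ → bilₑ (vecₑ 1ₑ x y (y :* y)) (vecₑ 1ₑ x̄ y′ (y′ :* y′)) := x :* x̄ :- (y′ :- y) :* (y′ :- y))
      refl x x̄ y y′) (x≡y⇒x-y≡0 xx̄≡ss))

    PV : herm P V ≡ 0#
    PV = trans (herm-V P) (solve 2 (λ x y → bilₑ (vecₑ 1ₑ x y (y :* y)) (vecₑ 1ₑ 0ₑ y (y :* y)) := 0ₑ) refl x y)

    PW : herm P W ≡ 0#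
    PW = trans (herm-W P) (solve 3 (λ x y y′ → bilₑ (vecₑ 1ₑ x y (y :* y)) (vecₑ 2ₑ 0ₑ (y′ :+ y) (2ₑ :* (y′ :* y))) := 0ₑ) refl x y y′)

    VW : herm V W ≡ 0#
    VW = trans (herm-W V) (solve 2 (λ y y′ → bilₑ (vecₑ 1ₑ 0ₑ y′ (y′ :* y′)) (vecₑ 2ₑ 0ₑ (y′ :+ y) (2ₑ :* (y′ :* y))) := 0ₑ) refl y y′)

    VV : herm V V ≡ - (ν * η)
    VV = begin
      herm V V                                          ≡⟨ herm-V V ⟩
      bil V (vec 1# 0# y (y * y))                       ≡⟨ solve 2 (λ y y′ → bilₑ (vecₑ 1ₑ 0ₑ y′ (y′ :* y′)) (vecₑ 1ₑ 0ₑ y (y :* y)) := :- (1ₑ :* ((y′ :- y) :* (y′ :- y)))) refl y y′ ⟩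
      - (1# * (s * s))                                  ≡⟨ cong (λ z → - (z * (s * s))) (sym (inverseˡ 2≢0)) ⟩
      - (ν * 2# * (s * s))                              ≡⟨ cong -_ (*-assoc _ _ _) ⟩
      - (ν * η)                                         ∎

    WW : herm W W ≡ η
    WW = trans (herm-W W) (solve 2 (λ y y′ → bilₑ (vecₑ 2ₑ 0ₑ (y :+ y′) (2ₑ :* (y :* y′))) (vecₑ 2ₑ 0ₑ (y′ :+ y) (2ₑ :* (y′ :* y))) :=
      2ₑ :* ((y′ :- y) :* (y′ :- y))) refl y y′)

    span : ∀ v → herm v P ≡ 0# → ∃ λ α → ∃₂ λ γ δ → ∀ i → v i ≡ α * P i + γ * V i + δ * W i
    span v hv = α , γ , δ , spanned
      where
      v0 = v 0F
      v1 = v 1F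
      v2 = v 2F
      v3 = v 3F
      i = s≢0 ⁻¹
      -- The coefficients solve coordinates 1, 0 and 2: `V` and `W` have no X₁ coordinate, which
      -- gives `α`; then γ + 2δ = v0 - α, and coordinate 2 becomes δs = -r. Coordinate 3 follows
      -- from the orthogonality to `P`.
      α = v1 * x≢0 ⁻¹
      r = (v2 + - (α * y)) + - (y′ * (v0 + - α))
      δ = - (r * i)
      γ = (v0 + - α) + - (2# * δ)
      αx≡v1 : α * x ≡ v1
      αx≡v1 = trans (*-assoc _ _ _) (trans (cong (v1 *_) (inverseˡ x≢0)) (*-identityʳ v1))
      δs+r≡0 : δ * s + r ≡ 0#
      δs+r≡0 = begin
        - (r * i) * s + r         ≡⟨ solve 3 (λ r i s → :- (r :* i) :* s :+ r := :- (r :* (i :* s)) :+ r) refl r i s ⟩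
        - (r * (i * s)) + r       ≡⟨ cong (λ z → - (r * z) + r) (inverseˡ s≢0) ⟩
        - (r * 1#) + r            ≡⟨ solve 1 (λ r → :- (r :* 1ₑ) :+ r := 0ₑ) refl r ⟩
        0#                        ∎
      spanned : ∀ i → v i ≡ α * P i + γ * V i + δ * W i
      spanned 0F = solve 3 (λ v0 α δ → v0 := α :* 1ₑ :+ (v0 :- α :- 2ₑ :* δ) :* 1ₑ :+ δ :* 2ₑ) refl v0 α δ
      spanned 1F = trans (sym αx≡v1) (solve 4 (λ α x γ δ → α :* x := α :* x :+ γ :* 0ₑ :+ δ :* 0ₑ) refl α x γ δ)
      spanned 2F = x-y≡0⇒x≡y (trans
        (solve 6 (λ v0 v2 α δ y y′ → v2 :- (α :* y :+ (v0 :- α :- 2ₑ :* δ) :* y′ :+ δ :* (y :+ y′)) :=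
                    δ :* (y′ :- y) :+ ((v2 :- α :* y) :- y′ :* (v0 :- α))) refl v0 v2 α δ y y′)
        δs+r≡0)
      spanned 3F = x-y≡0⇒x≡y (begin
        v3 + - (α * (y * y) + γ * (y′ * y′) + δ * (2# * (y * y′)))
          ≡⟨ solve 10 (λ v0 v1 v2 v3 α δ x x̄ y y′ →
               v3 :- (α :* (y :* y) :+ (v0 :- α :- 2ₑ :* δ) :* (y′ :* y′) :+ δ :* (2ₑ :* (y :* y′))) :=
               :- bilₑ (vecₑ v0 v1 v2 v3) (vecₑ 1ₑ x̄ y′ (y′ :* y′)) :+ (v1 :- α :* x) :* x̄ :+ α :* (x :* x̄ :- (y′ :- y) :* (y′ :- y))
                 :+ 2ₑ :* y′ :* (δ :* (y′ :- y) :+ ((v2 :- α :* y) :- y′ :* (v0 :- α))))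
             refl v0 v1 v2 v3 α δ x x̄ y y′ ⟩
        - bil v (vec 1# x̄ y′ (y′ * y′)) + (v1 + - (α * x)) * x̄ + α * (x * x̄ + - (s * s)) + 2# * y′ * (δ * s + r)
          ≡⟨ cong₂ (λ m n → m + 2# * y′ * n)
               (cong₂ (λ m n → m + α * n) (cong₂ (λ m n → - m + n * x̄) (trans (sym (herm-P v)) hv) (x≡y⇒x-y≡0 (sym αx≡v1))) (x≡y⇒x-y≡0 xx̄≡ss)) δs+r≡0 ⟩
        - 0# + 0# * x̄ + α * 0# + 2# * y′ * 0#
          ≡⟨ solve 3 (λ x̄ α y′ → :- 0ₑ :+ 0ₑ :* x̄ :+ α :* 0ₑ :+ 2ₑ :* y′ :* 0ₑ := 0ₑ) refl x̄ α y′ ⟩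
        0# ∎)

    indep : ∀ α γ δ → (∀ i → α * P i + γ * V i + δ * W i ≡ 0#) → α ≡ 0# × γ ≡ 0# × δ ≡ 0#
    indep α γ δ e = α≡0 , γ≡0 , δ≡0
      where
      α≡0 : α ≡ 0#
      α≡0 = xy≡0⇒y≡0 x≢0 (trans (solve 4 (λ α x γ δ → x :* α := α :* x :+ γ :* 0ₑ :+ δ :* 0ₑ) refl α x γ δ) (e 1F))
      δ≡0 : δ ≡ 0#
      δ≡0 = xy≡0⇒y≡0 s≢0 (begin
        s * δ
          ≡⟨ solve 5 (λ α γ δ y y′ → (y′ :- y) :* δ := y′ :* (α :* 1ₑ :+ γ :* 1ₑ :+ δ :* 2ₑ) :- (α :* y :+ γ :* y′ :+ δ :* (y :+ y′)) :- α :* (y′ :- y)) refl α γ δ y y′ ⟩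
        y′ * (α * 1# + γ * 1# + δ * 2#) + - (α * y + γ * y′ + δ * (y + y′)) + - (α * s)
          ≡⟨ cong₂ (λ m n → m + - (n * s)) (cong₂ (λ m n → y′ * m + - n) (e 0F) (e 2F)) α≡0 ⟩
        y′ * 0# + - 0# + - (0# * s)
          ≡⟨ solve 2 (λ y′ s → y′ :* 0ₑ :- 0ₑ :- 0ₑ :* s := 0ₑ) refl y′ s ⟩
        0# ∎)
      γ≡0 : γ ≡ 0#
      γ≡0 = begin
        γ                                                   ≡⟨ solve 3 (λ α γ δ → γ := (α :* 1ₑ :+ γ :* 1ₑ :+ δ :* 2ₑ) :- α :- 2ₑ :* δ) refl α γ δ ⟩
        (α * 1# + γ * 1# + δ * 2#) + - α + - (2# * δ)       ≡⟨ cong₂ (λ m n → m + - (2# * n)) (cong₂ (λ m n → m + - n) (e 0F) α≡0) δ≡0 ⟩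
        0# + - 0# + - (2# * 0#)                             ≡⟨ solve 0 (0ₑ :- 0ₑ :- 2ₑ :* 0ₑ := 0ₑ) refl ⟩
        0#                                                  ∎

    -- Every u + ζu^q has the required property; only its vanishing has to be avoided. The choice u
    -- = 1 works unless ζ = -1, and then u = y gives y - y^q, which is non-zero.
    hilbert90 : ∀ ζ → ζ * conj ζ ≡ 1# → ∃ λ z → z ≢ 0# × z ≡ ζ * conj z
    hilbert90 ζ ζζ̄≡1 = decide ((1# + ζ) ≟ 0#)
      where
      twisted : ∀ u → u + ζ * conj u ≡ ζ * conj (u + ζ * conj u)
      twisted u = sym (begin
        ζ * conj (u + ζ * conj u)                 ≡⟨ cong (ζ *_) (trans (conj-+ u _) (cong (conj u +_) (trans (conj-* ζ _) (cong (conj ζ *_) (conj-conj u))))) ⟩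
        ζ * (conj u + conj ζ * u)                 ≡⟨ solve 4 (λ ζ ζ̄ u ū → ζ :* (ū :+ ζ̄ :* u) := ζ :* ζ̄ :* u :+ ζ :* ū) refl ζ (conj ζ) u (conj u) ⟩
        ζ * conj ζ * u + ζ * conj u               ≡⟨ cong (λ t → t * u + ζ * conj u) ζζ̄≡1 ⟩
        1# * u + ζ * conj u                       ≡⟨ cong (_+ ζ * conj u) (*-identityˡ u) ⟩
        u + ζ * conj u                            ∎)
      decide : Dec (1# + ζ ≡ 0#) → ∃ λ z → z ≢ 0# × z ≡ ζ * conj z
      decide (no 1+ζ≢0) = _ , (λ e → 1+ζ≢0 (trans (sym (cong (1# +_) (trans (cong (ζ *_) conj-1) (*-identityʳ ζ)))) e)) , twisted 1#
      decide (yes 1+ζ≡0) = _ , (λ e → s≢0 (begin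
        s                                 ≡⟨ solve 3 (λ y y′ ζ → y′ :- y := (1ₑ :+ ζ) :* y′ :- (y :+ ζ :* y′)) refl y y′ ζ ⟩
        (1# + ζ) * y′ + - (y + ζ * y′)    ≡⟨ cong₂ (λ m n → m * y′ + - n) 1+ζ≡0 e ⟩
        0# * y′ + - 0#                    ≡⟨ solve 1 (λ y → 0ₑ :* y :- 0ₑ := 0ₑ) refl y′ ⟩
        0#                                ∎)) , twisted y

    -- Write ζ = z/z′ with z′ = z^q and take the matrix over F_q with eigenvalues `z` on (y,1) and
    -- `z′` on (y′,1). With κ = z² the vectors `P`, `V`, `W` are eigenvectors with eigenvalues z²,
    -- z′² and zz′ = ζz′².
    act : ∀ ζ → ζ * conj ζ ≡ 1# → ∃ λ A → Rep (ζ ^ half) A × apply A P ∼ P ×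
          ∃ λ s → s ≢ 0# × (∀ i → apply A V i ≡ s * V i) × (∀ i → apply A W i ≡ s * (ζ * W i))
    act ζ ζζ̄≡1 = S , subst (λ ε → Rep ε S) D^k (rep-std a∈ b∈ c∈ d∈ det≡zz′ (*-nonzero z≢0 z′≢0) κ^half (≃-refl S)) ,
      ∼-sym (z * z , *-nonzero z≢0 z≢0 , Std-eigen-affine a b c d (z * z) x y z x cy+d ay+b refl) ,
      z′ * z′ , *-nonzero z′≢0 z′≢0 , Std-eigen-affine a b c d (z * z) 0# y′ z′ 0# cy′+d ay′+b (trans (zeroʳ _) (sym (zeroʳ _))) ,
      λ i → trans (Std-eigen-polar a b c d (z * z) y y′ z z′ cy+d ay+b cy′+d ay′+b i)
        (trans (cong (λ t → t * z′ * W i) z≡ζz′) (solve 3 (λ ζ z′ W → ζ :* z′ :* z′ :* W := z′ :* z′ :* (ζ :* W)) refl ζ z′ (W i)))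
      where
      z = proj₁ (hilbert90 ζ ζζ̄≡1)
      z≢0 = proj₁ (proj₂ (hilbert90 ζ ζζ̄≡1))
      z′ = conj z
      z′≢0 = conj-nonzero z≢0
      conj-z′ : conj z′ ≡ z
      conj-z′ = conj-conj z
      z≡ζz′ : z ≡ ζ * z′
      z≡ζz′ = proj₂ (proj₂ (hilbert90 ζ ζζ̄≡1))
      i = s≢0 ⁻¹
      -- Solving z = cy + d, zy = ay + b together with the conjugate equations.
      a b c d : Carrier
      a = (z′ * y′ + - (z * y)) * i
      b = (y * y′ * z + - (y′ * y * z′)) * i
      c = (z′ + - z) * i
      d = (z * y′ + - (z′ * y)) * i
      S = Std a b c d (z * z)
      conj-i : conj i ≡ - i
      conj-i = *-cancelʳ (neg-nonzero s≢0) (begin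
        conj i * - s             ≡⟨ cong (conj i *_) (sym conj-s) ⟩
        conj i * conj s          ≡⟨ sym (conj-* i s) ⟩
        conj (i * s)             ≡⟨ cong conj (inverseˡ s≢0) ⟩
        conj 1#                  ≡⟨ conj-1 ⟩
        1#                       ≡⟨ sym (inverseˡ s≢0) ⟩
        i * s                    ≡⟨ solve 2 (λ i s → i :* s := :- i :* :- s) refl i s ⟩
        - i * - s                ∎)
      skew-quotient : ∀ {u v} → conj u ≡ v → conj v ≡ u → InFq ((u + - v) * i)
      skew-quotient {u} {v} eu ev = trans (conj-* _ _) (trans (cong₂ _*_ (trans (conj-minus u v) (cong₂ (λ m n → m + - n) eu ev)) conj-i)
        (solve 3 (λ u v i → (v :- u) :* :- i := (u :- v) :* i) refl u v i))
      conj-prod : ∀ {u v u′ v′} → conj u ≡ u′ → conj v ≡ v′ → conj (u * v) ≡ u′ * v′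
      conj-prod eu ev = trans (conj-* _ _) (cong₂ _*_ eu ev)
      a∈ : InFq a
      a∈ = skew-quotient (conj-prod conj-z′ conj-y′) (conj-prod refl refl)
      b∈ : InFq b
      b∈ = skew-quotient (conj-prod (conj-prod refl conj-y′) refl) (conj-prod (conj-prod conj-y′ refl) conj-z′)
      c∈ : InFq c
      c∈ = skew-quotient conj-z′ refl
      d∈ : InFq d
      d∈ = skew-quotient (conj-prod refl conj-y′) (conj-prod conj-z′ refl)
      cancel : ∀ u → u * (i * s) ≡ u
      cancel u = trans (cong (u *_) (inverseˡ s≢0)) (*-identityʳ u)
      cy+d : c * y + d ≡ z
      cy+d = trans (solve 5 (λ z z′ y y′ i → (z′ :- z) :* i :* y :+ (z :* y′ :- z′ :* y) :* i := z :* (i :* (y′ :- y))) refl z z′ y y′ i) (cancel z)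
      cy′+d : c * y′ + d ≡ z′
      cy′+d = trans (solve 5 (λ z z′ y y′ i → (z′ :- z) :* i :* y′ :+ (z :* y′ :- z′ :* y) :* i := z′ :* (i :* (y′ :- y))) refl z z′ y y′ i) (cancel z′)
      ay+b : a * y + b ≡ z * y
      ay+b = trans (solve 5 (λ z z′ y y′ i → (z′ :* y′ :- z :* y) :* i :* y :+ (y :* y′ :* z :- y′ :* y :* z′) :* i := z :* y :* (i :* (y′ :- y))) refl z z′ y y′ i) (cancel (z * y))
      ay′+b : a * y′ + b ≡ z′ * y′
      ay′+b = trans (solve 5 (λ z z′ y y′ i → (z′ :* y′ :- z :* y) :* i :* y′ :+ (y :* y′ :* z :- y′ :* y :* z′) :* i := z′ :* y′ :* (i :* (y′ :- y))) refl z z′ y y′ i) (cancel (z′ * y′))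
      det≡zz′ : det a b c d ≡ z * z′
      det≡zz′ = trans (solve 5 (λ z z′ y y′ i → (z′ :* y′ :- z :* y) :* i :* ((z :* y′ :- z′ :* y) :* i) :- (y :* y′ :* z :- y′ :* y :* z′) :* i :* ((z′ :- z) :* i) :=
          z :* z′ :* (i :* (y′ :- y)) :* (i :* (y′ :- y))) refl z z′ y y′ i)
        (trans (cancel _) (cancel _))
      κ^half : (z * z) ^ half ≡ z * z′
      κ^half = trans (^-distrib-* z z half) (half²≡norm z)
      ε = ζ ^ half
      zᵏ = z ^ k
      z′ᵏ = z′ ^ k
      -- Take h-th powers in z = ζz′, write z^h as z·z^k and z′ as z·z^(2k), and cancel z·z^k. As ε²
      -- = 1, this says D^k = ε.
      1≡εD^k : 1# ≡ ε * (zᵏ * z′ᵏ)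
      1≡εD^k = *-cancelˡ (*-nonzero z≢0 (^-nonzero k z≢0)) (begin
        z * zᵏ * 1#                                ≡⟨ trans (*-identityʳ _) (sym (^half z)) ⟩
        z ^ half                                   ≡⟨ cong (_^ half) z≡ζz′ ⟩
        (ζ * z′) ^ half                            ≡⟨ ^-distrib-* ζ z′ half ⟩
        ε * (z′ ^ half)                            ≡⟨ cong (ε *_) (^half z′) ⟩
        ε * (z′ * z′ᵏ)                             ≡⟨ cong (λ t → ε * (t * z′ᵏ)) (conj≡ z) ⟩
        ε * (z * (zᵏ * zᵏ) * z′ᵏ)                  ≡⟨ solve 4 (λ ε z u v → ε :* (z :* (u :* u) :* v) := z :* u :* (ε :* (u :* v))) refl ε z zᵏ z′ᵏ ⟩
        z * zᵏ * (ε * (zᵏ * z′ᵏ))                  ∎)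
      D^k : (z * z′) ^ k ≡ ε
      D^k = begin
        (z * z′) ^ k                     ≡⟨ ^-distrib-* z z′ k ⟩
        zᵏ * z′ᵏ                         ≡⟨ sym (*-identityˡ _) ⟩
        1# * (zᵏ * z′ᵏ)                  ≡⟨ cong (_* (zᵏ * z′ᵏ)) (sym (trans (half²≡norm ζ) ζζ̄≡1)) ⟩
        ε * ε * (zᵏ * z′ᵏ)               ≡⟨ *-assoc _ _ _ ⟩
        ε * (ε * (zᵏ * z′ᵏ))             ≡⟨ cong (ε *_) (sym 1≡εD^k) ⟩
        ε * 1#                           ≡⟨ *-identityʳ ε ⟩
        ε                                ∎

    -- No other point of X⁺ in the orbit of P is orthogonal to P, so A fixes P; then A has an eigenvalue z
    -- on (y, 1), and swapping the two lines would need z^q = -z, while det A = z^(q+1) is a square.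
    unswapped : ∀ {A β} → Rep 1# A → β ≢ 0# → Isotropic (P , comb 1# V (- β) W) →
                ¬ SameLine (image A (P , comb 1# V β W)) (P , comb 1# V (- β) W)
    unswapped {A} {β} RA β≢0 iso (_ , _ , AP∈ , (m , n , e)) = z≢0 (xy≡0⇒y≡0 2≢0 (begin
      2# * z           ≡⟨ solve 1 (λ z → 2ₑ :* z := z :+ z) refl z ⟩
      z + z            ≡⟨ cong₂ _+_ z≡-z′ (sym z′≡z) ⟩
      - z′ + z′        ≡⟨ -‿inverseˡ z′ ⟩
      0#               ∎))
      where
      open Rep RA
      D = det a b c d
      t = proj₁ (apply-std RA)
      t≢0 = proj₁ (proj₂ (apply-std RA))
      A≡ = proj₂ (proj₂ (apply-std RA))
      z w z′ w′ : Carrier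
      z = c * y + d
      w = a * y + b
      z′ = c * y′ + d
      w′ = a * y′ + b
      conj-affine : ∀ {c d} → InFq c → InFq d → ∀ {y y′} → conj y ≡ y′ → conj (c * y + d) ≡ c * y′ + d
      conj-affine c∈ d∈ ey = trans (conj-+ _ _) (cong₂ _+_ (trans (conj-* _ _) (cong₂ _*_ c∈ ey)) d∈)
      conj-z : conj z ≡ z′
      conj-z = conj-affine c∈ d∈ refl
      conj-w : conj w ≡ w′
      conj-w = conj-affine a∈ b∈ refl
      orthogonal : κ * (x * x̄) ≡ (w + - (z * y′)) * (w + - (z * y′))
      orthogonal = x-y≡0⇒x≡y (xy≡0⇒y≡0 t≢0 (begin
        t * (κ * (x * x̄) + - ((w + - (z * y′)) * (w + - (z * y′))))
          ≡⟨ solve 7 (λ t κ x x̄ z w y′ → t :* (κ :* (x :* x̄) :- (w :- z :* y′) :* (w :- z :* y′)) :=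
               bilₑ (vecₑ (t :* (z :* z)) (t :* (κ :* x)) (t :* (z :* w)) (t :* (w :* w))) (vecₑ 1ₑ x̄ y′ (y′ :* y′))) refl t κ x x̄ z w y′ ⟩
        bil (vec (t * (z * z)) (t * (κ * x)) (t * (z * w)) (t * (w * w))) (vec 1# x̄ y′ (y′ * y′))
          ≡⟨ sym (herm-P (vec (t * (z * z)) (t * (κ * x)) (t * (z * w)) (t * (w * w)))) ⟩
        herm (vec (t * (z * z)) (t * (κ * x)) (t * (z * w)) (t * (w * w))) P
          ≡⟨ herm-cong {vec (t * (z * z)) (t * (κ * x)) (t * (z * w)) (t * (w * w))} {apply A P} {P} {P} AP≡ (λ _ → refl) ⟩
        herm (apply A P) P
          ≡⟨ isotropic-on {P , comb 1# V (- β) W} {apply A P} {P} iso AP∈ (onLine-left P (comb 1# V (- β) W)) ⟩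
        0# ∎))
        where
        entry : ∀ i → vec (t * (z * z)) (t * (κ * x)) (t * (z * w)) (t * (w * w)) i ≡ t * vec (z * z) (κ * x) (z * w) (w * w) i
        entry 0F = refl
        entry 1F = refl
        entry 2F = refl
        entry 3F = refl
        AP≡ : ∀ i → vec (t * (z * z)) (t * (κ * x)) (t * (z * w)) (t * (w * w)) i ≡ apply A P i
        AP≡ i = trans (entry i) (sym (trans (A≡ P i) (cong (t *_) (Std-affine a b c d κ x y i))))
      -- The h-th power of `orthogonal` turns its right side into the norm of w - zy′ and `κ` into
      -- `D`; the curve equation and s^q = -s evaluate the rest.
      normed : (w + - (z * y′)) * (w′ + - (z′ * y)) ≡ - (D * (s * s))
      normed = begin
        (w + - (z * y′)) * (w′ + - (z′ * y))                ≡⟨ cong ((w + - (z * y′)) *_) (sym conj-f) ⟩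
        f * conj f                                          ≡⟨ sym (half²≡norm f) ⟩
        (f ^ half) * (f ^ half)                             ≡⟨ sym (^-distrib-* f f half) ⟩
        (f * f) ^ half                                      ≡⟨ cong (_^ half) (sym orthogonal) ⟩
        (κ * (x * x̄)) ^ half                                ≡⟨ trans (^-distrib-* κ _ half) (cong₂ _*_ κ^half (trans (^-distrib-* x x̄ half) (cong ((x ^ half) *_) (^-swap x q half)))) ⟩
        D * ((x ^ half) * conj (x ^ half))                  ≡⟨ cong (λ u → D * (u * conj u)) (sym curve) ⟩
        D * (s * conj s)                                    ≡⟨ cong (λ u → D * (s * u)) conj-s ⟩
        D * (s * - s)                                       ≡⟨ solve 2 (λ D s → D :* (s :* :- s) := :- (D :* (s :* s))) refl D s ⟩
        - (D * (s * s))                                     ∎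
        where
        f = w + - (z * y′)
        conj-f : conj f ≡ w′ + - (z′ * y)
        conj-f = trans (conj-minus w (z * y′)) (cong₂ (λ u v → u + - v) conj-w (trans (conj-* z y′) (cong₂ _*_ conj-z conj-y′)))
      -- The norm of w - zy exceeds that of w - zy′ by Ds², identically in `a`, `b`, `c`, `d`. By
      -- `normed` it is therefore 0, so (y,1) is an eigenvector.
      w≡zy : w ≡ z * y
      w≡zy = x-y≡0⇒x≡y (norm≡0 (begin
        (w + - (z * y)) * conj (w + - (z * y))
          ≡⟨ cong ((w + - (z * y)) *_) (trans (conj-minus w (z * y)) (cong₂ (λ u v → u + - v) conj-w (trans (conj-* z y) (cong (_* y′) conj-z)))) ⟩
        (w + - (z * y)) * (w′ + - (z′ * y′))
          ≡⟨ solve 6 (λ a b c d y y′ → let z = c :* y :+ d ; z′ = c :* y′ :+ d ; w = a :* y :+ b ; w′ = a :* y′ :+ b ; s = y′ :- y in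
               (w :- z :* y) :* (w′ :- z′ :* y′) := (w :- z :* y′) :* (w′ :- z′ :* y) :+ (a :* d :- b :* c) :* (s :* s)) refl a b c d y y′ ⟩
        (w + - (z * y′)) * (w′ + - (z′ * y)) + D * (s * s)   ≡⟨ cong (_+ D * (s * s)) normed ⟩
        - (D * (s * s)) + D * (s * s)                        ≡⟨ -‿inverseˡ _ ⟩
        0#                                                   ∎))
      w′≡z′y′ : w′ ≡ z′ * y′
      w′≡z′y′ = trans (sym conj-w) (trans (cong conj w≡zy) (trans (conj-* z y) (cong (_* y′) conj-z)))
      D≡zz′ : D ≡ z * z′
      D≡zz′ = *-cancelʳ s≢0 (begin
        D * s                                    ≡⟨ solve 6 (λ a b c d y y′ → (a :* d :- b :* c) :* (y′ :- y) := (a :* y′ :+ b) :* (c :* y :+ d) :- (a :* y :+ b) :* (c :* y′ :+ d)) refl a b c d y y′ ⟩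
        w′ * z + - (w * z′)                      ≡⟨ cong₂ (λ u v → u * z + - (v * z′)) w′≡z′y′ w≡zy ⟩
        z′ * y′ * z + - (z * y * z′)             ≡⟨ solve 4 (λ z z′ y y′ → z′ :* y′ :* z :- z :* y :* z′ := z :* z′ :* (y′ :- y)) refl z z′ y y′ ⟩
        z * z′ * s                               ∎)
      z≢0 = proj₁ (factor-nonzero (sym D≡zz′) det≢0)
      z′≢0 = proj₂ (factor-nonzero (sym D≡zz′) det≢0)
      AT≡ : ∀ i → apply A (comb 1# V β W) i ≡ t * (z′ * z′) * V i + t * (β * (z * z′)) * W i
      AT≡ i = begin
        apply A (comb 1# V β W) i                      ≡⟨ apply-comb A 1# V β W i ⟩
        1# * apply A V i + β * apply A W i             ≡⟨ cong₂ (λ u v → 1# * u + β * v) (trans (A≡ V i) (cong (t *_) SV)) (trans (A≡ W i) (cong (t *_) SW)) ⟩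
        1# * (t * (z′ * z′ * V i)) + β * (t * (z * z′ * W i))
          ≡⟨ solve 6 (λ t z z′ β V W → 1ₑ :* (t :* (z′ :* z′ :* V)) :+ β :* (t :* (z :* z′ :* W)) := t :* (z′ :* z′) :* V :+ t :* (β :* (z :* z′)) :* W) refl t z z′ β (V i) (W i) ⟩
        t * (z′ * z′) * V i + t * (β * (z * z′)) * W i ∎
        where
        SV : apply (Std a b c d κ) V i ≡ z′ * z′ * V i
        SV = Std-eigen-affine a b c d κ 0# y′ z′ 0# refl w′≡z′y′ (trans (zeroʳ κ) (sym (zeroʳ (z′ * z′)))) i
        SW : apply (Std a b c d κ) W i ≡ z * z′ * W i
        SW = Std-eigen-polar a b c d κ y y′ z z′ refl w≡zy refl w′≡z′y′ i
      coefficients : m ≡ 0# × n + - (t * (z′ * z′)) ≡ 0# × n * - β + - (t * (β * (z * z′))) ≡ 0#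
      coefficients = indep m (n + - (t * (z′ * z′))) (n * - β + - (t * (β * (z * z′)))) (λ i → begin
        m * P i + (n + - (t * (z′ * z′))) * V i + (n * - β + - (t * (β * (z * z′)))) * W i
          ≡⟨ solve 8 (λ m n β f g P V W → m :* P :+ (n :- f) :* V :+ (n :* :- β :- g) :* W := (m :* P :+ n :* (1ₑ :* V :+ :- β :* W)) :- (f :* V :+ g :* W))
               refl m n β (t * (z′ * z′)) (t * (β * (z * z′))) (P i) (V i) (W i) ⟩
        (m * P i + n * comb 1# V (- β) W i) + - (t * (z′ * z′) * V i + t * (β * (z * z′)) * W i)
          ≡⟨ x≡y⇒x-y≡0 (trans (sym (e i)) (AT≡ i)) ⟩
        0# ∎)
      z≡-z′ : z ≡ - z′
      z≡-z′ = *-cancelˡ (*-nonzero (*-nonzero t≢0 β≢0) z′≢0) (begin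
        t * β * z′ * z              ≡⟨ solve 4 (λ t β z z′ → t :* β :* z′ :* z := t :* (β :* (z :* z′))) refl t β z z′ ⟩
        t * (β * (z * z′))          ≡⟨ sym (x-y≡0⇒x≡y (proj₂ (proj₂ coefficients))) ⟩
        n * - β                     ≡⟨ cong (_* - β) (x-y≡0⇒x≡y (proj₁ (proj₂ coefficients))) ⟩
        t * (z′ * z′) * - β         ≡⟨ solve 3 (λ t β z′ → t :* (z′ :* z′) :* :- β := t :* β :* z′ :* :- z′) refl t β z′ ⟩
        t * β * z′ * - z′           ∎)
      -- From z′ = -z the determinant zz′ is -z². As `k` is even, z^(2k) = (-z²)^k = D^k = 1, so z^q
      -- = z·z^(2k) = z.
      z′≡z : z′ ≡ z
      z′≡z = begin
        z′                          ≡⟨ sym conj-z ⟩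
        conj z                      ≡⟨ conj≡ z ⟩
        z * ((z ^ k) * (z ^ k))     ≡⟨ cong (z *_) (begin
          (z ^ k) * (z ^ k)           ≡⟨ sym (^-distrib-* z z k) ⟩
          (z * z) ^ k                 ≡⟨ sym (neg^k (z * z)) ⟩
          (- (z * z)) ^ k             ≡⟨ cong (_^ k) (trans (solve 1 (λ z → :- (z :* z) := z :* :- z) refl z) (cong (z *_) -z≡z′)) ⟩
          (z * z′) ^ k                ≡⟨ cong (_^ k) (sym D≡zz′) ⟩
          D ^ k                       ≡⟨ det^k ⟩
          1#                          ∎) ⟩
        z * 1#                      ≡⟨ *-identityʳ z ⟩
        z                           ∎
        where
        -z≡z′ : - z ≡ z′
        -z≡z′ = trans (cong -_ z≡-z′) (solve 1 (λ z → :- :- z := z) refl z′)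

    frame : Frame P
    frame = record
      { V = V ; W = W ; ν = ν ; η = η
      ; ν∈ = Fq-⁻¹ (inverseˡ 2≢0) Fq-2
      ; ν≢0 = ⁻¹-nonzero 2≢0
      ; η≢0 = *-nonzero 2≢0 (*-nonzero s≢0 s≢0)
      ; PP = PP ; PV = PV ; PW = PW ; VW = VW ; VV = VV ; WW = WW
      ; span = span ; indep = indep ; act = act ; unswapped = unswapped
      }

-- Transport of frames along orbits, and the two assertions on orbits.

module Orbits (K : Field) (p q k : ℕ) (E : QuadraticExtension K p q k) where
  open Field K
  open FieldAlgebra K
  open Geometry K p q
  open Matrices K p q
  open Lines K p q
  open QuadraticExtension E
  open Conjugation K p q k E
  open Group K p q k E
  open Hermitian K p q k E
  open Frames K p q k E
  open XPlusFrames K p q k E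
  open Solver

  orbit-trans : ∀ {P Q R} → Orbit 𝔊 P Q → Orbit 𝔊 Q R → Orbit 𝔊 P R
  orbit-trans {P} {Q} {R} (A , A∈ , AP∼Q) (B , B∈ , BQ∼R) = B ⊗ A , mul B∈ A∈ ,
    ∼-trans {apply (B ⊗ A) P} {apply B (apply A P)} {R} (≡⇒∼ (apply-⊗ B A P))
      (∼-trans {apply B (apply A P)} {apply B Q} {R} (apply-∼ B AP∼Q) BQ∼R)

  orbit-sym : ∀ {P Q} → Orbit 𝔊 P Q → Orbit 𝔊 Q P
  orbit-sym {P} {Q} (A , A∈ , AP∼Q) = let B , RB , BA , _ = rep-inverse (proj₂ (𝔊⇒rep A∈)) in
    B , rep⇒𝔊 RB , ∼-trans {apply B Q} {apply B (apply A P)} {P} (apply-∼ B (∼-sym AP∼Q)) (apply-inverse B A BA P)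

  inGo-orbit : ∀ {P Q l} → Orbit 𝔊 P Q → InGo Q l → InGo P l
  inGo-orbit {P} {Q} P↝Q (gl , w , w∈l , w≢0 , Q↝w) = gl , w , w∈l , w≢0 , orbit-trans {P} {Q} {w} P↝Q Q↝w

  partD-orbit : ∀ {P Q} → Orbit 𝔊 P Q → PartDAt P → PartDAt Q
  partD-orbit {P} {Q} P↝Q (transitive , l₁ , l₂ , l₁∈ , l₂∈ , apart , two) =
    (λ l l′ l∈ l′∈ → transitive l l′ (toP {l} l∈) (toP {l′} l′∈)) ,
    l₁ , l₂ , inGo-orbit {Q} {P} {l₁} Q↝P l₁∈ , inGo-orbit {Q} {P} {l₂} Q↝P l₂∈ , apart , λ l l∈ → two l (toP {l} l∈)
    where
    Q↝P = orbit-sym {P} {Q} P↝Q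
    toP : ∀ {l} → InGo Q l → InGo P l
    toP {l} = inGo-orbit {P} {Q} {l} P↝Q

  -- When x = 0 the curve equation puts `y` in F_q, and y ↦ (y₀y+1)/y, with y₀ the given value,
  -- takes infinity to that point. Its determinant is -1, so `κ` = -1 is admissible because h is
  -- odd.
  framed : ∀ {P} → InXplus P → ∃ λ Q → Frame Q × Orbit 𝔊 Q P
  framed {P} (inj₂ P∼P∞) = P∞ , frame∞ , Id , one , ∼-trans {apply Id P∞} {P∞} {P} (≡⇒∼ (apply-Id P∞)) (∼-sym P∼P∞)
  framed {P} (inj₁ (x , y , curve , P∼xy)) = decide (x ≟ 0#)
    where
    decide : Dec (x ≡ 0#) → ∃ λ Q → Frame Q × Orbit 𝔊 Q P
    decide (no x≢0) = affine x y , AffinePoint.frame x y x≢0 curve , Id , one ,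
      ∼-trans {apply Id (affine x y)} {affine x y} {P} (≡⇒∼ (apply-Id (affine x y))) (∼-sym P∼xy)
    decide (yes x≡0) = P∞ , frame∞ , S ,
      rep⇒𝔊 (rep-std y∈ Fq-1 Fq-1 Fq-0 (solve 1 (λ y → y :* 0ₑ :- 1ₑ :* 1ₑ := :- 1ₑ) refl y) (neg-nonzero 1≢0) -1^half (≃-refl S)) ,
      ∼-trans {apply S P∞} {affine x y} {P} (≡⇒∼ (λ i → trans (SP∞ i) (cong (λ x → affine x y i) (sym x≡0)))) (∼-sym P∼xy)
      where
      S = Std y 1# 1# 0# (- 1#)
      y∈ : InFq y
      y∈ = x-y≡0⇒x≡y (trans curve (trans (cong (_^ half) x≡0) 0^half))
      SP∞ : ∀ i → apply S P∞ i ≡ affine 0# y i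
      SP∞ = solveVec 1 (λ y → applyₑ (Stdₑ y 1ₑ 1ₑ 0ₑ (:- 1ₑ)) (vecₑ 0ₑ 0ₑ 0ₑ 1ₑ) , vecₑ 1ₑ 0ₑ y (y :* y)) (y ∷ []) refl refl refl

  partD : PartD
  partD P P∈ = let Q , F , Q↝P = framed P∈ in partD-orbit {Q} {P} Q↝P (AtFrame.partD F)

  -- The stabiliser element is conjugated by `A`; the character of `A` then occurs twice and
  -- cancels.
  odd-stabiliser-orbit : ∀ {P Q} → Orbit 𝔊 P Q → (∃ λ A → Rep (- 1#) A × apply A P ∼ P) → ∃ λ A → Rep (- 1#) A × apply A Q ∼ Q
  odd-stabiliser-orbit {P} {Q} (A , A∈ , AP∼Q) (S , RS , SP∼P) =
    let ε , RA = 𝔊⇒rep A∈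
        B , RB , BA , _ = rep-inverse RA
        BQ∼P = ∼-trans {apply B Q} {apply B (apply A P)} {P} (apply-∼ B (∼-sym AP∼Q)) (apply-inverse B A BA P)
    in A ⊗ (S ⊗ B) , subst (λ ε → Rep ε (A ⊗ (S ⊗ B))) (sign (rep-sign RA)) (rep-⊗ RA (rep-⊗ RS RB)) ,
       ∼-trans {apply (A ⊗ (S ⊗ B)) Q} {apply A (apply (S ⊗ B) Q)} {Q} (≡⇒∼ (apply-⊗ A (S ⊗ B) Q))
         (∼-trans {apply A (apply (S ⊗ B) Q)} {apply A P} {Q} (apply-∼ A (∼-trans {apply (S ⊗ B) Q} {apply S (apply B Q)} {P} (≡⇒∼ (apply-⊗ S B Q))
           (∼-trans {apply S (apply B Q)} {apply S P} {P} (apply-∼ S BQ∼P) SP∼P))) AP∼Q)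
    where
    sign : ∀ {ε} → ε ≡ 1# ⊎ ε ≡ - 1# → ε * (- 1# * ε) ≡ - 1#
    sign (inj₁ refl) = solve 0 (1ₑ :* (:- 1ₑ :* 1ₑ) := :- 1ₑ) refl
    sign (inj₂ refl) = solve 0 (:- 1ₑ :* (:- 1ₑ :* :- 1ₑ) := :- 1ₑ) refl

  -- If the element taking `P` to `Q` has character -1, it is preceded by an element of character -1
  -- fixing `P`.
  sameOrbits : SameOrbits
  sameOrbits P Q P∈ _ = toℌ , λ { (A , A∈ , AP∼Q) → A , ℌ⇒𝔊 A∈ , AP∼Q }
    where
    stabiliser : ∃ λ A → Rep (- 1#) A × apply A P ∼ P
    stabiliser = let R , F , R↝P = framed P∈ in odd-stabiliser-orbit {R} {P} R↝P (AtFrame.odd-stabiliser F)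
    by-sign : ∀ {ε A} → ε ≡ 1# ⊎ ε ≡ - 1# → Rep ε A → apply A P ∼ Q → Orbit ℌ P Q
    by-sign {A = A} (inj₁ refl) RA AP∼Q = A , rep⇒ℌ RA , AP∼Q
    by-sign {A = A} (inj₂ refl) RA AP∼Q = let S , RS , SP∼P = stabiliser in
      A ⊗ S , rep⇒ℌ (subst (λ ε → Rep ε (A ⊗ S)) -1*-1≡1 (rep-⊗ RA RS)) ,
      ∼-trans {apply (A ⊗ S) P} {apply A (apply S P)} {Q} (≡⇒∼ (apply-⊗ A S P)) (∼-trans {apply A (apply S P)} {apply A P} {Q} (apply-∼ A SP∼P) AP∼Q)
    toℌ : Orbit 𝔊 P Q → Orbit ℌ P Q
    toℌ (A , A∈ , AP∼Q) = let ε , RA = 𝔊⇒rep A∈ in by-sign (rep-sign RA) RA AP∼Q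

open import Data.Nat using (_^_; _*_; _%_; _≤_)

theorem5p13 : (p e : ℕ) → Prime p → p ≢ 2 → 1 ≤ e → (p ^ e) % 4 ≡ 1 →
    (K : Field) → Field.Carrier K ↔ Fin (p ^ e * p ^ e) →
    Geometry.Theorem5p13 K p (p ^ e)
theorem5p13 p e p-prime p≢2 1≤e q%4≡1 K enum = (indexTwo , sameOrbits) , partD
  where
  r = p ^ e / 4
  q≡1+4r : p ^ e ≡ suc ((r ℕ.+ r) ℕ.+ (r ℕ.+ r))
  q≡1+4r = trans (m≡m%n+[m/n]*n (p ^ e) 4) (cong₂ ℕ._+_ q%4≡1
    (solve 1 (λ r → r :* con 4 := (r :+ r) :+ (r :+ r)) refl r))
    where open Data.Nat.Solver.+-*-Solver
  1<q : 1 ℕ.< p ^ e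
  1<q = ℕₚ.≤-trans (ℕ.nonTrivial⇒n>1 p {{prime⇒nonTrivial p-prime}})
    (subst (_≤ p ^ e) (ℕₚ.*-identityʳ p) (ℕₚ.^-monoʳ-≤ p {{ℕ.nonTrivial⇒nonZero p {{prime⇒nonTrivial p-prime}}}} 1≤e))
  -- Since e ≥ 1, q exceeds 1; this makes k = 2r and q²-1 positive, as the existence of roots
  -- requires.
  0<r : 0 ℕ.< r
  0<r = ℕₚ.n≢0⇒n>0 (λ r≡0 → ℕₚ.<-irrefl (sym (trans q≡1+4r (cong (λ r → suc ((r ℕ.+ r) ℕ.+ (r ℕ.+ r))) r≡0))) 1<q)
  E = quadraticExtension K p e p-prime p≢2 r q≡1+4r 0<r enum
  open Group K p (p ^ e) (r ℕ.+ r) E using (indexTwo)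
  open Orbits K p (p ^ e) (r ℕ.+ r) E using (sameOrbits; partD)
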